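{- Let $k\geq t+2\geq 4$, $n\geq 7(k-t+1)k^2$ and let $d\geq 2$ be an integer. If $\mathcal{F}\subseteq\binom{[n]}{k}$ is a $t$-intersecting family with $$|\mathcal{F}|\geq\binom{n-t}{k-t}-\binom{n-t-d}{k-t}+t\binom{n-t-d}{k-t-d+1},$$ then either $\gamma_t(\mathcal{F})\leq t\binom{n-t-d}{k-t-d+1}$, that is, there exists a $t$-subset $X$ of $[n]$ such that $|\mathcal{F}\setminus\mathcal{F}[X]|\leq t\binom{n-t-d}{k-t-d+1}$, or $d\leq t+2$ and $\mathcal{F}\subseteq\mathcal{A}(Z)$ for some $Z\in\binom{[n]}{t+2}$. Moreover, if $2\leq d\leq k-t+1$, then in the former case, equality $\gamma_t(\mathcal{F})=t\binom{n-t-d}{k-t-d+1}$ holds if and only if $\mathcal{F}\cong\mathcal{L}(n,k,t,d,d)$.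
   Context: $n,k,t$ are positive integers, $[n]=\{1,\dots,n\}$, and $\binom{[n]}{k}$ is the family of all $k$-subsets of $[n]$. Binomial coefficients $\binom{a}{b}$ are $0$ when $b<0$ or $a<b$. A family $\mathcal{F}$ is $t$-intersecting if $|F\cap F'|\ge t$ for all $F,F'\in\mathcal{F}$. $\mathcal{F}[X]=\{F\in\mathcal{F}:X\subseteq F\}$; $\Delta_t(\mathcal{F})=\max\{|\mathcal{F}[S]|:S\in\binom{[n]}{t}\}$, and the $t$-diversity is $\gamma_t(\mathcal{F}):=|\mathcal{F}|-\Delta_t(\mathcal{F})$. Two families are isomorphic ($\cong$) if they are the same up to a permutation of $[n]$. For $Z\in\binom{[n]}{t+2}$, $\mathcal{A}(Z)=\{F\in\binom{[n]}{k}:|F\cap Z|\geq t+1\}$. For $X\in\binom{[n]}{t}$, $U\in\binom{[n]}{t+u}$ and $V\in\binom{[n]}{t+v}$ with $X\subseteq U\cap V$, $$\mathcal{L}(X,U,V)=\left\{F\in\binom{[n]}{k}:X\subseteq F,\ F\cap(V\setminus X)\neq\emptyset\right\}\cup\left\{F\in\binom{[n]}{k}:F\cap U=U\setminus\{x\}\text{ for some }x\in X\right\},$$ and $\mathcal{L}(n,k,t,u,v)=\mathcal{L}([t],[t+u],[t+v])$. -}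

module Defs where

open import Data.Bool.Base using (true; false)
open import Data.Fin.Base using (toℕ)
open import Data.Fin.Permutation using (Permutation′; _⟨$⟩ˡ_)
open import Data.Fin.Subset as Sub using (Subset; inside; outside; ∣_∣; _─_; _-_; Nonempty)
open import Data.Fin.Subset.Properties using (_⊆?_)
open import Data.Integer.Base using (ℤ; +_; -[1+_])
open import Data.List.Base using (List; []; [_]; _∷_; _++_; map; filter; length)
open import Data.List.Extrema.Nat using (max)
open import Data.Nat.Base using (ℕ; zero; suc; _+_; _∸_; _≤_; _≥_)
open import Data.Nat.Combinatorics using (_C_)
open import Data.Nat.Properties using (_≟_; _<?_)
open import Data.Product.Base using (_×_; ∃)
open import Data.Sum.Base using (_⊎_)
open import Data.Vec.Base as Vec using (tabulate; lookup)
open import Function.Bundles using (_⇔_)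
open import Level using (0ℓ)
open import Relation.Binary.PropositionalEquality.Core using (_≡_)
open import Relation.Nullary.Decidable.Core using (does)
open import Relation.Unary using (Pred; Decidable; _∩_; _∖_)
open import Relation.Unary.Properties using (_∩?_; ∁?)

private
  variable
    n : ℕ

-- The binomial coefficient with integer arguments, 0 when b < 0 or a < b
-- (`a C b` already vanishes for a < b).
binom : ℤ → ℤ → ℕ
binom (+ a)    (+ b)    = a C b
binom (+ a)    -[1+ b ] = 0
binom -[1+ a ] b        = 0

-- The ground set [n] is Fin n, so that the paper's element i is the
-- element of Fin n with value i ∸ 1.  A family of subsets is a predicate;
-- its cardinality is taken with respect to a decision procedure for it.
Family : ℕ → Set₁
Family n = Pred (Subset n) 0ℓ

subsets : ∀ n → List (Subset n)
subsets zero    = [ Vec.[] ]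
subsets (suc n) = map (outside Vec.∷_) (subsets n) ++ map (inside Vec.∷_) (subsets n)

size : {F : Family n} → Decidable F → ℕ
size {n} F? = length (filter F? (subsets n))

_-subsets : ℕ → Family n
(k -subsets) A = ∣ A ∣ ≡ k

_-intersecting_ : ℕ → Family n → Set
t -intersecting F = ∀ {A B} → F A → F B → ∣ A Sub.∩ B ∣ ≥ t

-- The members of F containing X.
_⟨_⟩ : Family n → Subset n → Family n
F ⟨ X ⟩ = F ∩ (X Sub.⊆_)

_⟨_⟩? : {F : Family n} → Decidable F → (X : Subset n) → Decidable (F ⟨ X ⟩)
F? ⟨ X ⟩? = F? ∩? (X ⊆?_)

_∖?_ : {F G : Family n} → Decidable F → Decidable G → Decidable (F ∖ G)
F? ∖? G? = F? ∩? ∁? G?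

Δ : ℕ → {F : Family n} → Decidable F → ℕ
Δ {n} t F? = max 0 (map (λ S → size (F? ⟨ S ⟩?)) (filter (λ S → ∣ S ∣ ≟ t) (subsets n)))

-- The subtraction never truncates, as F ⟨ S ⟩ is contained in F.
γ : ℕ → {F : Family n} → Decidable F → ℕ
γ t F? = size F? ∸ Δ t F?

-- The image of A under π: i lies in it iff π⁻¹ i lies in A.
image : Permutation′ n → Subset n → Subset n
image π A = tabulate (λ i → lookup A (π ⟨$⟩ˡ i))

infix 4 _≅_
_≅_ : Family n → Family n → Set
F ≅ G = ∃ λ π → ∀ A → F A ⇔ G (image π A)

𝒜 : (k t : ℕ) → Subset n → Family n
𝒜 k t Z F = ∣ F ∣ ≡ k × ∣ F Sub.∩ Z ∣ ≥ t + 1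

ℒ : (k : ℕ) (X U V : Subset n) → Family n
ℒ k X U V F =
  ∣ F ∣ ≡ k ×
  ( (X Sub.⊆ F × Nonempty (F Sub.∩ (V ─ X)))
  ⊎ (∃ λ x → x Sub.∈ X × F Sub.∩ U ≡ U - x))

-- The paper's [m] ⊆ [n]; it has m elements when m ≤ n.
initial : ∀ n → ℕ → Subset n
initial n m = tabulate (λ i → does (toℕ i <? m))

ℒ[_,_,_,_,_] : (n k t u v : ℕ) → Family n
ℒ[ n , k , t , u , v ] = ℒ k (initial n t) (initial n (t + u)) (initial n (t + v))

-- Write m = k − t, and let cᵢ be the number of k-sets containing a given (t + i)-set; the hypothesis on n gives
-- c₁ ≥ 7k²c₂, so that all comparisons reduce to comparing the coefficients of c₁, and then those of c₂.
--
-- Peeling: enlarge F, as a family of sets of size at most k, to a maximal t-intersecting one, split off its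
-- minimal members of the top size t + j, and repeat one level lower.  Two such members meet in t points, and a
-- proper subset of one of them fails to t-intersect some member; extending it point by point through this obstacle
-- shows that there are at most C(t + j, j) (j + 1)^j of them.  So F lies above a t-intersecting family of sets of
-- size at most t + 1, up to O(t² c₂) exceptions; as |F| ≥ 3c₁ − O(c₂), either F is contained in 𝒜(Z) for some Z
-- or some t-set X has |F[X]| > c₁ + (m + 1)²c₂.
--
-- In the latter case every other member of F misses exactly one point of X, and if D is the set of points outside X
-- common to all of them, then F[X] has at most |D|c₁ + (m + 1)²c₂ members and F ∖ F[X] at most
-- t C(n − t − |D|, k − t − |D| + 1).  The size of F forces |D| ≥ d, unless |D| = 2 and F ⊆ 𝒜(X ∪ D).
-- If γ attains its bound then |D| = d and F ⊆ ℒ(X, X ∪ D, X ∪ D), and the two families have the same size.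

module Submission where

open import Defs
open import Data.Empty using (⊥; ⊥-elim)
import Data.Bool.Properties as Boolₚ
open import Data.Fin.Base using (Fin; zero; suc; toℕ; fromℕ<; punchIn)
import Data.Fin.Properties as Finₚ
open import Data.Fin.Permutation as Perm using (Permutation′; _⟨$⟩ˡ_; _⟨$⟩ʳ_)
open import Data.Fin.Subset as Sub using (Subset; inside; outside; ∣_∣; _─_; _-_; _∈_; _∉_; _∩_; _∪_; ⁅_⁆; ∁; Nonempty)
open import Data.Fin.Subset.Properties
open import Data.Integer.Base as ℤ using ()
import Data.Integer.Properties as ℤₚ
open import Data.List.Base using (List; []; _∷_; _++_; map; filter; length)
open import Data.List.Extrema.Nat using (argmax-sel; xs≤max)
import Data.List.Properties as Listₚ
open import Data.List.Membership.Propositional as Mem using () renaming (_∈_ to _∈ₗ_)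
open import Data.List.Membership.Propositional.Properties
  using (∈-map⁺; ∈-map⁻; ∈-++⁺ˡ; ∈-++⁺ʳ; ∈-filter⁺; ∈-filter⁻)
open import Data.List.Relation.Unary.All as All using (All)
open import Data.List.Relation.Unary.Any as Any using (Any; here; there)
open import Data.Nat.Base hiding (∣_-_∣)
open import Data.Nat.Combinatorics using (_C_; nCn≡1; nC1≡n; nCk≡nC[n∸k]; nCk+nC[k+1]≡[n+1]C[k+1]; k>n⇒nCk≡0)
open import Data.Nat.Properties
open import Data.Nat.Tactic.RingSolver using (solve-∀)
open import Data.Product.Base using (_×_; ∃; _,_; proj₁; proj₂)
open import Data.Sum.Base as Sum using (_⊎_; inj₁; inj₂; [_,_]′)
open import Data.Vec.Base as Vec using (lookup)
import Data.Vec.Properties as Vecₚ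
open import Function.Base using (_∘_; id)
open import Function.Bundles using (_⇔_; mk⇔; Equivalence)
open import Level using (0ℓ)
open import Relation.Binary.PropositionalEquality
  using (_≡_; refl; sym; trans; cong; cong₂; subst; subst₂; module ≡-Reasoning)
open import Relation.Nullary using (¬_; Dec; yes; no; does; contradiction)
open import Relation.Nullary.Decidable using (_×-dec_; _⊎-dec_; ¬?; decidable-stable; dec-true; dec-false)
open import Relation.Unary using (Pred; Decidable; _⊆_; _∖_)

-- The constant 7 has to beat the loss in the peeling. The sets of size t + 2 cost 9 C(t + 2, 2) c₂,
-- and decay by a factor 4 from level to level turns this into 6 (t + 1)(t + 2) c₂ altogether; this
-- 6 is the largest coefficient in any comparison of c₂ terms. The factor m + 1 in the bound on n
-- serves two ratios: c₁/c₂ = (n - t - 1)/(m - 1), and the quotient of consecutive levels, which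
-- contains a factor j + 2 ≤ m + 1. The obstacle is a kernel D of two points. If |D| ≥ 3, the
-- members outside F[X] number at most t c₂, and |F| reveals |D|. If |D| = 2, they may be of order t
-- c₁, as large as the main term. But then a member of F[X] that avoids D would obstruct all of them
-- and make them few, and without such a member the whole family lies in 𝒜(X ∪ D). For d = 2 the
-- same summand, with t ≥ 2, is what lifts |F| from about 2c₁ to about 3c₁.

private
  variable
    n : ℕ
    P Q R : Family n

-- Counting families

filter-mono : ∀ {A : Set} {P Q : Pred A 0ℓ} (P? : Decidable P) (Q? : Decidable Q) →
  P ⊆ Q → ∀ xs → length (filter P? xs) ≤ length (filter Q? xs)
filter-mono P? Q? P⊆Q [] = z≤n
filter-mono P? Q? P⊆Q (x ∷ xs) with P? x | Q? x | filter-mono P? Q? P⊆Q xs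
... | yes _ | yes _ | le = s≤s le
... | yes p | no ¬q | _  = contradiction (P⊆Q p) ¬q
... | no  _ | yes _ | le = m≤n⇒m≤1+n le
... | no  _ | no  _ | le = le

filter-rigid : ∀ {A : Set} {P Q : Pred A 0ℓ} (P? : Decidable P) (Q? : Decidable Q) →
  P ⊆ Q → ∀ xs → length (filter Q? xs) ≤ length (filter P? xs) →
  ∀ {x} → x ∈ₗ xs → Q x → P x
filter-rigid P? Q? P⊆Q (x ∷ xs) le x∈ q with P? x | Q? x
filter-rigid P? Q? P⊆Q (x ∷ xs) le (here refl) q | yes p | _ = p
filter-rigid P? Q? P⊆Q (x ∷ xs) le (there x∈)  q | yes _ | yes _ =
  filter-rigid P? Q? P⊆Q xs (s≤s⁻¹ le) x∈ q
filter-rigid P? Q? P⊆Q (x ∷ xs) le (there x∈)  q | yes p | no ¬q = contradiction (P⊆Q p) ¬q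
filter-rigid P? Q? P⊆Q (x ∷ xs) le x∈ q | no _ | yes _ =
  contradiction (≤-trans le (filter-mono P? Q? P⊆Q xs)) (n≮n _)
filter-rigid P? Q? P⊆Q (x ∷ xs) le (here refl) q | no _ | no ¬q = contradiction q ¬q
filter-rigid P? Q? P⊆Q (x ∷ xs) le (there x∈)  q | no _ | no _ =
  filter-rigid P? Q? P⊆Q xs le x∈ q

filter-cover : ∀ {A : Set} {P Q R : Pred A 0ℓ}
  (P? : Decidable P) (Q? : Decidable Q) (R? : Decidable R) →
  (∀ {x} → P x → Q x ⊎ R x) →
  ∀ xs → length (filter P? xs) ≤ length (filter Q? xs) + length (filter R? xs)
filter-cover P? Q? R? cov [] = z≤n
filter-cover P? Q? R? cov (x ∷ xs)
  with P? x | Q? x | R? x | filter-cover P? Q? R? cov xs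
... | yes _ | yes _ | yes _ | le = s≤s (≤-trans le (+-monoʳ-≤ _ (n≤1+n _)))
... | yes _ | yes _ | no  _ | le = s≤s le
... | yes _ | no  _ | yes _ | le = ≤-trans (s≤s le) (≤-reflexive (sym (+-suc _ _)))
... | yes p | no ¬q | no ¬r | _  = ⊥-elim ([ ¬q , ¬r ]′ (cov p))
... | no  _ | yes _ | yes _ | le = m≤n⇒m≤1+n (≤-trans le (+-monoʳ-≤ _ (n≤1+n _)))
... | no  _ | yes _ | no  _ | le = m≤n⇒m≤1+n le
... | no  _ | no  _ | yes _ | le = ≤-trans le (+-monoʳ-≤ _ (n≤1+n _))
... | no  _ | no  _ | no  _ | le = le

filter-split : ∀ {A : Set} {P Q R : Pred A 0ℓ}
  (P? : Decidable P) (Q? : Decidable Q) (R? : Decidable R) →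
  Q ⊆ P → R ⊆ P → (∀ {x} → Q x → ¬ R x) →
  ∀ xs → length (filter Q? xs) + length (filter R? xs) ≤ length (filter P? xs)
filter-split P? Q? R? q⊆p r⊆p disj [] = z≤n
filter-split P? Q? R? q⊆p r⊆p disj (x ∷ xs)
  with P? x | Q? x | R? x | filter-split P? Q? R? q⊆p r⊆p disj xs
... | _     | yes q | yes r | _  = contradiction r (disj q)
... | yes _ | yes _ | no  _ | le = s≤s le
... | yes _ | no  _ | yes _ | le = ≤-trans (≤-reflexive (+-suc _ _)) (s≤s le)
... | yes _ | no  _ | no  _ | le = m≤n⇒m≤1+n le
... | no ¬p | yes q | no  _ | _  = contradiction (q⊆p q) ¬p
... | no ¬p | no  _ | yes r | _  = contradiction (r⊆p r) ¬p
... | no  _ | no  _ | no  _ | le = le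

length-filter-map : ∀ {A B : Set} {P : Pred B 0ℓ} (P? : Decidable P) (f : A → B) xs →
  length (filter P? (map f xs)) ≡ length (filter (P? ∘ f) xs)
length-filter-map P? f [] = refl
length-filter-map P? f (x ∷ xs) with P? (f x)
... | yes _ = cong suc (length-filter-map P? f xs)
... | no  _ = length-filter-map P? f xs

∈-subsets : (S : Subset n) → S ∈ₗ subsets n
∈-subsets Vec.[] = here refl
∈-subsets (outside Vec.∷ S) = ∈-++⁺ˡ (∈-map⁺ _ (∈-subsets S))
∈-subsets {suc n} (inside Vec.∷ S) =
  ∈-++⁺ʳ (map (outside Vec.∷_) (subsets n)) (∈-map⁺ _ (∈-subsets S))

size-mono : (P? : Decidable P) (Q? : Decidable Q) → P ⊆ Q → size P? ≤ size Q?
size-mono {n} P? Q? P⊆Q = filter-mono P? Q? P⊆Q (subsets n)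

size-rigid : (P? : Decidable P) (Q? : Decidable Q) → P ⊆ Q → size Q? ≤ size P? → Q ⊆ P
size-rigid {n} P? Q? P⊆Q le {S} = filter-rigid P? Q? P⊆Q (subsets n) le (∈-subsets S)

size-cover : (P? : Decidable P) (Q? : Decidable Q) (R? : Decidable R) →
  (∀ {S} → P S → Q S ⊎ R S) → size P? ≤ size Q? + size R?
size-cover {n} P? Q? R? cov = filter-cover P? Q? R? cov (subsets n)

size≤⟨⟩+∖ : {F : Family n} (F? : Decidable F) (X : Subset n) →
  size F? ≤ size (F? ⟨ X ⟩?) + size (F? ∖? (F? ⟨ X ⟩?))
size≤⟨⟩+∖ {F = F} F? X = size-cover F? (F? ⟨ X ⟩?) (F? ∖? (F? ⟨ X ⟩?)) (λ {S} → split S)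
  where
  split : ∀ S → F S → (F ⟨ X ⟩) S ⊎ (F ∖ (F ⟨ X ⟩)) S
  split S FS with (F? ⟨ X ⟩?) S
  ... | yes p = inj₁ p
  ... | no ¬p = inj₂ (FS , ¬p)

size-split : (P? : Decidable P) (Q? : Decidable Q) (R? : Decidable R) →
  Q ⊆ P → R ⊆ P → (∀ {S} → Q S → ¬ R S) → size Q? + size R? ≤ size P?
size-split {n} P? Q? R? q⊆p r⊆p disj = filter-split P? Q? R? q⊆p r⊆p disj (subsets n)

size-empty : (P? : Decidable P) → (∀ {S} → ¬ P S) → size P? ≡ 0
size-empty {n} P? none = cong length (Listₚ.filter-none P? (All.universal (λ _ → none) (subsets n)))

size-∷ : {P : Family (suc n)} (P? : Decidable P) →
  size P? ≡ size (P? ∘ (outside Vec.∷_)) + size (P? ∘ (inside Vec.∷_))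
size-∷ {n} P? = begin
  length (filter P? (map (outside Vec.∷_) (subsets n) ++ map (inside Vec.∷_) (subsets n)))
    ≡⟨ cong length (Listₚ.filter-++ P? (map (outside Vec.∷_) (subsets n)) _) ⟩
  length (filter P? (map (outside Vec.∷_) (subsets n)) ++ filter P? (map (inside Vec.∷_) (subsets n)))
    ≡⟨ Listₚ.length-++ (filter P? (map (outside Vec.∷_) (subsets n))) ⟩
  _ ≡⟨ cong₂ _+_ (length-filter-map P? _ (subsets n)) (length-filter-map P? _ (subsets n)) ⟩
  _ ∎
  where open ≡-Reasoning

-- A union bound with the index set given as a list, so that it serves for sets of points and for
-- sets of subsets alike.
size-⋃ : ∀ {I : Set} {Q : I → Family n} (P? : Decidable P) (Q? : ∀ i → Decidable (Q i)) c (is : List I) →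
  (∀ {S} → P S → ∃ λ i → i ∈ₗ is × Q i S) →
  (∀ i → i ∈ₗ is → size (Q? i) ≤ c) →
  size P? ≤ length is * c
size-⋃ P? Q? c [] cov bd = ≤-reflexive (size-empty P? λ p → contradiction (proj₁ (proj₂ (cov p))) λ ())
size-⋃ {P = P} {Q = Q} P? Q? c (i ∷ is) cov bd = ≤-trans
  (size-cover P? (Q? i) rest? (λ {S} → split S))
  (+-mono-≤ (bd i (here refl)) (size-⋃ rest? Q? c is Mem.find (λ j j∈ → bd j (there j∈))))
  where
  rest? : Decidable (λ S → Any (λ j → Q j S) is)
  rest? S = Any.any? (λ j → Q? j S) is
  split : ∀ S → P S → Q i S ⊎ Any (λ j → Q j S) is
  split S p with cov p
  ... | _ , here refl , q = inj₁ q
  ... | j , there j∈  , q = inj₂ (Mem.lose j∈ q)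

elems : Subset n → List (Fin n)
elems Vec.[] = []
elems (inside  Vec.∷ Y) = zero ∷ map suc (elems Y)
elems (outside Vec.∷ Y) = map suc (elems Y)

length-elems : (Y : Subset n) → length (elems Y) ≡ ∣ Y ∣
length-elems Vec.[] = refl
length-elems (inside  Vec.∷ Y) = cong suc (trans (Listₚ.length-map suc (elems Y)) (length-elems Y))
length-elems (outside Vec.∷ Y) = trans (Listₚ.length-map suc (elems Y)) (length-elems Y)

∈-elems⁺ : {Y : Subset n} {y : Fin n} → y ∈ Y → y ∈ₗ elems Y
∈-elems⁺ Vec.here = here refl
∈-elems⁺ {Y = inside  Vec.∷ Y} (Vec.there y∈) = there (∈-map⁺ suc (∈-elems⁺ y∈))
∈-elems⁺ {Y = outside Vec.∷ Y} (Vec.there y∈) = ∈-map⁺ suc (∈-elems⁺ y∈)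

∈-elems⁻ : {Y : Subset n} {y : Fin n} → y ∈ₗ elems Y → y ∈ Y
∈-elems⁻ {Y = inside Vec.∷ Y} (here refl) = Vec.here
∈-elems⁻ {Y = inside Vec.∷ Y} (there y∈) with ∈-map⁻ suc y∈
... | _ , z∈ , refl = Vec.there (∈-elems⁻ z∈)
∈-elems⁻ {Y = outside Vec.∷ Y} y∈ with ∈-map⁻ suc y∈
... | _ , z∈ , refl = Vec.there (∈-elems⁻ z∈)

size-⋃-∈ : ∀ {Q : Fin n → Family n} (P? : Decidable P) (Q? : ∀ y → Decidable (Q y)) c (Y : Subset n) →
  (∀ {S} → P S → ∃ λ y → y ∈ Y × Q y S) →
  (∀ y → y ∈ Y → size (Q? y) ≤ c) →
  size P? ≤ ∣ Y ∣ * c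
size-⋃-∈ P? Q? c Y cov bd = subst (λ l → size P? ≤ l * c) (length-elems Y)
  (size-⋃ P? Q? c (elems Y)
    (λ p → let y , y∈ , q = cov p in y , ∈-elems⁺ y∈ , q)
    (λ y y∈ → bd y (∈-elems⁻ y∈)))

-- Finite sets and intervals of k-sets

x∈p─q⇒x∉q : ∀ {x : Fin n} (p q : Subset n) → x ∈ p ─ q → x ∉ q
x∈p─q⇒x∉q (_ Vec.∷ p) (outside Vec.∷ q) (Vec.there x∈) (Vec.there x∈q) = x∈p─q⇒x∉q p q x∈ x∈q
x∈p─q⇒x∉q (_ Vec.∷ p) (inside  Vec.∷ q) (Vec.there x∈) (Vec.there x∈q) = x∈p─q⇒x∉q p q x∈ x∈q

∣p∩q∣+∣p─q∣≡∣p∣ : (p q : Subset n) → ∣ p ∩ q ∣ + ∣ p ─ q ∣ ≡ ∣ p ∣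
∣p∩q∣+∣p─q∣≡∣p∣ Vec.[] Vec.[] = refl
∣p∩q∣+∣p─q∣≡∣p∣ (outside Vec.∷ p) (outside Vec.∷ q) = ∣p∩q∣+∣p─q∣≡∣p∣ p q
∣p∩q∣+∣p─q∣≡∣p∣ (outside Vec.∷ p) (inside  Vec.∷ q) = ∣p∩q∣+∣p─q∣≡∣p∣ p q
∣p∩q∣+∣p─q∣≡∣p∣ (inside  Vec.∷ p) (outside Vec.∷ q) = trans (+-suc _ _) (cong suc (∣p∩q∣+∣p─q∣≡∣p∣ p q))
∣p∩q∣+∣p─q∣≡∣p∣ (inside  Vec.∷ p) (inside  Vec.∷ q) = cong suc (∣p∩q∣+∣p─q∣≡∣p∣ p q)

∣p∪q∣≡∣p∣+∣q─p∣ : (p q : Subset n) → ∣ p ∪ q ∣ ≡ ∣ p ∣ + ∣ q ─ p ∣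
∣p∪q∣≡∣p∣+∣q─p∣ Vec.[] Vec.[] = refl
∣p∪q∣≡∣p∣+∣q─p∣ (outside Vec.∷ p) (outside Vec.∷ q) = ∣p∪q∣≡∣p∣+∣q─p∣ p q
∣p∪q∣≡∣p∣+∣q─p∣ (outside Vec.∷ p) (inside  Vec.∷ q) = trans (cong suc (∣p∪q∣≡∣p∣+∣q─p∣ p q)) (sym (+-suc _ _))
∣p∪q∣≡∣p∣+∣q─p∣ (inside  Vec.∷ p) (outside Vec.∷ q) = cong suc (∣p∪q∣≡∣p∣+∣q─p∣ p q)
∣p∪q∣≡∣p∣+∣q─p∣ (inside  Vec.∷ p) (inside  Vec.∷ q) = cong suc (∣p∪q∣≡∣p∣+∣q─p∣ p q)

disjoint⇒∣p∪q∣≡∣p∣+∣q∣ : (p q : Subset n) → (∀ {x} → x ∈ q → x ∉ p) → ∣ p ∪ q ∣ ≡ ∣ p ∣ + ∣ q ∣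
disjoint⇒∣p∪q∣≡∣p∣+∣q∣ p q disjoint = trans (∣p∪q∣≡∣p∣+∣q─p∣ p q) (cong (λ r → ∣ p ∣ + ∣ r ∣)
  (⊆-antisym (p─q⊆p q p) (λ x∈ → x∈p∧x∉q⇒x∈p─q x∈ (disjoint x∈))))

p⊆q∧∣q∣≤∣p∣⇒p≡q : (p q : Subset n) → p Sub.⊆ q → ∣ q ∣ ≤ ∣ p ∣ → p ≡ q
p⊆q∧∣q∣≤∣p∣⇒p≡q Vec.[] Vec.[] _ _ = refl
p⊆q∧∣q∣≤∣p∣⇒p≡q (outside Vec.∷ p) (outside Vec.∷ q) p⊆q le =
  cong (outside Vec.∷_) (p⊆q∧∣q∣≤∣p∣⇒p≡q p q (drop-∷-⊆ p⊆q) le)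
p⊆q∧∣q∣≤∣p∣⇒p≡q (outside Vec.∷ p) (inside Vec.∷ q) p⊆q le =
  contradiction (≤-trans le (p⊆q⇒∣p∣≤∣q∣ (drop-∷-⊆ p⊆q))) (n≮n _)
p⊆q∧∣q∣≤∣p∣⇒p≡q (inside Vec.∷ p) (outside Vec.∷ q) p⊆q le with p⊆q Vec.here
... | ()
p⊆q∧∣q∣≤∣p∣⇒p≡q (inside Vec.∷ p) (inside Vec.∷ q) p⊆q le =
  cong (inside Vec.∷_) (p⊆q∧∣q∣≤∣p∣⇒p≡q p q (drop-∷-⊆ p⊆q) (s≤s⁻¹ le))

x∈p⇒suc∣p-x∣≡∣p∣ : {p : Subset n} {x : Fin n} → x ∈ p → suc ∣ p - x ∣ ≡ ∣ p ∣
x∈p⇒suc∣p-x∣≡∣p∣ {p = inside Vec.∷ p} Vec.here = cong (suc ∘ ∣_∣) (p─⊥≡p p)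
x∈p⇒suc∣p-x∣≡∣p∣ {p = inside  Vec.∷ p} (Vec.there x∈) = cong suc (x∈p⇒suc∣p-x∣≡∣p∣ x∈)
x∈p⇒suc∣p-x∣≡∣p∣ {p = outside Vec.∷ p} (Vec.there x∈) = x∈p⇒suc∣p-x∣≡∣p∣ x∈

x∉p⇒∣p∪⁅x⁆∣≡suc∣p∣ : {p : Subset n} {x : Fin n} → x ∉ p → ∣ p ∪ ⁅ x ⁆ ∣ ≡ suc ∣ p ∣
x∉p⇒∣p∪⁅x⁆∣≡suc∣p∣ {p = inside  Vec.∷ p} {zero} x∉ = contradiction Vec.here x∉
x∉p⇒∣p∪⁅x⁆∣≡suc∣p∣ {p = outside Vec.∷ p} {zero} x∉ = cong (suc ∘ ∣_∣) (∪-identityʳ p)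
x∉p⇒∣p∪⁅x⁆∣≡suc∣p∣ {p = inside  Vec.∷ p} {suc x} x∉ = cong suc (x∉p⇒∣p∪⁅x⁆∣≡suc∣p∣ (x∉ ∘ Vec.there))
x∉p⇒∣p∪⁅x⁆∣≡suc∣p∣ {p = outside Vec.∷ p} {suc x} x∉ = x∉p⇒∣p∪⁅x⁆∣≡suc∣p∣ (x∉ ∘ Vec.there)

interpolate : ∀ (A B : Subset n) c → A Sub.⊆ B → ∣ A ∣ ≤ c → c ≤ ∣ B ∣ →
  ∃ λ C → A Sub.⊆ C × C Sub.⊆ B × ∣ C ∣ ≡ c
interpolate Vec.[] Vec.[] zero _ _ _ = Vec.[] , id , id , refl
interpolate (inside Vec.∷ A) (outside Vec.∷ B) c A⊆B _ _ with A⊆B Vec.here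
... | ()
interpolate (inside Vec.∷ A) (inside Vec.∷ B) (suc c) A⊆B lo hi
  with interpolate A B c (drop-∷-⊆ A⊆B) (s≤s⁻¹ lo) (s≤s⁻¹ hi)
... | C , A⊆C , C⊆B , eq = inside Vec.∷ C , s⊆s A⊆C , s⊆s C⊆B , cong suc eq
interpolate (outside Vec.∷ A) (outside Vec.∷ B) c A⊆B lo hi
  with interpolate A B c (drop-∷-⊆ A⊆B) lo hi
... | C , A⊆C , C⊆B , eq = outside Vec.∷ C , s⊆s A⊆C , s⊆s C⊆B , eq
-- The extra point is spent only if the rest of `B` cannot supply `c` points; then `c` is the size
-- of the whole upper set.
interpolate (outside Vec.∷ A) (inside Vec.∷ B) c A⊆B lo hi with c ≤? ∣ B ∣
... | yes c≤ with interpolate A B c (drop-∷-⊆ A⊆B) lo c≤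
...   | C , A⊆C , C⊆B , eq = outside Vec.∷ C , s⊆s A⊆C , out⊆ C⊆B , eq
interpolate (outside Vec.∷ A) (inside Vec.∷ B) c A⊆B lo hi | no c≰ =
  inside Vec.∷ B , A⊆B , id , ≤-antisym (≰⇒> c≰) hi

t-subset : ∀ (p : Subset n) t → t ≤ ∣ p ∣ → ∃ λ X → X Sub.⊆ p × ∣ X ∣ ≡ t
t-subset {n} p t t≤ =
  let X , _ , X⊆ , X≡ = interpolate Sub.⊥ p t ⊥⊆ (≤-trans (≤-reflexive (∣⊥∣≡0 n)) z≤n) t≤ in X , X⊆ , X≡

∪⁅⁆⊆ : ∀ {A S : Subset n} {y} → A Sub.⊆ S → y ∈ S → A ∪ ⁅ y ⁆ Sub.⊆ S
∪⁅⁆⊆ {A = A} {S} {y} A⊆S y∈S z∈ =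
  [ A⊆S , (λ z∈y → subst (_∈ S) (sym (x∈⁅y⁆⇒x≡y y z∈y)) y∈S) ]′ (x∈p∪q⁻ A ⁅ y ⁆ z∈)

-- Indexing by ∣ U ∣ ∸ k rather than by k ∸ ∣ A ∣ makes the count vanish, as it should, when k < ∣ A ∣.
Interval : ℕ → Subset n → Subset n → Family n
Interval k A U S = ∣ S ∣ ≡ k × A Sub.⊆ S × S Sub.⊆ U

Interval? : ∀ k (A U : Subset n) → Decidable (Interval k A U)
Interval? k A U S = ∣ S ∣ ≟ k ×-dec A ⊆? S ×-dec S ⊆? U

zero∉outside∷ : {p : Subset n} → zero ∉ (outside Vec.∷ p)
zero∉outside∷ ()

size-cong : (P? : Decidable P) (Q? : Decidable Q) → P ⊆ Q → Q ⊆ P → size P? ≡ size Q?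
size-cong P? Q? P⊆Q Q⊆P = ≤-antisym (size-mono P? Q? P⊆Q) (size-mono Q? P? Q⊆P)

nC0≡1 : ∀ n → n C 0 ≡ 1
nC0≡1 n = trans (nCk≡nC[n∸k] {k = 0} {n = n} z≤n) (nCn≡1 n)

-- A member is determined by the points of `U ─ A` that it omits. A point of `U` outside `A` may be
-- omitted or kept, which is Pascal's rule.
size-Interval : ∀ k (A U : Subset n) → A Sub.⊆ U → k ≤ ∣ U ∣ →
  size (Interval? k A U) ≡ (∣ U ∣ ∸ ∣ A ∣) C (∣ U ∣ ∸ k)
size-Interval .0 Vec.[] Vec.[] A⊆U z≤n = refl
size-Interval k (inside Vec.∷ A) (outside Vec.∷ U) A⊆U k≤ with A⊆U Vec.here
... | ()
size-Interval k (outside Vec.∷ A) (outside Vec.∷ U) A⊆U k≤ = begin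
  size (Interval? k (outside Vec.∷ A) (outside Vec.∷ U)) ≡⟨ size-∷ (Interval? k (outside Vec.∷ A) (outside Vec.∷ U)) ⟩
  _ ≡⟨ cong₂ _+_
         (size-cong (Interval? k (outside Vec.∷ A) (outside Vec.∷ U) ∘ (outside Vec.∷_)) (Interval? k A U)
           (λ (e , l , u) → e , drop-∷-⊆ l , drop-∷-⊆ u) (λ (e , l , u) → e , s⊆s l , s⊆s u))
         (size-empty (Interval? k (outside Vec.∷ A) (outside Vec.∷ U) ∘ (inside Vec.∷_)) λ (e , l , u) → zero∉outside∷ (u Vec.here)) ⟩
  size (Interval? k A U) + 0 ≡⟨ +-identityʳ _ ⟩
  size (Interval? k A U) ≡⟨ size-Interval k A U (drop-∷-⊆ A⊆U) k≤ ⟩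
  _ ∎
  where
  open ≡-Reasoning
size-Interval k (inside Vec.∷ A) (inside Vec.∷ U) A⊆U k≤ = begin
  size (Interval? k (inside Vec.∷ A) (inside Vec.∷ U)) ≡⟨ size-∷ (Interval? k (inside Vec.∷ A) (inside Vec.∷ U)) ⟩
  _ ≡⟨ cong (_+ size (Interval? k (inside Vec.∷ A) (inside Vec.∷ U) ∘ (inside Vec.∷_)))
         (size-empty (Interval? k (inside Vec.∷ A) (inside Vec.∷ U) ∘ (outside Vec.∷_)) λ (e , l , u) → zero∉outside∷ (l Vec.here)) ⟩
  size (Interval? k (inside Vec.∷ A) (inside Vec.∷ U) ∘ (inside Vec.∷_)) ≡⟨ go k k≤ ⟩
  _ ∎
  where
  open ≡-Reasoning
  go : ∀ k → k ≤ suc ∣ U ∣ →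
    size (Interval? k (inside Vec.∷ A) (inside Vec.∷ U) ∘ (inside Vec.∷_)) ≡ (∣ U ∣ ∸ ∣ A ∣) C (suc ∣ U ∣ ∸ k)
  go zero _ = trans (size-empty (Interval? 0 (inside Vec.∷ A) (inside Vec.∷ U) ∘ (inside Vec.∷_)) λ { (() , _) })
    (sym (k>n⇒nCk≡0 (s≤s (m∸n≤m ∣ U ∣ ∣ A ∣))))
  go (suc k) (s≤s k≤) = trans
    (size-cong (Interval? (suc k) (inside Vec.∷ A) (inside Vec.∷ U) ∘ (inside Vec.∷_)) (Interval? k A U)
      (λ (e , l , u) → suc-injective e , drop-∷-⊆ l , drop-∷-⊆ u) (λ (e , l , u) → cong suc e , s⊆s l , s⊆s u))
    (size-Interval k A U (drop-∷-⊆ A⊆U) k≤)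
size-Interval k (outside Vec.∷ A) (inside Vec.∷ U) A⊆U k≤ = begin
  size (Interval? k (outside Vec.∷ A) (inside Vec.∷ U)) ≡⟨ size-∷ (Interval? k (outside Vec.∷ A) (inside Vec.∷ U)) ⟩
  _ ≡⟨ cong (_+ size (Interval? k (outside Vec.∷ A) (inside Vec.∷ U) ∘ (inside Vec.∷_)))
         (size-cong (Interval? k (outside Vec.∷ A) (inside Vec.∷ U) ∘ (outside Vec.∷_)) (Interval? k A U)
           (λ (e , l , u) → e , drop-∷-⊆ l , drop-∷-⊆ u) (λ (e , l , u) → e , s⊆s l , out⊆ u)) ⟩
  size (Interval? k A U) + size (Interval? k (outside Vec.∷ A) (inside Vec.∷ U) ∘ (inside Vec.∷_)) ≡⟨ go k k≤ ⟩
  (suc (∣ U ∣ ∸ ∣ A ∣)) C (suc ∣ U ∣ ∸ k) ≡⟨ cong (_C (suc ∣ U ∣ ∸ k)) (sym (+-∸-assoc 1 (p⊆q⇒∣p∣≤∣q∣ A⊆′U))) ⟩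
  _ ∎
  where
  open ≡-Reasoning
  A⊆′U : A Sub.⊆ U
  A⊆′U = drop-∷-⊆ A⊆U
  inner : ∀ k → k ≤ ∣ U ∣ →
    size (Interval? (suc k) (outside Vec.∷ A) (inside Vec.∷ U) ∘ (inside Vec.∷_)) ≡ (∣ U ∣ ∸ ∣ A ∣) C (∣ U ∣ ∸ k)
  inner k k≤ = trans
    (size-cong (Interval? (suc k) (outside Vec.∷ A) (inside Vec.∷ U) ∘ (inside Vec.∷_)) (Interval? k A U)
      (λ (e , l , u) → suc-injective e , drop-∷-⊆ l , drop-∷-⊆ u)
      (λ (e , l , u) → cong suc e , out⊆ l , s⊆s u))
    (size-Interval k A U A⊆′U k≤)
  go : ∀ k → k ≤ suc ∣ U ∣ →
    size (Interval? k A U) + size (Interval? k (outside Vec.∷ A) (inside Vec.∷ U) ∘ (inside Vec.∷_))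
      ≡ suc (∣ U ∣ ∸ ∣ A ∣) C (suc ∣ U ∣ ∸ k)
  go zero _ = begin
    _ ≡⟨ cong₂ _+_ (size-Interval 0 A U A⊆′U z≤n) (size-empty (Interval? 0 (outside Vec.∷ A) (inside Vec.∷ U) ∘ (inside Vec.∷_)) λ { (() , _) }) ⟩
    (∣ U ∣ ∸ ∣ A ∣) C ∣ U ∣ + 0
      ≡⟨ cong ((∣ U ∣ ∸ ∣ A ∣) C ∣ U ∣ +_) (sym (k>n⇒nCk≡0 (s≤s (m∸n≤m ∣ U ∣ ∣ A ∣)))) ⟩
    (∣ U ∣ ∸ ∣ A ∣) C ∣ U ∣ + (∣ U ∣ ∸ ∣ A ∣) C suc ∣ U ∣ ≡⟨ nCk+nC[k+1]≡[n+1]C[k+1] (∣ U ∣ ∸ ∣ A ∣) ∣ U ∣ ⟩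
    _ ∎
  go (suc k) (s≤s k≤) with m≤n⇒m<n∨m≡n k≤
  ... | inj₁ k<U = begin
    _ ≡⟨ cong₂ _+_ (size-Interval (suc k) A U A⊆′U k<U) (inner k k≤) ⟩
    (∣ U ∣ ∸ ∣ A ∣) C (∣ U ∣ ∸ suc k) + (∣ U ∣ ∸ ∣ A ∣) C (∣ U ∣ ∸ k)
      ≡⟨ cong (λ j → (∣ U ∣ ∸ ∣ A ∣) C (∣ U ∣ ∸ suc k) + (∣ U ∣ ∸ ∣ A ∣) C j) eq ⟩
    _ ≡⟨ nCk+nC[k+1]≡[n+1]C[k+1] (∣ U ∣ ∸ ∣ A ∣) (∣ U ∣ ∸ suc k) ⟩
    _ ≡⟨ cong (suc (∣ U ∣ ∸ ∣ A ∣) C_) (sym eq) ⟩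
    _ ∎
    where eq : ∣ U ∣ ∸ k ≡ suc (∣ U ∣ ∸ suc k)
          eq = +-∸-assoc 1 {∣ U ∣} {suc k} k<U
  -- The only member is now the whole upper set: there is none without the new point and one with
  -- it.
  ... | inj₂ refl = begin
    _ ≡⟨ cong₂ _+_ (size-empty (Interval? (suc k) A U) λ (e , l , u) → n≮n _ (≤-trans (≤-reflexive (sym e)) (p⊆q⇒∣p∣≤∣q∣ u))) (inner k ≤-refl) ⟩
    (k ∸ ∣ A ∣) C (k ∸ k) ≡⟨ cong ((k ∸ ∣ A ∣) C_) (n∸n≡0 k) ⟩
    (k ∸ ∣ A ∣) C 0 ≡⟨ trans (nC0≡1 (k ∸ ∣ A ∣)) (sym (nC0≡1 (suc (k ∸ ∣ A ∣)))) ⟩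
    suc (k ∸ ∣ A ∣) C 0 ≡⟨ cong (suc (k ∸ ∣ A ∣) C_) (sym (n∸n≡0 k)) ⟩
    _ ∎

-- Where the hypotheses of `size-Interval` fail the interval is empty, so the bound holds whatever
-- truncated subtraction makes of the right-hand side.
size-Interval≤ : ∀ k (A U : Subset n) → size (Interval? k A U) ≤ (∣ U ∣ ∸ ∣ A ∣) C (∣ U ∣ ∸ k)
size-Interval≤ k A U with A ⊆? U | k ≤? ∣ U ∣
... | yes A⊆U | yes k≤ = ≤-reflexive (size-Interval k A U A⊆U k≤)
... | no A⊈U  | _      = ≤-trans (≤-reflexive (size-empty (Interval? k A U) λ (_ , l , u) → A⊈U (⊆-trans l u))) z≤n
... | yes _   | no k≰  = ≤-trans
  (≤-reflexive (size-empty (Interval? k A U) λ (e , _ , u) → k≰ (subst (_≤ ∣ U ∣) e (p⊆q⇒∣p∣≤∣q∣ u)))) z≤n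

─-Empty⇒⊆ : {p q : Subset n} → ¬ Nonempty (p ─ q) → p Sub.⊆ q
─-Empty⇒⊆ {p = p} {q} none {x} x∈p with x ∈? q
... | yes x∈q = x∈q
... | no  x∉q = contradiction (x , x∈p∧x∉q⇒x∈p─q x∈p x∉q) none

size-Interval-⊤≤ : ∀ (A : Subset n) k → size (Interval? k A Sub.⊤) ≤ (n ∸ ∣ A ∣) C (n ∸ k)
size-Interval-⊤≤ {n} A k = subst (λ u → size (Interval? k A Sub.⊤) ≤ (u ∸ ∣ A ∣) C (u ∸ k)) (∣⊤∣≡n n) (size-Interval≤ k A Sub.⊤)

size-⊇≤ : ∀ {P : Family n} (P? : Decidable P) k (A : Subset n) →
  (∀ {S} → P S → ∣ S ∣ ≡ k × A Sub.⊆ S) → size P? ≤ (n ∸ ∣ A ∣) C (n ∸ k)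
size-⊇≤ P? k A P⊆ = ≤-trans
  (size-mono P? (Interval? k A Sub.⊤) (λ p → let e , A⊆S = P⊆ p in e , A⊆S , λ _ → ∈⊤))
  (size-Interval-⊤≤ A k)

size-Interval-∁⁅⁆≤ : ∀ k (A : Subset n) x → size (Interval? k A (∁ ⁅ x ⁆)) ≤ (n ∸ suc ∣ A ∣) C (n ∸ suc k)
size-Interval-∁⁅⁆≤ {n} k A x = ≤-trans (size-Interval≤ k A (∁ ⁅ x ⁆)) (≤-reflexive (begin
  (∣ ∁ ⁅ x ⁆ ∣ ∸ ∣ A ∣) C (∣ ∁ ⁅ x ⁆ ∣ ∸ k)
    ≡⟨ cong (λ u → (u ∸ ∣ A ∣) C (u ∸ k)) (trans (∣∁p∣≡n∸∣p∣ ⁅ x ⁆) (cong (n ∸_) (∣⁅x⁆∣≡1 x))) ⟩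
  (n ∸ 1 ∸ ∣ A ∣) C (n ∸ 1 ∸ k) ≡⟨ cong₂ _C_ (∸-+-assoc n 1 ∣ A ∣) (∸-+-assoc n 1 k) ⟩
  (n ∸ suc ∣ A ∣) C (n ∸ suc k) ∎))
  where open ≡-Reasoning

-- Peeling

-- Any (t − 1)-set E with A ∩ B ⊆ E ⊆ B leaves a transversal Y = B ─ E of the sets meeting B in t points.
blocker : ∀ (A B : Subset n) t j → ∣ B ∣ ≤ t + j → ∣ A ∩ B ∣ < t →
  ∃ λ Y → ∣ Y ∣ ≤ suc j × (∀ {y} → y ∈ Y → y ∈ B × y ∉ A) ×
    (∀ S → t ≤ ∣ S ∩ B ∣ → ∃ λ y → y ∈ Y × y ∈ S)
blocker {n} A B (suc t) j B≤ (s≤s AB≤t) with t ≤? ∣ B ∣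
-- `B` is too small for any set to meet it as required, so the empty transversal will do.
... | no t≰B = Sub.⊥ , ≤-trans (≤-reflexive (∣⊥∣≡0 n)) z≤n , (λ y∈ → contradiction y∈ ∉⊥) ,
  λ S t≤ → contradiction (≤-trans (n≤1+n _) (≤-trans t≤ (∣p∩q∣≤∣q∣ S B))) t≰B
... | yes t≤B with interpolate (A ∩ B) B t (p∩q⊆q A B) AB≤t t≤B
...   | E , AB⊆E , E⊆B , refl = B ─ E , Y≤ , Y-mem , meets
  where
  E∩B : B ∩ E ≡ E
  E∩B = ⊆-antisym (p∩q⊆q B E) (λ x∈ → x∈p∩q⁺ (E⊆B x∈ , x∈))
  Y≤ : ∣ B ─ E ∣ ≤ suc j
  Y≤ = +-cancelˡ-≤ ∣ E ∣ _ _ (begin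
    ∣ E ∣ + ∣ B ─ E ∣     ≡⟨ cong (λ D → ∣ D ∣ + ∣ B ─ E ∣) (sym E∩B) ⟩
    ∣ B ∩ E ∣ + ∣ B ─ E ∣ ≡⟨ ∣p∩q∣+∣p─q∣≡∣p∣ B E ⟩
    ∣ B ∣                 ≤⟨ B≤ ⟩
    suc (∣ E ∣ + j)       ≡⟨ sym (+-suc ∣ E ∣ j) ⟩
    ∣ E ∣ + suc j         ∎)
    where open ≤-Reasoning
  Y-mem : ∀ {y} → y ∈ B ─ E → y ∈ B × y ∉ A
  Y-mem y∈ = p─q⊆p B E y∈ , λ y∈A → x∈p─q⇒x∉q B E y∈ (AB⊆E (x∈p∩q⁺ (y∈A , p─q⊆p B E y∈)))
  meets : ∀ S → suc ∣ E ∣ ≤ ∣ S ∩ B ∣ → ∃ λ y → y ∈ B ─ E × y ∈ S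
  meets S le with nonempty? ((S ∩ B) ─ E)
  ... | no none = contradiction (p⊆q⇒∣p∣≤∣q∣ (─-Empty⇒⊆ none)) (<⇒≱ le)
  ... | yes (y , y∈) = let y∈S , y∈B = x∈p∩q⁻ S B (p─q⊆p (S ∩ B) E y∈) in
    y , x∈p∧x∉q⇒x∈p─q y∈B (x∈p─q⇒x∉q (S ∩ B) E y∈) , y∈S

infix 4 _≟ₛ_
_≟ₛ_ : (A B : Subset n) → Dec (A ≡ B)
_≟ₛ_ = Vecₚ.≡-dec Boolₚ._≟_

module _ (t : ℕ) where

  Conflict : Family n → Subset n → Set
  Conflict T S = ∃ λ B → T B × ∣ S ∩ B ∣ < t

  -- Sets of fewer than `t` points are exempt: they fail to t-intersect themselves and could not be
  -- added even to an empty family.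
  Saturated : ℕ → Family n → Subset n → Set
  Saturated s T S = ∣ S ∣ ≤ s → t ≤ ∣ S ∣ → T S ⊎ Conflict T S

  conflict? : ∀ {T : Family n} → Decidable T → Decidable (Conflict T)
  conflict? T? S = anySubset? (λ B → T? B ×-dec ∣ S ∩ B ∣ <? t)

  -- A greedy pass over the list suffices, since a conflict persists when the family grows.
  saturate-along : ∀ s {T : Family n} → Decidable T → t -intersecting T → (∀ {S} → T S → ∣ S ∣ ≤ s) →
    (xs : List (Subset n)) →
    ∃ λ (T⁺ : Family n) → Decidable T⁺ × T ⊆ T⁺ × t -intersecting T⁺ × (∀ {S} → T⁺ S → ∣ S ∣ ≤ s) ×
      (∀ {S} → S ∈ₗ xs → Saturated s T⁺ S)
  saturate-along s {T} T? int bd [] = T , T? , id , int , bd , λ ()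
  saturate-along {n} s T? int bd (x ∷ xs) with saturate-along s T? int bd xs
  ... | T⁺ , T⁺? , T⊆ , int⁺ , bd⁺ , sat with ∣ x ∣ ≤? s | t ≤? ∣ x ∣ | conflict? T⁺? x
  ...   | no x≰s | _ | _ = T⁺ , T⁺? , T⊆ , int⁺ , bd⁺ , λ
    { (here refl) x≤s _ → contradiction x≤s x≰s ; (there S∈) → sat S∈ }
  ...   | yes _ | no t≰x | _ = T⁺ , T⁺? , T⊆ , int⁺ , bd⁺ , λ
    { (here refl) _ t≤x → contradiction t≤x t≰x ; (there S∈) → sat S∈ }
  ...   | yes _ | yes _ | yes c = T⁺ , T⁺? , T⊆ , int⁺ , bd⁺ , λ
    { (here refl) _ _ → inj₂ c ; (there S∈) → sat S∈ }
  ...   | yes x≤s | yes t≤x | no ¬c =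
    (λ S → T⁺ S ⊎ S ≡ x) , (λ S → T⁺? S ⊎-dec S ≟ₛ x) , inj₁ ∘ T⊆ ,
    (λ {A} {B} → int′ A B) , (λ { (inj₁ p) → bd⁺ p ; (inj₂ refl) → x≤s }) , sat′
    where
    agree : ∀ B → T⁺ B → t ≤ ∣ x ∩ B ∣
    agree B b = ≮⇒≥ (λ lt → ¬c (B , b , lt))
    int′ : ∀ A B → T⁺ A ⊎ A ≡ x → T⁺ B ⊎ B ≡ x → t ≤ ∣ A ∩ B ∣
    int′ A B (inj₁ a) (inj₁ b) = int⁺ a b
    int′ A _ (inj₁ a) (inj₂ refl) = subst (λ I → t ≤ ∣ I ∣) (∩-comm x A) (agree A a)
    int′ _ B (inj₂ refl) (inj₁ b) = agree B b
    int′ _ _ (inj₂ refl) (inj₂ refl) = subst (λ I → t ≤ ∣ I ∣) (sym (∩-idem x)) t≤x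
    sat′ : ∀ {S} → S ∈ₗ x ∷ xs → Saturated s (λ S → T⁺ S ⊎ S ≡ x) S
    sat′ (here refl) _ _ = inj₁ (inj₂ refl)
    sat′ (there S∈) S≤s t≤S with sat S∈ S≤s t≤S
    ... | inj₁ p = inj₁ (inj₁ p)
    ... | inj₂ (B , b , lt) = inj₂ (B , inj₁ b , lt)

  module Minimal {T : Family n} (T? : Decidable T) (int : t -intersecting T) (j : ℕ)
    (bd : ∀ {S} → T S → ∣ S ∣ ≤ t + j) (sat : ∀ S → Saturated (t + j) T S) where

    HasProper : Subset n → Set
    HasProper S = ∃ λ V → V Sub.⊂ S × T V

    W : Family n
    W S = T S × ∣ S ∣ ≡ t + j × ¬ HasProper S

    W? : Decidable W
    W? S = T? S ×-dec ∣ S ∣ ≟ t + j ×-dec ¬? (anySubset? (λ V → V ⊂? S ×-dec T? V))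

    -- `e` is the number of points that `X` still lacks. If `T X`, minimality forbids a member of
    -- `W` above `X`. Otherwise saturation yields a `B` in conflict with `X`, and each member of `W`
    -- above `X` contains one of the at most j + 1 points of a transversal.
    size-W⟨_⟩ : ∀ X e → t ≤ ∣ X ∣ → ∣ X ∣ + e ≡ t + j → size (W? ⟨ X ⟩?) ≤ suc j ^ e
    size-W⟨ X ⟩ zero t≤X eq = ≤-trans
      (size-⊇≤ (W? ⟨ X ⟩?) (t + j) X (λ ((_ , e , _) , X⊆S) → e , X⊆S))
      (≤-reflexive (trans (cong (λ a → (n ∸ a) C (n ∸ (t + j))) (trans (sym (+-identityʳ _)) eq)) (nCn≡1 (n ∸ (t + j)))))
    size-W⟨ X ⟩ (suc e) t≤X eq with sat X (≤-trans (m≤m+n _ _) (≤-reflexive eq)) t≤X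
    ... | inj₁ TX = ≤-trans (≤-reflexive (size-empty (W? ⟨ X ⟩?) none)) z≤n
      where
      none : ∀ {S} → ¬ (W ⟨ X ⟩) S
      none {S} ((_ , S≡ , ¬proper) , X⊆S) with nonempty? (S ─ X)
      ... | yes (x , x∈) = ¬proper (X , (X⊆S , x , p─q⊆p S X x∈ , x∈p─q⇒x∉q S X x∈) , TX)
      ... | no  S⊆X = n≮n ∣ X ∣ (begin-strict
        ∣ X ∣         <⟨ m<m+n ∣ X ∣ z<s ⟩
        ∣ X ∣ + suc e ≡⟨ trans eq (sym S≡) ⟩
        ∣ S ∣         ≤⟨ p⊆q⇒∣p∣≤∣q∣ (─-Empty⇒⊆ S⊆X) ⟩
        ∣ X ∣         ∎)
        where open ≤-Reasoning
    ... | inj₂ (B , TB , lt) with blocker X B t j (bd TB) lt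
    ...   | Y , Y≤ , Y-mem , meets = ≤-trans
      (size-⋃-∈ (W? ⟨ X ⟩?) (λ y → W? ⟨ X ∪ ⁅ y ⁆ ⟩?) (suc j ^ e) Y
        (λ {S} (w , X⊆S) → let y , y∈Y , y∈S = meets S (int (proj₁ w) TB) in
          y , y∈Y , w , ∪⁅⁆⊆ X⊆S y∈S)
        (λ y y∈Y → let eq′ = x∉p⇒∣p∪⁅x⁆∣≡suc∣p∣ (proj₂ (Y-mem y∈Y)) in
          size-W⟨ X ∪ ⁅ y ⁆ ⟩ e (≤-trans t≤X (≤-trans (n≤1+n _) (≤-reflexive (sym eq′))))
            (trans (cong (_+ e) eq′) (trans (sym (+-suc ∣ X ∣ e)) eq))))
      (*-monoˡ-≤ (suc j ^ e) Y≤)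

    size-W : size W? ≤ ((t + j) C j) * suc j ^ j
    size-W with anySubset? W?
    ... | no none = ≤-trans (≤-reflexive (size-empty W? (λ {S} w → none (S , w)))) z≤n
    ... | yes (S₁ , T₁ , S₁≡ , _) = ≤-trans
      (size-⋃ W? (λ X → W? ⟨ X ⟩?) (suc j ^ j) (filter (Interval? t Sub.⊥ S₁) (subsets n))
        (λ {S} w → let X , X⊆I , X≡ = t-subset (S ∩ S₁) t (int (proj₁ w) T₁) in
          X , ∈-filter⁺ (Interval? t Sub.⊥ S₁) (∈-subsets X) (X≡ , ⊥⊆ , ⊆-trans X⊆I (p∩q⊆q S S₁)) ,
          w , ⊆-trans X⊆I (p∩q⊆p S S₁))
        (λ X X∈ → let X≡ , _ = proj₂ (∈-filter⁻ (Interval? t Sub.⊥ S₁) {xs = subsets n} X∈) in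
          size-W⟨ X ⟩ j (≤-reflexive (sym X≡)) (cong (_+ j) X≡)))
      (*-monoˡ-≤ (suc j ^ j) (≤-trans (size-Interval≤ t Sub.⊥ S₁) (≤-reflexive
        (cong₂ _C_ (trans (cong₂ _∸_ S₁≡ (∣⊥∣≡0 n)) refl) (trans (cong (_∸ t) S₁≡) (m+n∸m≡n t j))))))

    module _ (k : ℕ) where
      Above : Family n
      Above A = ∣ A ∣ ≡ k × ∃ λ V → W V × V Sub.⊆ A

      Above? : Decidable Above
      Above? A = ∣ A ∣ ≟ k ×-dec anySubset? (λ V → W? V ×-dec V ⊆? A)

      size-Above : size Above? ≤ ((t + j) C j) * suc j ^ j * ((n ∸ (t + j)) C (n ∸ k))
      size-Above = ≤-trans
        (size-⋃ Above? (λ V → Interval? k V Sub.⊤) _ (filter W? (subsets n))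
          (λ (e , V , w , V⊆A) → V , ∈-filter⁺ W? (∈-subsets V) w , e , V⊆A , λ _ → ∈⊤)
          (λ V V∈ → let _ , e , _ = proj₂ (∈-filter⁻ W? {xs = subsets n} V∈) in
            ≤-trans (size-Interval-⊤≤ V k) (≤-reflexive (cong (λ a → (n ∸ a) C (n ∸ k)) e))))
        (*-monoˡ-≤ _ size-W)

  module _ {n : ℕ} (k : ℕ) where

    level : ℕ → ℕ
    level j = ((t + j) C j) * suc j ^ j * ((n ∸ (t + j)) C (n ∸ k))

    -- Peeling stops at sets of size t + 1, so the sum runs over the levels from 2 to j + 1.
    levels : ℕ → ℕ
    levels zero    = 0
    levels (suc j) = levels j + level (2 + j)

    -- The members of T lying above W are the price of lowering the bound on the sizes by one.
    peel : ∀ j {T : Family n} → Decidable T → t -intersecting T → (∀ {S} → T S → ∣ S ∣ ≤ t + suc j) →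
      ∃ λ (T₁ : Family n) → Decidable T₁ × t -intersecting T₁ × (∀ {S} → T₁ S → ∣ S ∣ ≤ t + 1) ×
      ∃ λ (Q : Family n) → ∃ λ (Q? : Decidable Q) → size Q? ≤ levels j ×
        (∀ {V A} → T V → ∣ A ∣ ≡ k → V Sub.⊆ A → (∃ λ V₁ → T₁ V₁ × V₁ Sub.⊆ A) ⊎ Q A)
    peel zero {T} T? int bd = T , T? , int , bd , (λ _ → ⊥) , (λ _ → no id) ,
      ≤-reflexive (size-empty {n} {λ _ → ⊥} (λ _ → no id) id) , λ {V} TV _ V⊆A → inj₁ (V , TV , V⊆A)
    -- Saturation is redone at every level: a set may owe its conflict to a member of the top size
    -- that has just been discarded.
    peel (suc j) {T} T? int bd with saturate-along (t + (2 + j)) T? int bd (subsets n)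
    ... | T⁺ , T⁺? , T⊆T⁺ , int⁺ , bd⁺ , sat
      with peel j {λ S → T⁺ S × ∣ S ∣ ≤ t + suc j} (λ S → T⁺? S ×-dec ∣ S ∣ ≤? t + suc j)
             (λ (a , _) (b , _) → int⁺ a b) proj₂
    ...   | T₁ , T₁? , int₁ , bd₁ , Q , Q? , Q≤ , cov =
      T₁ , T₁? , int₁ , bd₁ , Q′ , Q′? ,
      ≤-trans (size-cover Q′? Q? (Above? k) id) (+-mono-≤ Q≤ (size-Above k)) ,
      λ {V} {A} TV A≡ V⊆A → cov⁺ V A (T⊆T⁺ TV) A≡ V⊆A
      where
      open Minimal T⁺? int⁺ (2 + j) bd⁺ (λ S → sat (∈-subsets S))
      Q′ : Family n
      Q′ A = Q A ⊎ Above k A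
      Q′? : Decidable Q′
      Q′? A = Q? A ⊎-dec Above? k A
      low : ∀ V A → T⁺ V → ∣ A ∣ ≡ k → V Sub.⊆ A → ∣ V ∣ ≤ t + suc j → (∃ λ V₁ → T₁ V₁ × V₁ Sub.⊆ A) ⊎ Q′ A
      low V A TV A≡ V⊆A V≤ with cov {V} {A} (TV , V≤) A≡ V⊆A
      ... | inj₁ v = inj₁ v
      ... | inj₂ q = inj₂ (inj₁ q)
      cov⁺ : ∀ V A → T⁺ V → ∣ A ∣ ≡ k → V Sub.⊆ A → (∃ λ V₁ → T₁ V₁ × V₁ Sub.⊆ A) ⊎ Q′ A
      cov⁺ V A TV A≡ V⊆A with m≤n⇒m<n∨m≡n (bd⁺ TV)
      ... | inj₁ V< = low V A TV A≡ V⊆A (s≤s⁻¹ (≤-trans V< (≤-reflexive (+-suc t (suc j)))))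
      ... | inj₂ V≡ with anySubset? (λ U → U ⊂? V ×-dec T⁺? U)
      ...   | no ¬proper = inj₂ (inj₂ (A≡ , V , (TV , V≡ , ¬proper) , V⊆A))
      -- A top-size set that is not minimal gives way to a proper subset, which still lies below
      -- `A`.
      ...   | yes (U , U⊂V , TU) = low U A TU A≡ (⊆-trans (p⊂q⇒p⊆q U⊂V) V⊆A)
        (s≤s⁻¹ (≤-trans (p⊂q⇒∣p∣<∣q∣ U⊂V) (≤-reflexive (trans V≡ (+-suc t (suc j))))))

-- Binomial estimates

[k+1]*[n+1]C[k+1]≡[n+1]*nCk : ∀ n k → suc k * (suc n C suc k) ≡ suc n * (n C k)
[k+1]*[n+1]C[k+1]≡[n+1]*nCk zero zero = refl
[k+1]*[n+1]C[k+1]≡[n+1]*nCk zero (suc k) = begin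
  (2 + k) * (1 C (2 + k)) ≡⟨ cong ((2 + k) *_) (k>n⇒nCk≡0 {n = 1} {k = 2 + k} (s≤s (s≤s z≤n))) ⟩
  (2 + k) * 0             ≡⟨ *-zeroʳ (2 + k) ⟩
  1 * 0                   ≡⟨ cong (1 *_) (sym (k>n⇒nCk≡0 {n = 0} {k = suc k} (s≤s z≤n))) ⟩
  1 * (0 C suc k)         ∎
  where open ≡-Reasoning
[k+1]*[n+1]C[k+1]≡[n+1]*nCk (suc n) zero = begin
  1 * ((2 + n) C 1)       ≡⟨ cong (1 *_) (nC1≡n (2 + n)) ⟩
  1 * (2 + n)             ≡⟨ *-comm 1 (2 + n) ⟩
  (2 + n) * 1             ≡⟨ cong ((2 + n) *_) (sym (nC0≡1 (suc n))) ⟩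
  (2 + n) * (suc n C 0)   ∎
  where open ≡-Reasoning
[k+1]*[n+1]C[k+1]≡[n+1]*nCk (suc n) (suc k) = begin
  (2 + k) * ((2 + n) C (2 + k))
    ≡⟨ cong ((2 + k) *_) (sym (nCk+nC[k+1]≡[n+1]C[k+1] (suc n) (suc k))) ⟩
  (2 + k) * (suc n C suc k + suc n C (2 + k))
    ≡⟨ lemma₁ k (suc n C suc k) (suc n C (2 + k)) ⟩
  suc n C suc k + (suc k * (suc n C suc k) + (2 + k) * (suc n C (2 + k)))
    ≡⟨ cong (suc n C suc k +_) (cong₂ _+_ ([k+1]*[n+1]C[k+1]≡[n+1]*nCk n k) ([k+1]*[n+1]C[k+1]≡[n+1]*nCk n (suc k))) ⟩
  suc n C suc k + (suc n * (n C k) + suc n * (n C suc k))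
    ≡⟨ cong (suc n C suc k +_) (sym (*-distribˡ-+ (suc n) (n C k) (n C suc k))) ⟩
  suc n C suc k + suc n * (n C k + n C suc k)
    ≡⟨ cong (λ c → suc n C suc k + suc n * c) (nCk+nC[k+1]≡[n+1]C[k+1] n k) ⟩
  (2 + n) * (suc n C suc k) ∎
  where
  open ≡-Reasoning
  lemma₁ : ∀ k a b → (2 + k) * (a + b) ≡ a + ((1 + k) * a + (2 + k) * b)
  lemma₁ = solve-∀

nCk≤[n+1]Ck : ∀ n k → n C k ≤ suc n C k
nCk≤[n+1]Ck n zero = ≤-reflexive (trans (nC0≡1 n) (sym (nC0≡1 (suc n))))
nCk≤[n+1]Ck n (suc k) = ≤-trans (m≤n+m _ (n C k)) (≤-reflexive (nCk+nC[k+1]≡[n+1]C[k+1] n k))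

C-monoˡ-≤ : ∀ {a b} k → a ≤ b → a C k ≤ b C k
C-monoˡ-≤ k a≤b = go (≤⇒≤′ a≤b)
  where
  go : ∀ {a b} → a ≤′ b → a C k ≤ b C k
  go ≤′-refl = ≤-refl
  go (≤′-step a≤′b) = ≤-trans (go a≤′b) (nCk≤[n+1]Ck _ k)

C>0 : ∀ {n k} → k ≤ n → 0 < n C k
C>0 {n} {k} k≤n = ≤-trans (≤-reflexive (sym (nCn≡1 k))) (C-monoˡ-≤ k k≤n)

[n+1]*nCk≡[n+1-k]*[n+1]Ck : ∀ k r → (suc (k + r)) * ((k + r) C k) ≡ suc r * (suc (k + r) C k)
[n+1]*nCk≡[n+1-k]*[n+1]Ck k r = begin
  suc (k + r) * ((k + r) C k)         ≡⟨ cong (suc (k + r) *_) (nCk≡nC[n∸k] (m≤m+n k r)) ⟩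
  suc (k + r) * ((k + r) C (k + r ∸ k)) ≡⟨ cong (λ i → suc (k + r) * ((k + r) C i)) (m+n∸m≡n k r) ⟩
  suc (k + r) * ((k + r) C r)         ≡⟨ sym ([k+1]*[n+1]C[k+1]≡[n+1]*nCk (k + r) r) ⟩
  suc r * (suc (k + r) C suc r)       ≡⟨ cong (λ i → suc r * (suc (k + r) C i)) (sym eq) ⟩
  suc r * (suc (k + r) C (suc (k + r) ∸ k)) ≡⟨ cong (suc r *_) (sym (nCk≡nC[n∸k] (m≤n⇒m≤1+n (m≤m+n k r)))) ⟩
  suc r * (suc (k + r) C k)           ∎
  where
  open ≡-Reasoning
  eq : suc (k + r) ∸ k ≡ suc r
  eq = trans (cong (_∸ k) (sym (+-suc k r))) (m+n∸m≡n k (suc r))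

[k+1]*nC[k+1]≡[n-k]*nCk : ∀ k r → suc k * ((k + r) C suc k) ≡ r * ((k + r) C k)
[k+1]*nC[k+1]≡[n-k]*nCk k r = +-cancelˡ-≡ (suc k * a) _ _ (begin
  suc k * a + suc k * b     ≡⟨ sym (*-distribˡ-+ (suc k) a b) ⟩
  suc k * (a + b)           ≡⟨ cong (suc k *_) (nCk+nC[k+1]≡[n+1]C[k+1] (k + r) k) ⟩
  suc k * (suc (k + r) C suc k) ≡⟨ [k+1]*[n+1]C[k+1]≡[n+1]*nCk (k + r) k ⟩
  suc (k + r) * a           ≡⟨ *-distribʳ-+ a (suc k) r ⟩
  suc k * a + r * a         ∎)
  where
  open ≡-Reasoning
  a b : ℕ
  a = (k + r) C k
  b = (k + r) C suc k

-- In quotients, (1 + 1/q)^i (1 - i/q) ≤ 1. The induction step is (q + 1) r ≤ q (r + 1), valid for r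
-- ≤ q.
[q+1]^i*[q-i]≤q^[i+1] : ∀ q i r → i + r ≡ q → suc q ^ i * r ≤ q ^ suc i
[q+1]^i*[q-i]≤q^[i+1] q zero r refl = ≤-reflexive (trans (*-identityˡ q) (sym (*-identityʳ q)))
[q+1]^i*[q-i]≤q^[i+1] q (suc i) r eq = begin
  suc q * suc q ^ i * r       ≡⟨ lemma (suc q) (suc q ^ i) r ⟩
  suc q ^ i * (r + q * r)     ≤⟨ *-monoʳ-≤ (suc q ^ i) (+-monoˡ-≤ (q * r) (≤-trans (m≤n+m r (suc i)) (≤-reflexive eq))) ⟩
  suc q ^ i * (q + q * r)     ≡⟨ lemma₂ q (suc q ^ i) r ⟩
  q * (suc q ^ i * suc r)     ≤⟨ *-monoʳ-≤ q ([q+1]^i*[q-i]≤q^[i+1] q i (suc r) (trans (+-suc i r) eq)) ⟩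
  q * q ^ suc i               ∎
  where
  open ≤-Reasoning
  lemma : ∀ a b c → a * b * c ≡ b * (a * c)
  lemma = solve-∀
  lemma₂ : ∀ a b c → b * (a + a * c) ≡ a * (b * (1 + c))
  lemma₂ = solve-∀

-- That is, (1 + 1/(j + 1))^j ≤ j + 1: crude, but enough to compare the factors (j + 1)^j of
-- consecutive levels.
[j+2]^j≤[j+1]^[j+1] : ∀ j → suc (suc j) ^ j ≤ suc j ^ suc j
[j+2]^j≤[j+1]^[j+1] j = ≤-trans (≤-reflexive (sym (*-identityʳ _)))
  ([q+1]^i*[q-i]≤q^[i+1] (suc j) j 1 (+-comm j 1))

m+d≡n⇒m≤n : ∀ {m n} d → m + d ≡ n → m ≤ n
m+d≡n⇒m≤n {m} d eq = ≤-trans (m≤m+n m d) (≤-reflexive eq)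

-- Counts of k-sets above a given set, and their ratios

module Numbers (n t m : ℕ) (2≤t : 2 ≤ t) (2≤m : 2 ≤ m) (n≥ : 7 * (m + 1) * (t + m) ^ 2 ≤ n) where

  k : ℕ
  k = t + m

  -- The number of k-sets that contain a given s-set.
  up : ℕ → ℕ
  up s = (n ∸ s) C (n ∸ k)

  c₁ c₂ : ℕ
  c₁ = up (1 + t)
  c₂ = up (2 + t)

  -- The number of k-sets that contain a given (t + d − 1)-set and miss a given point outside it.
  β : ℕ → ℕ
  β d = (n ∸ (t + d)) C (n ∸ suc k)

  k≢0 : NonZero k
  k≢0 = >-nonZero (≤-trans (s≤s z≤n) (≤-trans 2≤t (m≤m+n t m)))

  m+1≢0 : NonZero (m + 1)
  m+1≢0 = >-nonZero (≤-trans (s≤s z≤n) (m≤n+m 1 m))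

  k≤k*k : k ≤ k * k
  k≤k*k = m≤m*n k k {{k≢0}}

  n≥7[m+1]kk : 7 * (m + 1) * (k * k) ≤ n
  n≥7[m+1]kk = subst (λ q → 7 * (m + 1) * (k * q) ≤ n) (*-identityʳ k) n≥

  -- The 4 is the decay factor that `level-decay` asks for; the summand `k` pays for the subtraction
  -- in n - t - j.
  k+4[m+1]kk≤n : k + 4 * ((m + 1) * (k * k)) ≤ n
  k+4[m+1]kk≤n = begin
    k + 4 * ((m + 1) * (k * k))     ≤⟨ +-monoˡ-≤ _ k≤k*k ⟩
    k * k + 4 * ((m + 1) * (k * k)) ≤⟨ m+d≡n⇒m≤n (k * k * (2 + 3 * m)) (lemma m (k * k)) ⟩
    7 * (m + 1) * (k * k)           ≤⟨ n≥7[m+1]kk ⟩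
    n                               ∎
    where
    open ≤-Reasoning
    lemma : ∀ m a → a + 4 * ((m + 1) * a) + a * (2 + 3 * m) ≡ 7 * (m + 1) * a
    lemma = solve-∀

  2+k≤n : 2 + k ≤ n
  2+k≤n = begin
    2 + k                           ≡⟨ +-comm 2 k ⟩
    k + 2                           ≤⟨ +-monoʳ-≤ k (≤-trans 2≤t (≤-trans (m≤m+n t m) k≤k*k)) ⟩
    k + k * k                       ≤⟨ +-monoʳ-≤ k (≤-trans (m≤n*m (k * k) (m + 1) {{m+1≢0}}) (m≤n*m _ 4)) ⟩
    k + 4 * ((m + 1) * (k * k))     ≤⟨ k+4[m+1]kk≤n ⟩
    n                               ∎
    where open ≤-Reasoning

  k<n : k < n
  k<n = ≤-trans (n≤1+n _) 2+k≤n

  up-ratio : ∀ s → s < k → up (suc s) * (n ∸ s) ≡ up s * (k ∸ s)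
  up-ratio s s<k = begin
    up (suc s) * (n ∸ s)                   ≡⟨ cong₂ (λ a b → (a C (n ∸ k)) * b) e₁ e₀ ⟩
    ((q + r) C q) * suc (q + r)            ≡⟨ *-comm _ (suc (q + r)) ⟩
    suc (q + r) * ((q + r) C q)            ≡⟨ [n+1]*nCk≡[n+1-k]*[n+1]Ck q r ⟩
    suc r * (suc (q + r) C q)              ≡⟨ *-comm (suc r) _ ⟩
    (suc (q + r) C q) * suc r              ≡⟨ sym (cong₂ (λ a b → (a C q) * b) e₀ e₂) ⟩
    up s * (k ∸ s) ∎
    where
    open ≡-Reasoning
    q r : ℕ
    q = n ∸ k
    r = k ∸ suc s
    e₁ : n ∸ suc s ≡ q + r
    e₁ = begin
      n ∸ suc s             ≡⟨ cong (_∸ suc s) (sym (m∸n+n≡m (<⇒≤ k<n))) ⟩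
      (n ∸ k + k) ∸ suc s   ≡⟨ +-∸-assoc (n ∸ k) s<k ⟩
      q + r ∎
    e₂ : k ∸ s ≡ suc r
    e₂ = +-∸-assoc 1 {k} {suc s} s<k
    e₀ : n ∸ s ≡ suc (q + r)
    e₀ = trans (+-∸-assoc 1 {n} {suc s} (≤-trans s<k (<⇒≤ k<n))) (cong suc e₁)

  c₂>0 : 0 < c₂
  c₂>0 = C>0 (∸-monoʳ-≤ n (≤-trans (+-monoˡ-≤ t 2≤m) (≤-reflexive (+-comm m t))))

  -- By `up-ratio`, c₁/c₂ is (n - t - 1)/(m - 1), and the factor m + 1 in the bound on n covers the
  -- denominator.
  7kk*c₂≤c₁ : 7 * (k * k) * c₂ ≤ c₁
  7kk*c₂≤c₁ = *-cancelʳ-≤ (7 * (k * k) * c₂) c₁ (k ∸ suc t) {{>-nonZero (m<n⇒0<n∸m 1+t<k)}} (begin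
    7 * (k * k) * c₂ * (k ∸ suc t)        ≡⟨ lemma (k * k) c₂ (k ∸ suc t) ⟩
    c₂ * (7 * (k ∸ suc t) * (k * k))      ≤⟨ *-monoʳ-≤ c₂ big ⟩
    c₂ * (n ∸ suc t)                      ≡⟨ up-ratio (suc t) 1+t<k ⟩
    c₁ * (k ∸ suc t)                      ∎)
    where
    open ≤-Reasoning
    1+t<k : suc t < k
    1+t<k = ≤-trans (+-monoˡ-≤ t 2≤m) (≤-reflexive (+-comm m t))
    lemma : ∀ a b c → 7 * a * b * c ≡ b * (7 * c * a)
    lemma = solve-∀
    lemma₂ : ∀ m a → 7 * m * a + a + 6 * a ≡ 7 * (m + 1) * a
    lemma₂ = solve-∀
    big : 7 * (k ∸ suc t) * (k * k) ≤ n ∸ suc t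
    big = m+n≤o⇒m≤o∸n _ (begin
      7 * (k ∸ suc t) * (k * k) + suc t
        ≤⟨ +-mono-≤ (*-monoˡ-≤ (k * k) (*-monoʳ-≤ 7 (≤-trans (∸-monoʳ-≤ k (n≤1+n t)) (≤-reflexive (m+n∸m≡n t m))))) (≤-trans (<⇒≤ 1+t<k) k≤k*k) ⟩
      7 * m * (k * k) + k * k  ≤⟨ m+d≡n⇒m≤n (6 * (k * k)) (lemma₂ m (k * k)) ⟩
      7 * (m + 1) * (k * k)    ≤⟨ n≥7[m+1]kk ⟩
      n                        ∎)

  -- The device behind the comparisons of coefficients: if the lower and upper bounds on `f` differ
  -- by one in the coefficient of c₁, then c₁ ≤ (A + B) c₂.
  squeeze : ∀ e f A B → suc e * c₁ ≤ f + A * c₂ → f ≤ e * c₁ + B * c₂ → A + B < 7 * (k * k) → ⊥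
  squeeze e f A B lo hi small = n≮n c₁ (begin-strict
    c₁                 ≤⟨ +-cancelʳ-≤ (e * c₁) c₁ _ (begin
                            c₁ + e * c₁                ≤⟨ lo ⟩
                            f + A * c₂                 ≤⟨ +-monoˡ-≤ (A * c₂) hi ⟩
                            e * c₁ + B * c₂ + A * c₂   ≡⟨ lemma (e * c₁) A B c₂ ⟩
                            (A + B) * c₂ + e * c₁      ∎) ⟩
    (A + B) * c₂       <⟨ *-monoˡ-< c₂ {{>-nonZero c₂>0}} small ⟩
    7 * (k * k) * c₂   ≤⟨ 7kk*c₂≤c₁ ⟩
    c₁                 ∎)
    where
    open ≤-Reasoning
    lemma : ∀ x A B c → x + B * c + A * c ≡ (A + B) * c + x
    lemma = solve-∀

  up-pascal : ∀ s → s < n → up s ≡ (n ∸ suc s) C (n ∸ suc k) + up (suc s)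
  up-pascal s s<n = begin
    up s                                             ≡⟨ cong₂ _C_ (+-∸-assoc 1 {n} {suc s} s<n) eq ⟩
    suc (n ∸ suc s) C suc (n ∸ suc k)                ≡⟨ sym (nCk+nC[k+1]≡[n+1]C[k+1] (n ∸ suc s) (n ∸ suc k)) ⟩
    (n ∸ suc s) C (n ∸ suc k) + (n ∸ suc s) C suc (n ∸ suc k)
      ≡⟨ cong (λ i → (n ∸ suc s) C (n ∸ suc k) + (n ∸ suc s) C i) (sym eq) ⟩
    _ ∎
    where
    open ≡-Reasoning
    eq : n ∸ k ≡ suc (n ∸ suc k)
    eq = +-∸-assoc 1 {n} {suc k} k<n

  up-mono : ∀ {s s′} → s ≤ s′ → up s′ ≤ up s
  up-mono s≤s′ = C-monoˡ-≤ (n ∸ k) (∸-monoʳ-≤ n s≤s′)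

  β-mono : ∀ {d d′} → d ≤ d′ → β d′ ≤ β d
  β-mono d≤d′ = C-monoˡ-≤ (n ∸ suc k) (∸-monoʳ-≤ n (+-monoʳ-≤ t d≤d′))

  t+i<n : ∀ {i} → i ≤ m → t + i < n
  t+i<n i≤m = ≤-trans (s≤s (+-monoʳ-≤ t i≤m)) k<n

  c₁≡β₂+c₂ : c₁ ≡ β 2 + c₂
  c₁≡β₂+c₂ = trans (up-pascal (1 + t) (subst (_< n) (+-comm t 1) (t+i<n (≤-trans (s≤s z≤n) 2≤m))))
    (cong (λ s → (n ∸ s) C (n ∸ suc k) + c₂) (+-comm 2 t))

  -- β 3 counts the sets above a (t + 2)-set that miss one further point. This makes the members
  -- outside F[X] a lower-order term once the kernel has three points.
  β₃≤c₂ : β 3 ≤ c₂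
  β₃≤c₂ = begin
    β 3                                      ≡⟨ cong (λ s → (n ∸ s) C (n ∸ suc k)) (+-comm t 3) ⟩
    (n ∸ (3 + t)) C (n ∸ suc k)              ≤⟨ m≤m+n _ (up (3 + t)) ⟩
    (n ∸ (3 + t)) C (n ∸ suc k) + up (3 + t) ≡⟨ sym (up-pascal (2 + t) (subst (_< n) (+-comm t 2) (t+i<n 2≤m))) ⟩
    c₂ ∎
    where open ≤-Reasoning

  -- The range of `d` is sharp: beyond it, t + d - 1 exceeds k.
  β>0 : ∀ {d} → d ≤ m + 1 → 0 < β d
  β>0 {d} d≤ = C>0 (∸-monoʳ-≤ n (≤-trans (+-monoʳ-≤ t d≤)
    (≤-reflexive (trans (sym (+-assoc t m 1)) (+-comm k 1)))))

  -- p c(d) = (m + 1 − d) β(d) for c(d) = up (t + d) and p = n − k, which is large.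
  [m+1]*up<β : ∀ {d} → d ≤ m + 1 → (m + 1) * up (t + d) < β d
  [m+1]*up<β {d} d≤ with up (t + d) in eq
  -- This is d = m + 1, where no k-set is large enough and strictness rests on `β>0`.
  ... | zero = subst (_< β d) (sym (*-zeroʳ (m + 1))) (β>0 d≤)
  ... | suc u = *-cancelˡ-< (m + 1) _ _ (begin-strict
    (m + 1) * ((m + 1) * suc u) ≡⟨ sym (*-assoc (m + 1) (m + 1) (suc u)) ⟩
    (m + 1) * (m + 1) * suc u   <⟨ *-monoˡ-< (suc u) p-big ⟩
    suc q * suc u               ≡⟨ cong (suc q *_) (sym (trans (cong₂ _C_ (sym M≡) (sym p≡)) eq)) ⟩
    suc q * ((q + r) C suc q)   ≡⟨ [k+1]*nC[k+1]≡[n-k]*nCk q r ⟩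
    r * ((q + r) C q)           ≡⟨ cong (λ a → r * (a C q)) (sym M≡) ⟩
    r * β d                     ≤⟨ *-monoˡ-≤ (β d) (m∸n≤m (m + 1) d) ⟩
    (m + 1) * β d               ∎)
    where
    open ≤-Reasoning
    q r : ℕ
    q = n ∸ suc k
    r = m + 1 ∸ d
    p≡ : n ∸ k ≡ suc q
    p≡ = +-∸-assoc 1 {n} {suc k} k<n
    M≡ : n ∸ (t + d) ≡ q + r
    M≡ = begin-equality
      n ∸ (t + d)                     ≡⟨ cong (_∸ (t + d)) (sym (m∸n+n≡m k<n)) ⟩
      (q + suc k) ∸ (t + d)           ≡⟨ cong (λ x → (q + x) ∸ (t + d)) (trans (+-comm 1 k) (+-assoc t m 1)) ⟩
      (q + (t + (m + 1))) ∸ (t + d)   ≡⟨ +-∸-assoc q (+-monoʳ-≤ t d≤) ⟩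
      q + ((t + (m + 1)) ∸ (t + d))   ≡⟨ cong (q +_) ([m+n]∸[m+o]≡n∸o t (m + 1) d) ⟩
      q + r ∎
    p-big : (m + 1) * (m + 1) < suc q
    p-big = subst ((m + 1) * (m + 1) <_) p≡ (begin-strict
      (m + 1) * (m + 1)         <⟨ *-monoʳ-< (m + 1) {{m+1≢0}}
                                     (≤-trans (s≤s (≤-reflexive (+-comm m 1))) (≤-trans (+-monoˡ-≤ m 2≤t) k≤k*k)) ⟩
      (m + 1) * (k * k)         ≤⟨ m≤n*m _ 4 ⟩
      4 * ((m + 1) * (k * k))   ≤⟨ m+n≤o⇒m≤o∸n _ (≤-trans (≤-reflexive (+-comm _ k)) k+4[m+1]kk≤n) ⟩
      n ∸ k ∎)

  -- Strictness excludes a kernel of more than d points when the diversity attains its bound. It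
  -- holds up to d = m + 1, where the two values are 0 and 1.
  β-strict : ∀ {d} → d ≤ m + 1 → β (suc d) < β d
  β-strict {d} d≤ = begin-strict
    β (suc d)                         ≡⟨ cong₂ _C_ (cong (n ∸_) (+-suc t d)) q≡ ⟩
    a C suc q                         <⟨ m<n+m (a C suc q) (C>0 q≤a) ⟩
    a C q + a C suc q                 ≡⟨ nCk+nC[k+1]≡[n+1]C[k+1] a q ⟩
    suc a C suc q                     ≡⟨ sym (cong₂ _C_ a≡ q≡) ⟩
    β d                               ∎
    where
    open ≤-Reasoning
    t+d≤1+k : t + d ≤ suc k
    t+d≤1+k = ≤-trans (+-monoʳ-≤ t d≤) (≤-reflexive (trans (sym (+-assoc t m 1)) (+-comm k 1)))
    a q : ℕ
    a = n ∸ suc (t + d)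
    q = n ∸ (2 + k)
    a≡ : n ∸ (t + d) ≡ suc a
    a≡ = +-∸-assoc 1 {n} {suc (t + d)} (≤-trans (s≤s t+d≤1+k) 2+k≤n)
    q≡ : n ∸ suc k ≡ suc q
    q≡ = +-∸-assoc 1 {n} {2 + k} 2+k≤n
    q≤a : q ≤ a
    q≤a = ∸-monoʳ-≤ n (s≤s t+d≤1+k)

  -- The quotient of consecutive levels is (t + j + 1)/(j + 1) · (j + 2)^(j + 1)/(j + 1)^j · (k - t
  -- - j)/(n - t - j). By `[j+2]^j≤[j+1]^[j+1]` it is at most (j + 2)(t + j + 1)(k - t - j)/(n - t -
  -- j), and for j < m the numerator is at most (m + 1)k².
  level-decay : ∀ j → 4 * level t {n} k (suc j) ≤ level t {n} k j
  level-decay j with j <? m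
  -- From here on t + j + 1 exceeds k, and the level is 0.
  ... | no j≮m = ≤-trans (≤-reflexive (trans (cong (4 *_) (trans (cong (x *_) up≡0) (*-zeroʳ x))) (*-zeroʳ 4))) z≤n
    where
    x : ℕ
    x = ((t + suc j) C suc j) * suc (suc j) ^ suc j
    up≡0 : up (t + suc j) ≡ 0
    up≡0 = k>n⇒nCk≡0 (≤-trans (s≤s (∸-monoʳ-≤ n (+-monoʳ-≤ t (s≤s (≮⇒≥ j≮m)))))
      (≤-reflexive (trans (cong (λ s → suc (n ∸ s)) (+-suc t m)) (sym (+-∸-assoc 1 {n} {suc k} k<n)))))
  ... | yes j<m = *-cancelʳ-≤ _ _ (suc j * u) {{m*n≢0 (suc j) u {{_}} {{>-nonZero u>0}}}} (begin
    4 * (b′ * (suc (suc j) * e′) * up (t + suc j)) * (suc j * u)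
      ≡⟨ lemma₁ b′ (suc (suc j)) e′ (up (t + suc j)) (suc j) u ⟩
    4 * (suc j * b′) * (suc (suc j) * e′) * (up (t + suc j) * u)
      ≡⟨ cong₂ (λ y z → 4 * y * (suc (suc j) * e′) * z) b-eq up-eq ⟩
    4 * (suc (t + j) * b) * (suc (suc j) * e′) * (up (t + j) * (k ∸ (t + j)))
      ≡⟨ lemma₂ (suc (t + j)) b (suc (suc j)) e′ (up (t + j)) (k ∸ (t + j)) ⟩
    b * e′ * up (t + j) * (4 * (suc (suc j) * (suc (t + j) * (k ∸ (t + j)))))
      ≤⟨ *-mono-≤ (*-monoˡ-≤ (up (t + j)) (*-monoʳ-≤ b ([j+2]^j≤[j+1]^[j+1] j))) u-big ⟩
    b * (suc j * suc j ^ j) * up (t + j) * u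
      ≡⟨ lemma₃ b (suc j) (suc j ^ j) (up (t + j)) u ⟩
    b * suc j ^ j * up (t + j) * (suc j * u) ∎)
    where
    open ≤-Reasoning
    u b b′ e′ : ℕ
    u = n ∸ (t + j)
    b = (t + j) C j
    b′ = (t + suc j) C suc j
    e′ = suc (suc j) ^ j
    u>0 : 0 < u
    u>0 = m<n⇒0<n∸m (t+i<n (<⇒≤ j<m))
    b-eq : suc j * b′ ≡ suc (t + j) * b
    b-eq = trans (cong (λ s → suc j * (s C suc j)) (+-suc t j)) ([k+1]*[n+1]C[k+1]≡[n+1]*nCk (t + j) j)
    t+j<k : t + j < k
    t+j<k = +-monoʳ-< t j<m
    up-eq : up (t + suc j) * u ≡ up (t + j) * (k ∸ (t + j))
    up-eq = trans (cong (λ s → up s * u) (+-suc t j)) (up-ratio (t + j) t+j<k)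
    lemma₁ : ∀ a b c d e f → 4 * (a * (b * c) * d) * (e * f) ≡ 4 * (e * a) * (b * c) * (d * f)
    lemma₁ = solve-∀
    lemma₂ : ∀ a b c d e f → 4 * (a * b) * (c * d) * (e * f) ≡ b * d * e * (4 * (c * (a * f)))
    lemma₂ = solve-∀
    lemma₃ : ∀ a b c d e → a * (b * c) * d * e ≡ a * c * d * (b * e)
    lemma₃ = solve-∀
    u-big : 4 * (suc (suc j) * (suc (t + j) * (k ∸ (t + j)))) ≤ u
    u-big = m+n≤o⇒m≤o∸n _ (begin
      4 * (suc (suc j) * (suc (t + j) * (k ∸ (t + j)))) + (t + j)
        ≤⟨ +-mono-≤ (*-monoʳ-≤ 4 (*-mono-≤ (≤-trans (s≤s j<m) (≤-reflexive (+-comm 1 m))) (*-mono-≤ t+j<k (m∸n≤m k (t + j))))) (<⇒≤ t+j<k) ⟩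
      4 * ((m + 1) * (k * k)) + k ≡⟨ +-comm _ k ⟩
      k + 4 * ((m + 1) * (k * k)) ≤⟨ k+4[m+1]kk≤n ⟩
      n ∎)

  -- The geometric sum in a form fit for induction: the last level, kept on the left, pays for four
  -- times the next one.
  3*levels≤4*level₂ : ∀ j → 3 * levels t {n} k (suc j) + level t {n} k (2 + j) ≤ 4 * level t {n} k 2
  3*levels≤4*level₂ zero = ≤-reflexive (lemma (level t {n} k 2))
    where
    lemma : ∀ a → 3 * (0 + a) + a ≡ 4 * a
    lemma = solve-∀
  3*levels≤4*level₂ (suc j) = begin
    3 * (levels t {n} k (suc j) + l) + l ≡⟨ lemma (levels t {n} k (suc j)) l ⟩
    3 * levels t {n} k (suc j) + 4 * l   ≤⟨ +-monoʳ-≤ (3 * levels t {n} k (suc j)) (level-decay (2 + j)) ⟩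
    3 * levels t {n} k (suc j) + level t {n} k (2 + j) ≤⟨ 3*levels≤4*level₂ j ⟩
    4 * level t {n} k 2 ∎
    where
    open ≤-Reasoning
    l : ℕ
    l = level t {n} k (3 + j)
    lemma : ∀ a b → 3 * (a + b) + b ≡ 3 * a + 4 * b
    lemma = solve-∀

  -- The levels decay geometrically, and 4/3 of the first one is 4/3 · 9 C(t + 2, 2) c₂.
  levels≤ : ∀ j → levels t {n} k j ≤ 6 * ((1 + t) * (2 + t)) * c₂
  levels≤ zero = z≤n
  levels≤ (suc j) = *-cancelˡ-≤ 3 (begin
    3 * levels t {n} k (suc j)        ≤⟨ m+n≤o⇒m≤o _ (3*levels≤4*level₂ j) ⟩
    4 * (((t + 2) C 2) * 9 * up (t + 2)) ≡⟨ lemma₁ ((t + 2) C 2) (up (t + 2)) ⟩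
    18 * (2 * ((t + 2) C 2)) * up (t + 2) ≡⟨ cong (λ s → 18 * (2 * (s C 2)) * up s) (+-comm t 2) ⟩
    18 * (2 * ((2 + t) C 2)) * c₂     ≡⟨ cong (λ x → 18 * x * c₂) (trans ([k+1]*[n+1]C[k+1]≡[n+1]*nCk (1 + t) 1) (cong ((2 + t) *_) (nC1≡n (1 + t)))) ⟩
    18 * ((2 + t) * (1 + t)) * c₂     ≡⟨ lemma₂ (2 + t) (1 + t) c₂ ⟩
    3 * (6 * ((1 + t) * (2 + t)) * c₂) ∎)
    where
    open ≤-Reasoning
    lemma₁ : ∀ a b → 4 * (a * 9 * b) ≡ 18 * (2 * a) * b
    lemma₁ = solve-∀
    lemma₂ : ∀ a b c → 18 * (a * b) * c ≡ 3 * (6 * (b * a) * c)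
    lemma₂ = solve-∀

  -- `up` chooses the points that are omitted, the binomials in `σ` those that are added.
  up-co : ∀ i → i ≤ m → up (i + t) ≡ (n ∸ t ∸ i) C (m ∸ i)
  up-co i i≤m = begin
    (n ∸ (i + t)) C (n ∸ k)                     ≡⟨ cong₂ _C_ (trans (cong (n ∸_) (+-comm i t)) (sym (∸-+-assoc n t i))) n∸k≡ ⟩
    (n ∸ t ∸ i) C ((n ∸ t ∸ i) ∸ (m ∸ i))       ≡⟨ sym (nCk≡nC[n∸k] (∸-monoˡ-≤ i m≤N)) ⟩
    (n ∸ t ∸ i) C (m ∸ i)                       ∎
    where
    open ≡-Reasoning
    m≤N : m ≤ n ∸ t
    m≤N = m+n≤o⇒m≤o∸n m (≤-trans (≤-reflexive (+-comm m t)) (<⇒≤ k<n))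
    n∸k≡ : n ∸ k ≡ (n ∸ t ∸ i) ∸ (m ∸ i)
    n∸k≡ = sym (begin
      (n ∸ t ∸ i) ∸ (m ∸ i)   ≡⟨ ∸-+-assoc (n ∸ t) i (m ∸ i) ⟩
      n ∸ t ∸ (i + (m ∸ i))   ≡⟨ cong (n ∸ t ∸_) (m+[n∸m]≡n i≤m) ⟩
      n ∸ t ∸ m               ≡⟨ ∸-+-assoc n t m ⟩
      n ∸ (t + m)             ∎)

-- Subtraction-free lower bound for C(N, m) − C(N − e, m) = Σ_{i = 1}^{e} C(N − i, m − 1), N = 2 + N′, m = 2 + m′.
C-sum-bound : ∀ N′ m′ e → e ≤ 2 + N′ →
  e * (suc N′ C suc m′) + (2 + N′ ∸ e) C (2 + m′) ≤ (2 + N′) C (2 + m′) + e * e * (N′ C m′)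
C-sum-bound N′ m′ zero _ = ≤-reflexive (sym (+-identityʳ _))
C-sum-bound N′ m′ (suc e) (s≤s e≤) = begin
  suc e * d₁ + (suc N′ ∸ e) C (2 + m′)
    ≡⟨ lemma₁ e d₁ ((suc N′ ∸ e) C (2 + m′)) ⟩
  e * d₁ + (d₁ + (suc N′ ∸ e) C (2 + m′))
    ≤⟨ +-monoʳ-≤ (e * d₁) (+-monoˡ-≤ ((suc N′ ∸ e) C (2 + m′)) (drop e)) ⟩
  e * d₁ + ((suc N′ ∸ e) C suc m′ + e * d₂ + (suc N′ ∸ e) C (2 + m′))
    ≡⟨ lemma₂ (e * d₁) ((suc N′ ∸ e) C suc m′) (e * d₂) ((suc N′ ∸ e) C (2 + m′)) ⟩
  e * d₁ + ((suc N′ ∸ e) C suc m′ + (suc N′ ∸ e) C (2 + m′)) + e * d₂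
    ≡⟨ cong (λ x → e * d₁ + x + e * d₂) (trans (nCk+nC[k+1]≡[n+1]C[k+1] (suc N′ ∸ e) (suc m′))
         (cong (_C (2 + m′)) (sym (+-∸-assoc 1 e≤)))) ⟩
  e * d₁ + (2 + N′ ∸ e) C (2 + m′) + e * d₂
    ≤⟨ +-monoˡ-≤ (e * d₂) (C-sum-bound N′ m′ e (m≤n⇒m≤1+n e≤)) ⟩
  (2 + N′) C (2 + m′) + e * e * d₂ + e * d₂
    ≤⟨ m+d≡n⇒m≤n ((1 + e) * d₂) (lemma₃ ((2 + N′) C (2 + m′)) e d₂) ⟩
  (2 + N′) C (2 + m′) + suc e * suc e * d₂ ∎
  where
  open ≤-Reasoning
  d₁ d₂ : ℕ
  d₁ = suc N′ C suc m′
  d₂ = N′ C m′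
  -- By Pascal's rule each unit step in the upper index costs at most `d₂`. With at most e steps for
  -- each of the e summands, the error is at most e² `d₂`.
  drop : ∀ e → d₁ ≤ (suc N′ ∸ e) C suc m′ + e * d₂
  drop zero = ≤-reflexive (sym (+-identityʳ d₁))
  drop (suc e) = ≤-trans (drop e) (≤-trans (+-monoˡ-≤ (e * d₂) step)
    (≤-reflexive (lemma ((N′ ∸ e) C suc m′) d₂ (e * d₂))))
    where
    lemma : ∀ a b c → a + b + c ≡ a + (b + c)
    lemma = solve-∀
    step : (suc N′ ∸ e) C suc m′ ≤ (N′ ∸ e) C suc m′ + d₂
    step with e ≤? N′
    ... | no e≰N′ = ≤-trans (≤-reflexive (cong (_C suc m′) (m≤n⇒m∸n≡0 (≰⇒> e≰N′)))) z≤n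
    ... | yes e≤N′ = begin
      (suc N′ ∸ e) C suc m′                  ≡⟨ cong (_C suc m′) (+-∸-assoc 1 e≤N′) ⟩
      suc (N′ ∸ e) C suc m′                  ≡⟨ sym (nCk+nC[k+1]≡[n+1]C[k+1] (N′ ∸ e) m′) ⟩
      (N′ ∸ e) C m′ + (N′ ∸ e) C suc m′      ≤⟨ +-monoˡ-≤ _ (C-monoˡ-≤ m′ (m∸n≤m N′ e)) ⟩
      d₂ + (N′ ∸ e) C suc m′                 ≡⟨ +-comm d₂ _ ⟩
      (N′ ∸ e) C suc m′ + d₂                 ∎
  lemma₁ : ∀ e a b → (1 + e) * a + b ≡ e * a + (a + b)
  lemma₁ = solve-∀
  lemma₂ : ∀ a b c d → a + (b + c + d) ≡ a + (b + d) + c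
  lemma₂ = solve-∀
  lemma₃ : ∀ a e d → a + e * e * d + e * d + (1 + e) * d ≡ a + (1 + e) * (1 + e) * d
  lemma₃ = solve-∀

-- Lower bounds on the size of the family in terms of c₁ and c₂

module Bounds (n t m : ℕ) (2≤t : 2 ≤ t) (2≤m : 2 ≤ m) (n≥ : 7 * (m + 1) * (t + m) ^ 2 ≤ n) where

  open Numbers n t m 2≤t 2≤m n≥

  -- The number of k-sets that contain a given t-set and meet a d-set disjoint from it.
  σ : ℕ → ℕ
  σ d = (n ∸ t) C m ∸ (n ∸ t ∸ d) C m

  -- `e` is kept apart from `d`, which may be arbitrarily large: the applications take an `e` just
  -- large enough for a contradiction, so that e² stays small against 7k².
  e*c₁≤σ+e*e*c₂ : ∀ {e d} → e ≤ d → e ≤ 2 + m + t → e * c₁ ≤ σ d + e * e * c₂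
  e*c₁≤σ+e*e*c₂ {e} {d} e≤d e≤ = +-cancelʳ-≤ x (e * c₁) _ (begin
    e * c₁ + x                                    ≤⟨ +-monoʳ-≤ (e * c₁) (C-monoˡ-≤ m (∸-monoʳ-≤ (n ∸ t) e≤d)) ⟩
    e * c₁ + (n ∸ t ∸ e) C m                      ≤⟨ bound ⟩
    (n ∸ t) C m + e * e * c₂                      ≤⟨ +-monoˡ-≤ (e * e * c₂) (m≤n+m∸n _ x) ⟩
    x + σ d + e * e * c₂                          ≡⟨ lemma x (σ d) (e * e * c₂) ⟩
    σ d + e * e * c₂ + x ∎)
    where
    open ≤-Reasoning
    x : ℕ
    x = (n ∸ t ∸ d) C m
    lemma : ∀ a b c → a + b + c ≡ b + c + a
    lemma = solve-∀
    bound : e * c₁ + (n ∸ t ∸ e) C m ≤ (n ∸ t) C m + e * e * c₂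
    bound = subst₂ (λ x y → e * x + (n ∸ t ∸ e) C m ≤ (n ∸ t) C m + e * e * y)
      (sym (up-co 1 (≤-trans (s≤s z≤n) 2≤m))) (sym (up-co 2 2≤m))
      (go (n ∸ t) m 2≤m 2≤N e≤N)
      where
      go : ∀ N m → 2 ≤ m → 2 ≤ N → e ≤ N → e * ((N ∸ 1) C (m ∸ 1)) + (N ∸ e) C m ≤ N C m + e * e * ((N ∸ 2) C (m ∸ 2))
      go (suc (suc N′)) (suc (suc m′)) (s≤s (s≤s z≤n)) (s≤s (s≤s z≤n)) e≤N = C-sum-bound N′ m′ e e≤N
      big : 2 + m + t ≤ n ∸ t
      big = m+n≤o⇒m≤o∸n _ (begin
        2 + m + t + t               ≤⟨ +-monoˡ-≤ t (+-monoˡ-≤ t (+-monoˡ-≤ m 2≤t)) ⟩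
        t + m + t + t               ≤⟨ m+d≡n⇒m≤n (2 * m) (lemma₂ t m) ⟩
        3 * k                       ≤⟨ *-monoʳ-≤ 3 (m≤m*n k k {{k≢0}}) ⟩
        3 * (k * k)                 ≤⟨ m≤m+n _ (k * k) ⟩
        3 * (k * k) + k * k         ≡⟨ lemma₃ (k * k) ⟩
        4 * (k * k)                 ≤⟨ *-monoʳ-≤ 4 (m≤n*m (k * k) (m + 1) {{m+1≢0}}) ⟩
        4 * ((m + 1) * (k * k))     ≤⟨ m≤n+m _ k ⟩
        k + 4 * ((m + 1) * (k * k)) ≤⟨ k+4[m+1]kk≤n ⟩
        n                           ∎)
        where
        lemma₂ : ∀ t m → t + m + t + t + 2 * m ≡ 3 * (t + m)
        lemma₂ = solve-∀
        lemma₃ : ∀ a → 3 * a + a ≡ 4 * a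
        lemma₃ = solve-∀
      e≤N : e ≤ n ∸ t
      e≤N = ≤-trans e≤ big
      2≤N : 2 ≤ n ∸ t
      2≤N = ≤-trans (≤-trans (m≤m+n 2 m) (m≤m+n (2 + m) t)) big

  module _ {d f : ℕ} (2≤d : 2 ≤ d) (f≥ : σ d + t * β d ≤ f) where

    size≥ : ∀ {e} → e ≤ d → e ≤ 2 + m + t → e * c₁ ≤ f + e * e * c₂
    size≥ {e} e≤d e≤ = ≤-trans (e*c₁≤σ+e*e*c₂ e≤d e≤) (+-monoˡ-≤ (e * e * c₂) (m+n≤o⇒m≤o _ f≥))

    size≥3 : 3 * c₁ ≤ f + 9 * c₂
    size≥3 with m≤n⇒m<n∨m≡n 2≤d
    ... | inj₁ 3≤d = size≥ 3≤d (≤-trans (+-monoʳ-≤ 2 (≤-trans (s≤s z≤n) 2≤m)) (m≤m+n (2 + m) t))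
    -- For d = 2 the summand σ 2 yields only 2c₁. The missing c₁ comes from t β 2 ≥ 2 (c₁ - c₂).
    ... | inj₂ refl = begin
      3 * c₁                                ≤⟨ *-monoˡ-≤ c₁ (n≤1+n 3) ⟩
      4 * c₁                                ≡⟨ lemma₁ c₁ ⟩
      2 * c₁ + 2 * c₁                       ≡⟨ cong (λ x → 2 * c₁ + 2 * x) c₁≡β₂+c₂ ⟩
      2 * c₁ + 2 * (β 2 + c₂)               ≤⟨ +-monoˡ-≤ _ (e*c₁≤σ+e*e*c₂ {2} {2} ≤-refl (≤-trans (m≤m+n 2 m) (m≤m+n (2 + m) t))) ⟩
      σ 2 + 4 * c₂ + 2 * (β 2 + c₂)         ≡⟨ lemma₂ (σ 2) (β 2) c₂ ⟩
      σ 2 + 2 * β 2 + 6 * c₂                ≤⟨ +-mono-≤ (≤-trans (+-monoʳ-≤ (σ 2) (*-monoˡ-≤ (β 2) 2≤t)) f≥) (*-monoˡ-≤ c₂ (m≤m+n 6 3)) ⟩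
      f + 9 * c₂                            ∎
      where
      open ≤-Reasoning
      lemma₁ : ∀ a → 4 * a ≡ 2 * a + 2 * a
      lemma₁ = solve-∀
      lemma₂ : ∀ a b c → a + 4 * c + 2 * (b + c) ≡ a + 2 * b + 6 * c
      lemma₂ = solve-∀

-- Families with a popular t-set

-- `S ∩ U` lies in `U - x` and is at least as large, hence equal to it.
remove-⊆ : ∀ {U S : Subset n} {x t} → x ∈ U → x ∉ S → ∣ U ∣ ≤ suc t → t ≤ ∣ S ∩ U ∣ → U - x Sub.⊆ S
remove-⊆ {U = U} {S} {x} {t} x∈U x∉S U≤ t≤ = λ y∈ → proj₁ (x∈p∩q⁻ S U (subst (_ ∈_) (sym eq) y∈))
  where
  S∩U⊆ : S ∩ U Sub.⊆ U - x
  S∩U⊆ y∈ = let y∈S , y∈U = x∈p∩q⁻ S U y∈ in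
    x∈p∧x≢y⇒x∈p-y y∈U (λ { refl → x∉S y∈S })
  eq : S ∩ U ≡ U - x
  eq = p⊆q∧∣q∣≤∣p∣⇒p≡q (S ∩ U) (U - x) S∩U⊆
    (≤-trans (s≤s⁻¹ (≤-trans (≤-reflexive (x∈p⇒suc∣p-x∣≡∣p∣ x∈U)) U≤)) t≤)

⊈⇒∃ : {p q : Subset n} → ¬ (p Sub.⊆ q) → ∃ λ x → x ∈ p × x ∉ q
⊈⇒∃ {p = p} {q} p⊈q with nonempty? (p ─ q)
... | yes (x , x∈) = x , p─q⊆p p q x∈ , x∈p─q⇒x∉q p q x∈
... | no none = ⊥-elim (p⊈q (─-Empty⇒⊆ none))

-- For t = 1 and 2-sets this is the fact that pairwise intersecting edges form a star or lie in a
-- triangle. Two members S₁, S₂ meeting in a t-set X, and a third one missing a point x of X,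
-- determine Z = S₁ ∪ S₂; the third is then Z - x.
sunflower-or-book : ∀ t {T : Family n} → Decidable T → t ≤ n → t -intersecting T → (∀ {S} → T S → ∣ S ∣ ≤ t + 1) →
  (∃ λ X → ∣ X ∣ ≡ t × ∀ S → T S → X Sub.⊆ S) ⊎ (∃ λ Z → ∣ Z ∣ ≡ t + 2 × ∀ S → T S → t + 1 ≤ ∣ S ∩ Z ∣)
sunflower-or-book {n} t {T} T? t≤n int bd with anySubset? T?
... | no none = let X , _ , X≡ = t-subset Sub.⊤ t (subst (t ≤_) (sym (∣⊤∣≡n n)) t≤n) in
  inj₁ (X , X≡ , λ S TS → contradiction (S , TS) none)
... | yes (S₁ , T₁) with anySubset? (λ S → T? S ×-dec ¬? (S₁ ⊆? S))
...   | no none = let X , X⊆ , X≡ = t-subset S₁ t (subst (λ I → t ≤ ∣ I ∣) (∩-idem S₁) (int T₁ T₁)) in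
  inj₁ (X , X≡ , λ S TS → ⊆-trans X⊆ (decidable-stable (S₁ ⊆? S) (λ ¬⊆ → none (S , TS , ¬⊆))))
...   | yes (S₂ , T₂ , S₁⊈S₂) with anySubset? (λ S → T? S ×-dec ¬? ((S₁ ∩ S₂) ⊆? S))
...     | no none = inj₁ (S₁ ∩ S₂ , X≡ , λ S TS → decidable-stable ((S₁ ∩ S₂) ⊆? S) (λ ¬⊆ → none (S , TS , ¬⊆)))
  where
  X≡ : ∣ S₁ ∩ S₂ ∣ ≡ t
  X≡ = ≤-antisym
    (s≤s⁻¹ (≤-trans (p⊂q⇒∣p∣<∣q∣ {p = S₁ ∩ S₂} {S₁} (p∩q⊆p S₁ S₂ ,
       let x , x∈ , x∉ = ⊈⇒∃ S₁⊈S₂ in x , x∈ , λ x∈I → x∉ (proj₂ (x∈p∩q⁻ S₁ S₂ x∈I))))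
       (≤-trans (bd T₁) (≤-reflexive (+-comm t 1)))))
    (int T₁ T₂)
...     | yes (S₃ , T₃ , X⊈S₃) = inj₂ (Z , Z≡ , covered)
  where
  bd′ : ∀ {S} → T S → ∣ S ∣ ≤ suc t
  bd′ TS = ≤-trans (bd TS) (≤-reflexive (+-comm t 1))
  X Z : Subset n
  X = S₁ ∩ S₂
  Z = S₁ ∪ S₂
  x : Fin n
  x = proj₁ (⊈⇒∃ X⊈S₃)
  x∈X : x ∈ X
  x∈X = proj₁ (proj₂ (⊈⇒∃ X⊈S₃))
  x∉S₃ : x ∉ S₃
  x∉S₃ = proj₂ (proj₂ (⊈⇒∃ X⊈S₃))
  X≤t : ∣ X ∣ ≤ t
  X≤t = s≤s⁻¹ (≤-trans (p⊂q⇒∣p∣<∣q∣ {p = X} {S₁} (p∩q⊆p S₁ S₂ ,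
       let y , y∈ , y∉ = ⊈⇒∃ S₁⊈S₂ in y , y∈ , λ y∈I → y∉ (proj₂ (x∈p∩q⁻ S₁ S₂ y∈I)))) (bd′ T₁))
  X≡t : ∣ X ∣ ≡ t
  X≡t = ≤-antisym X≤t (int T₁ T₂)
  Z-y⊆ : ∀ {S y} → T S → y ∈ X → y ∉ S → Z - y Sub.⊆ S
  Z-y⊆ {S} {y} TS y∈X y∉S z∈ with x∈p∪q⁻ S₁ S₂ (p─q⊆p Z ⁅ y ⁆ z∈)
  ... | inj₁ z∈₁ = remove-⊆ (proj₁ (x∈p∩q⁻ S₁ S₂ y∈X)) y∉S (bd′ T₁) (int TS T₁)
    (x∈p∧x≢y⇒x∈p-y z∈₁ (λ { refl → x∈p─q⇒x∉q Z ⁅ y ⁆ z∈ (x∈⁅x⁆ y) }))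
  ... | inj₂ z∈₂ = remove-⊆ (proj₂ (x∈p∩q⁻ S₁ S₂ y∈X)) y∉S (bd′ T₂) (int TS T₂)
    (x∈p∧x≢y⇒x∈p-y z∈₂ (λ { refl → x∈p─q⇒x∉q Z ⁅ y ⁆ z∈ (x∈⁅x⁆ y) }))
  -- S₂ might a priori be X itself. S₃ excludes this: a member through x shares t points with S₃ and
  -- has x in addition.
  full : ∀ {S} → T S → x ∈ S → ∣ S ∣ ≡ suc t
  full {S} TS x∈S = ≤-antisym (bd′ TS) (≤-trans (s≤s (int T₃ TS)) (p⊂q⇒∣p∣<∣q∣ {p = S₃ ∩ S} {S}
    (p∩q⊆q S₃ S , x , x∈S , λ x∈I → x∉S₃ (proj₁ (x∈p∩q⁻ S₃ S x∈I)))))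
  Z≡ : ∣ Z ∣ ≡ t + 2
  Z≡ = begin
    ∣ S₁ ∪ S₂ ∣        ≡⟨ ∣p∪q∣≡∣p∣+∣q─p∣ S₁ S₂ ⟩
    ∣ S₁ ∣ + ∣ S₂ ─ S₁ ∣ ≡⟨ cong₂ _+_ (full T₁ (proj₁ (x∈p∩q⁻ S₁ S₂ x∈X))) one ⟩
    suc t + 1          ≡⟨ sym (+-suc t 1) ⟩
    t + 2 ∎
    where
    open ≡-Reasoning
    one : ∣ S₂ ─ S₁ ∣ ≡ 1
    one = +-cancelˡ-≡ t _ _ (begin
      t + ∣ S₂ ─ S₁ ∣           ≡⟨ cong (_+ ∣ S₂ ─ S₁ ∣) (sym (trans (cong ∣_∣ (∩-comm S₂ S₁)) X≡t)) ⟩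
      ∣ S₂ ∩ S₁ ∣ + ∣ S₂ ─ S₁ ∣ ≡⟨ ∣p∩q∣+∣p─q∣≡∣p∣ S₂ S₁ ⟩
      ∣ S₂ ∣                    ≡⟨ full T₂ (proj₂ (x∈p∩q⁻ S₁ S₂ x∈X)) ⟩
      suc t                     ≡⟨ +-comm 1 t ⟩
      t + 1 ∎)
  X⊆Z : X Sub.⊆ Z
  X⊆Z = ⊆-trans (p∩q⊆p S₁ S₂) (p⊆p∪q S₂)
  Z-y≡ : ∀ {y} → y ∈ X → ∣ Z - y ∣ ≡ t + 1
  Z-y≡ y∈X = suc-injective (trans (x∈p⇒suc∣p-x∣≡∣p∣ (X⊆Z y∈X)) (trans Z≡ (+-suc t 1)))
  S₃⊆Z : S₃ Sub.⊆ Z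
  S₃⊆Z y∈ = p─q⊆p Z ⁅ x ⁆ (subst (_ ∈_)
    (sym (p⊆q∧∣q∣≤∣p∣⇒p≡q (Z - x) S₃ (Z-y⊆ T₃ x∈X x∉S₃) (≤-trans (bd T₃) (≤-reflexive (sym (Z-y≡ x∈X)))))) y∈)
  covered : ∀ S → T S → t + 1 ≤ ∣ S ∩ Z ∣
  covered S TS with X ⊆? S
  ... | no X⊈S = let y , y∈X , y∉S = ⊈⇒∃ X⊈S in
    ≤-trans (≤-reflexive (sym (Z-y≡ y∈X))) (p⊆q⇒∣p∣≤∣q∣ {p = Z - y} {S ∩ Z}
      (λ z∈ → x∈p∩q⁺ (Z-y⊆ TS y∈X y∉S z∈ , p─q⊆p Z ⁅ y ⁆ z∈)))
  ... | yes X⊆S with t + 1 ≤? ∣ S ∩ Z ∣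
  ...   | yes le = le
  -- Now S meets Z in X alone, and S₃ lies in Z and misses x, so the two share at most t - 1 points.
  ...   | no ¬le = contradiction (int TS T₃) (<⇒≱ (begin-strict
    ∣ S ∩ S₃ ∣ ≤⟨ p⊆q⇒∣p∣≤∣q∣ {p = S ∩ S₃} {X - x} (λ z∈ → let z∈S , z∈S₃ = x∈p∩q⁻ S S₃ z∈ in
                    x∈p∧x≢y⇒x∈p-y (subst (_ ∈_) (sym X≡S∩Z) (x∈p∩q⁺ (z∈S , S₃⊆Z z∈S₃))) λ { refl → x∉S₃ z∈S₃ }) ⟩
    ∣ X - x ∣ <⟨ x∈p⇒∣p-x∣<∣p∣ x∈X ⟩
    ∣ X ∣     ≡⟨ X≡t ⟩
    t         ∎))
    where
    open ≤-Reasoning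
    X≡S∩Z : X ≡ S ∩ Z
    X≡S∩Z = p⊆q∧∣q∣≤∣p∣⇒p≡q X (S ∩ Z) (λ z∈ → x∈p∩q⁺ (X⊆S z∈ , X⊆Z z∈))
      (≤-trans (s≤s⁻¹ (≤-trans (≰⇒> ¬le) (≤-reflexive (+-comm t 1)))) (≤-reflexive (sym X≡t)))

∈-⋂⁻ : ∀ {y : Fin n} {S} (L : List (Subset n)) → y ∈ Sub.⋂ L → S ∈ₗ L → y ∈ S
∈-⋂⁻ (S ∷ L) y∈ (here refl) = proj₁ (x∈p∩q⁻ S (Sub.⋂ L) y∈)
∈-⋂⁻ (S ∷ L) y∈ (there S∈) = ∈-⋂⁻ L (proj₂ (x∈p∩q⁻ S (Sub.⋂ L) y∈)) S∈

∉-⋂⁻ : ∀ {y : Fin n} (L : List (Subset n)) → y ∉ Sub.⋂ L → ∃ λ S → S ∈ₗ L × y ∉ S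
∉-⋂⁻ [] y∉ = contradiction ∈⊤ y∉
∉-⋂⁻ {y = y} (S ∷ L) y∉ with y ∈? S
... | no y∉S = S , here refl , y∉S
... | yes y∈S = let S′ , S′∈ , y∉S′ = ∉-⋂⁻ L (λ y∈L → y∉ (x∈p∩q⁺ (y∈S , y∈L))) in S′ , there S′∈ , y∉S′

-- Branching, and the kernel of a heavy t-set

module Core (n t m : ℕ) (2≤t : 2 ≤ t) (2≤m : 2 ≤ m) (n≥ : 7 * (m + 1) * (t + m) ^ 2 ≤ n)
  {F : Family n} (F? : Decidable F) (uniform : F ⊆ (t + m) -subsets) (int : t -intersecting F) where

  open Numbers n t m 2≤t 2≤m n≥
  open Bounds n t m 2≤t 2≤m n≥

  ∣⟨_⟩∣ : Subset n → ℕ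
  ∣⟨ A ⟩∣ = size (F? ⟨ A ⟩?)

  ∣⟨⟩∣≤up : ∀ A → ∣⟨ A ⟩∣ ≤ up ∣ A ∣
  ∣⟨⟩∣≤up A = size-⊇≤ (F? ⟨ A ⟩?) k A (λ (f , A⊆S) → uniform f , A⊆S)

  ∣A∪⁅y⁆∩B∣≤ : ∀ (A B : Subset n) y → ∣ (A ∪ ⁅ y ⁆) ∩ B ∣ ≤ suc ∣ A ∩ B ∣
  ∣A∪⁅y⁆∩B∣≤ A B y = begin
    ∣ (A ∪ ⁅ y ⁆) ∩ B ∣       ≤⟨ p⊆q⇒∣p∣≤∣q∣ {p = (A ∪ ⁅ y ⁆) ∩ B} {(A ∩ B) ∪ ⁅ y ⁆} (λ z∈ →
      let z∈A∪y , z∈B = x∈p∩q⁻ (A ∪ ⁅ y ⁆) B z∈ in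
      x∈p∪q⁺ (Sum.map₁ (λ z∈A → x∈p∩q⁺ (z∈A , z∈B)) (x∈p∪q⁻ A ⁅ y ⁆ z∈A∪y))) ⟩
    ∣ (A ∩ B) ∪ ⁅ y ⁆ ∣       ≡⟨ ∣p∪q∣≡∣p∣+∣q─p∣ (A ∩ B) ⁅ y ⁆ ⟩
    ∣ A ∩ B ∣ + ∣ ⁅ y ⁆ ─ (A ∩ B) ∣ ≤⟨ +-monoʳ-≤ ∣ A ∩ B ∣ (≤-trans (∣p─q∣≤∣p∣ ⁅ y ⁆ (A ∩ B)) (≤-reflexive (∣⁅x⁆∣≡1 y))) ⟩
    ∣ A ∩ B ∣ + 1             ≡⟨ +-comm ∣ A ∩ B ∣ 1 ⟩
    suc ∣ A ∩ B ∣ ∎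
    where open ≤-Reasoning

  branch : ∀ {B} A c → F B → ∣ A ∩ B ∣ < t → (∀ y → y ∉ A → ∣⟨ A ∪ ⁅ y ⁆ ⟩∣ ≤ c) → ∣⟨ A ⟩∣ ≤ (m + 1) * c
  branch {B} A c FB lt bd with blocker A B t m (≤-reflexive (uniform FB)) lt
  ... | Y , Y≤ , Y-mem , meets = ≤-trans
    (size-⋃-∈ (F? ⟨ A ⟩?) (λ y → F? ⟨ A ∪ ⁅ y ⁆ ⟩?) c Y
      (λ {S} (f , A⊆S) → let y , y∈Y , y∈S = meets S (int f FB) in y , y∈Y , f , ∪⁅⁆⊆ A⊆S y∈S)
      (λ y y∈Y → bd y (proj₂ (Y-mem y∈Y))))
    (*-monoˡ-≤ c (≤-trans Y≤ (≤-reflexive (+-comm 1 m))))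

  blocked : ∀ {B} A → F B → ∣ A ∩ B ∣ < t → ∣⟨ A ⟩∣ ≤ (m + 1) * up (suc ∣ A ∣)
  blocked A FB lt = branch A _ FB lt (λ y y∉ →
    ≤-trans (∣⟨⟩∣≤up (A ∪ ⁅ y ⁆)) (≤-reflexive (cong up (x∉p⇒∣p∪⁅x⁆∣≡suc∣p∣ y∉))))

  -- A new point raises `∣ A ∩ B ∣` by at most one, so when two points are missing the same `B`
  -- obstructs a second time.
  blocked² : ∀ {B} A → F B → suc ∣ A ∩ B ∣ < t → ∣⟨ A ⟩∣ ≤ (m + 1) * ((m + 1) * up (2 + ∣ A ∣))
  blocked² {B} A FB lt = branch A _ FB (<⇒≤ lt) (λ y y∉ →
    ≤-trans (blocked (A ∪ ⁅ y ⁆) FB (≤-trans (s≤s (∣A∪⁅y⁆∩B∣≤ A B y)) lt))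
      (≤-reflexive (cong (λ a → (m + 1) * up (suc a)) (x∉p⇒∣p∪⁅x⁆∣≡suc∣p∣ y∉))))

  -- The threshold rules out kernels with fewer than two points.
  Heavy : Subset n → Set
  Heavy X = ∣ X ∣ ≡ t × c₁ + (m + 1) * (m + 1) * c₂ < ∣⟨ X ⟩∣

  record Kernel (X D : Subset n) : Set where
    field
      disjoint : ∀ {y} → y ∈ D → y ∉ X
      2≤∣D∣    : 2 ≤ ∣ D ∣
      ∣D∣≤     : ∣ D ∣ ≤ m + 1
      outer    : ∀ {S} → F S → X Sub.⊈ S → D Sub.⊆ S × ∃ λ x → x ∈ X × x ∉ S × X - x Sub.⊆ S
      inner    : ∣⟨ X ⟩∣ ≤ ∣ D ∣ * c₁ + (m + 1) * (m + 1) * c₂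

  -- A member missing two points of `X` would obstruct twice and leave at most (m + 1)²c₂ members
  -- above `X`, against heaviness. For the bound on F[X], fix a member `B` not containing `X`: each
  -- member above `X` meets `B` outside `X`. A point of `D` accounts for at most c₁ of them. Any
  -- other such point y is missed by a member that still obstructs `X ∪ ⁅ y ⁆`, which leaves (m +
  -- 1)c₂.
  kernel : ∀ {X} → Heavy X → (∀ {S} → F S → X Sub.⊆ S) ⊎ ∃ (Kernel X)
  kernel {X} (X≡ , heavy) with anySubset? (λ S → F? S ×-dec ¬? (X ⊆? S))
  ... | no none = inj₁ (λ {S} FS → decidable-stable (X ⊆? S) (λ ¬⊆ → none (S , FS , ¬⊆)))
  ... | yes (B , FB , X⊈B) = inj₂ (D , record
    { disjoint = x∈p─q⇒x∉q (Sub.⋂ L) X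
    ; 2≤∣D∣ = ≰⇒> ∣D∣≰1
    ; ∣D∣≤ = ≤-trans (p⊆q⇒∣p∣≤∣q∣ D⊆B─X) B─X≤
    ; outer = outer
    ; inner = inner
    })
    where
    out? : Decidable (λ S → F S × X Sub.⊈ S)
    out? S = F? S ×-dec ¬? (X ⊆? S)
    L : List (Subset n)
    L = filter out? (subsets n)
    D : Subset n
    D = Sub.⋂ L ─ X
    near : ∀ {S} → F S → t ≤ suc ∣ X ∩ S ∣
    near {S} FS with t ≤? suc ∣ X ∩ S ∣
    ... | yes le = le
    ... | no ¬le = contradiction heavy (≤⇒≯ (begin
      ∣⟨ X ⟩∣                              ≤⟨ blocked² X FS (≰⇒> ¬le) ⟩
      (m + 1) * ((m + 1) * up (2 + ∣ X ∣)) ≡⟨ cong (λ a → (m + 1) * ((m + 1) * up (2 + a))) X≡ ⟩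
      (m + 1) * ((m + 1) * c₂)             ≡⟨ sym (*-assoc (m + 1) (m + 1) c₂) ⟩
      (m + 1) * (m + 1) * c₂               ≤⟨ m≤n+m _ c₁ ⟩
      c₁ + (m + 1) * (m + 1) * c₂          ∎))
      where open ≤-Reasoning
    far : ∀ {S} → X Sub.⊈ S → ∣ X ∩ S ∣ < t
    far {S} X⊈S = ≤-trans (p⊂q⇒∣p∣<∣q∣ {p = X ∩ S} {X} (p∩q⊆p X S ,
      let x , x∈ , x∉ = ⊈⇒∃ X⊈S in x , x∈ , λ x∈I → x∉ (proj₂ (x∈p∩q⁻ X S x∈I)))) (≤-reflexive X≡)
    outer : ∀ {S} → F S → X Sub.⊈ S → D Sub.⊆ S × ∃ λ x → x ∈ X × x ∉ S × X - x Sub.⊆ S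
    outer {S} FS X⊈S =
      (λ y∈D → ∈-⋂⁻ L (p─q⊆p (Sub.⋂ L) X y∈D) (∈-filter⁺ out? (∈-subsets S) (FS , X⊈S))) ,
      (let x , x∈ , x∉ = ⊈⇒∃ X⊈S in x , x∈ , x∉ ,
        -- The set reduced here is `X`, of size t, and `near` gives t - 1 common points.
        remove-⊆ {t = t ∸ 1} x∈ x∉ (≤-trans (≤-reflexive X≡) (m≤n+m∸n t 1))
          (≤-trans (∸-monoˡ-≤ 1 (near FS)) (≤-reflexive (cong ∣_∣ (∩-comm X S)))))
    D⊆B─X : D Sub.⊆ B ─ X
    D⊆B─X y∈ = x∈p∧x∉q⇒x∈p─q (proj₁ (outer FB X⊈B) y∈) (x∈p─q⇒x∉q (Sub.⋂ L) X y∈)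
    B─X≤ : ∣ B ─ X ∣ ≤ m + 1
    B─X≤ = +-cancelˡ-≤ (suc ∣ X ∩ B ∣) _ _ (begin
      suc (∣ X ∩ B ∣ + ∣ B ─ X ∣) ≡⟨ cong (λ I → suc (∣ I ∣ + ∣ B ─ X ∣)) (∩-comm X B) ⟩
      suc (∣ B ∩ X ∣ + ∣ B ─ X ∣) ≡⟨ cong suc (trans (∣p∩q∣+∣p─q∣≡∣p∣ B X) (uniform FB)) ⟩
      suc (t + m)                 ≡⟨ trans (+-comm 1 (t + m)) (+-assoc t m 1) ⟩
      t + (m + 1)                 ≤⟨ +-monoˡ-≤ (m + 1) (near FB) ⟩
      suc ∣ X ∩ B ∣ + (m + 1)     ∎)
      where open ≤-Reasoning
    E : Subset n
    E = (B ─ X) ─ D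
    In Out : Family n
    In S = F S × X Sub.⊆ S × Nonempty (D ∩ S)
    Out S = F S × X Sub.⊆ S × Nonempty (E ∩ S)
    In? : Decidable In
    In? S = F? S ×-dec X ⊆? S ×-dec nonempty? (D ∩ S)
    Out? : Decidable Out
    Out? S = F? S ×-dec X ⊆? S ×-dec nonempty? (E ∩ S)
    split : ∀ S → (F ⟨ X ⟩) S → In S ⊎ Out S
    split S (FS , X⊆S) with blocker X B t m (≤-reflexive (uniform FB)) (far X⊈B)
    ... | Y , _ , Y-mem , meets with meets S (int FS FB)
    ...   | y , y∈Y , y∈S with y ∈? D
    ...     | yes y∈D = inj₁ (FS , X⊆S , y , x∈p∩q⁺ (y∈D , y∈S))
    ...     | no  y∉D = inj₂ (FS , X⊆S , y , x∈p∩q⁺ (x∈p∧x∉q⇒x∈p─q (let y∈B , y∉X = Y-mem y∈Y in x∈p∧x∉q⇒x∈p─q y∈B y∉X) y∉D , y∈S))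
    ∣X∪⁅_⁆∣ : ∀ y → y ∉ X → ∣ X ∪ ⁅ y ⁆ ∣ ≡ suc t
    ∣X∪⁅ y ⁆∣ y∉ = trans (x∉p⇒∣p∪⁅x⁆∣≡suc∣p∣ y∉) (cong suc X≡)
    In≤ : size In? ≤ ∣ D ∣ * c₁
    In≤ = size-⋃-∈ In? (λ y → F? ⟨ X ∪ ⁅ y ⁆ ⟩?) c₁ D
      (λ {S} (FS , X⊆S , y , y∈) → let y∈D , y∈S = x∈p∩q⁻ D S y∈ in y , y∈D , FS , ∪⁅⁆⊆ X⊆S y∈S)
      (λ y y∈D → ≤-trans (∣⟨⟩∣≤up (X ∪ ⁅ y ⁆)) (≤-reflexive (cong up (∣X∪⁅ y ⁆∣ (x∈p─q⇒x∉q (Sub.⋂ L) X y∈D)))))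
    Out≤ : size Out? ≤ (m + 1) * ((m + 1) * c₂)
    Out≤ = ≤-trans
      (size-⋃-∈ Out? (λ y → F? ⟨ X ∪ ⁅ y ⁆ ⟩?) ((m + 1) * c₂) E
        (λ {S} (FS , X⊆S , y , y∈) → let y∈E , y∈S = x∈p∩q⁻ E S y∈ in y , y∈E , FS , ∪⁅⁆⊆ X⊆S y∈S)
        (λ y y∈E → let y∉X = x∈p─q⇒x∉q B X (p─q⊆p (B ─ X) D y∈E)
                       S , S∈L , y∉S = ∉-⋂⁻ L (λ y∈⋂ → x∈p─q⇒x∉q (B ─ X) D y∈E (x∈p∧x∉q⇒x∈p─q y∈⋂ y∉X))
                       FS , X⊈S = proj₂ (∈-filter⁻ out? {xs = subsets n} S∈L)
                   in ≤-trans
                        (blocked (X ∪ ⁅ y ⁆) FS (≤-trans (s≤s (p⊆q⇒∣p∣≤∣q∣ {p = (X ∪ ⁅ y ⁆) ∩ S} {X ∩ S} (λ z∈ →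
                          let z∈X∪y , z∈S = x∈p∩q⁻ (X ∪ ⁅ y ⁆) S z∈ in
                          [ (λ z∈X → x∈p∩q⁺ (z∈X , z∈S))
                          , (λ z∈y → contradiction (subst (_∈ S) (x∈⁅y⁆⇒x≡y y z∈y) z∈S) y∉S) ]′ (x∈p∪q⁻ X ⁅ y ⁆ z∈X∪y))))
                          (far X⊈S)))
                        (≤-reflexive (cong (λ a → (m + 1) * up (suc a)) (∣X∪⁅ y ⁆∣ y∉X)))))
      (*-monoˡ-≤ ((m + 1) * c₂) (≤-trans (∣p─q∣≤∣p∣ (B ─ X) D) B─X≤))
    inner : ∣⟨ X ⟩∣ ≤ ∣ D ∣ * c₁ + (m + 1) * (m + 1) * c₂
    inner = ≤-trans (size-cover (F? ⟨ X ⟩?) In? Out? (λ {S} → split S))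
      (+-mono-≤ In≤ (≤-trans Out≤ (≤-reflexive (sym (*-assoc (m + 1) (m + 1) c₂)))))
    ∣D∣≰1 : ∣ D ∣ ≰ 1
    ∣D∣≰1 D≤1 = contradiction heavy (≤⇒≯ (≤-trans inner
      (+-monoˡ-≤ ((m + 1) * (m + 1) * c₂) (≤-trans (*-monoˡ-≤ c₁ D≤1) (≤-reflexive (*-identityˡ c₁))))))

  module Tail {X D} (X≡ : ∣ X ∣ ≡ t) (K : Kernel X D) where
    open Kernel K

    out? : Decidable (F ∖ (F ⟨ X ⟩))
    out? = F? ∖? (F? ⟨ X ⟩?)

    core : Fin n → Subset n
    core x = (X - x) ∪ D

    core≡ : ∀ {x} → x ∈ X → suc ∣ core x ∣ ≡ t + ∣ D ∣
    core≡ {x} x∈ = begin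
      suc ∣ (X - x) ∪ D ∣     ≡⟨ cong suc (disjoint⇒∣p∪q∣≡∣p∣+∣q∣ (X - x) D (λ y∈ → disjoint y∈ ∘ p─q⊆p X ⁅ x ⁆)) ⟩
      suc ∣ X - x ∣ + ∣ D ∣   ≡⟨ cong (_+ ∣ D ∣) (trans (x∈p⇒suc∣p-x∣≡∣p∣ x∈) X≡) ⟩
      t + ∣ D ∣               ∎
      where open ≡-Reasoning

    outside-core : ∀ {S} → (F ∖ (F ⟨ X ⟩)) S → ∃ λ x → x ∈ X × x ∉ S × core x Sub.⊆ S
    outside-core {S} (FS , ¬FX) = let D⊆S , x , x∈ , x∉ , X-x⊆S = outer FS (λ X⊆S → ¬FX (FS , X⊆S)) in
      x , x∈ , x∉ , λ z∈ → [ X-x⊆S , D⊆S ]′ (x∈p∪q⁻ (X - x) D z∈)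

    tail≤ : size out? ≤ t * β ∣ D ∣
    tail≤ = ≤-trans
      (size-⋃-∈ out? (λ x → Interval? k (core x) (∁ ⁅ x ⁆)) (β ∣ D ∣) X
        (λ {S} o → let x , x∈ , x∉ , c⊆ = outside-core o in
          x , x∈ , uniform (proj₁ o) , c⊆ , λ z∈S → x∉p⇒x∈∁p (λ z∈x → x∉ (subst (_∈ S) (x∈⁅y⁆⇒x≡y x z∈x) z∈S)))
        (λ x x∈ → ≤-trans (size-Interval-∁⁅⁆≤ k (core x) x)
          (≤-reflexive (cong (λ a → (n ∸ a) C (n ∸ suc k)) (core≡ x∈)))))
      (≤-reflexive (cong (_* β ∣ D ∣) X≡))

    -- Such a `B` meets every core in at most t - 1 points and so obstructs it. The bound gains over
    -- `tail≤` since (m + 1) `up` (t + |D|) is below β |D|; it forces all of F[X] to meet `D`, both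
    -- for kernels of two points and in the case of equality.
    tail-missed≤ : ∀ {B} → F B → X Sub.⊆ B → (∀ {y} → y ∈ D → y ∉ B) → size out? ≤ t * ((m + 1) * up (t + ∣ D ∣))
    tail-missed≤ {B} FB X⊆B miss = ≤-trans
      (size-⋃-∈ out? (λ x → F? ⟨ core x ⟩?) ((m + 1) * up (t + ∣ D ∣)) X
        (λ o → let x , x∈ , x∉ , c⊆ = outside-core o in x , x∈ , proj₁ o , c⊆)
        (λ x x∈ → ≤-trans (blocked (core x) FB (begin-strict
            ∣ core x ∩ B ∣ ≤⟨ p⊆q⇒∣p∣≤∣q∣ {p = core x ∩ B} {X - x} (λ z∈ → let z∈c , z∈B = x∈p∩q⁻ (core x) B z∈ in
                               [ id , (λ z∈D → contradiction z∈B (miss z∈D)) ]′ (x∈p∪q⁻ (X - x) D z∈c)) ⟩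
            ∣ X - x ∣      <⟨ x∈p⇒∣p-x∣<∣p∣ x∈ ⟩
            ∣ X ∣          ≡⟨ X≡ ⟩
            t              ∎))
          (≤-reflexive (cong (λ a → (m + 1) * up a) (core≡ x∈)))))
      (≤-reflexive (cong (_* ((m + 1) * up (t + ∣ D ∣))) X≡))
      where open ≤-Reasoning

-- Each bound is the comparison of quadratic polynomials in t − 2 and m − 2 whose coefficients are all nonnegative.
module Quadratics where

  from-2 : (P Q : ℕ → ℕ → ℕ) → (∀ t m → P (2 + t) (2 + m) < Q (2 + t) (2 + m)) →
    ∀ {t m} → 2 ≤ t → 2 ≤ m → P t m < Q t m
  from-2 P Q h {suc (suc t)} {suc (suc m)} (s≤s (s≤s z≤n)) (s≤s (s≤s z≤n)) = h t m

  7k² : ℕ → ℕ → ℕ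
  7k² t m = 7 * ((t + m) * (t + m))

  q₁ : ∀ {t m} → 2 ≤ t → 2 ≤ m → 9 + ((m + 1) * (m + 1) + 6 * ((1 + t) * (2 + t))) < 7k² t m
  q₁ = from-2 (λ t m → 9 + ((m + 1) * (m + 1) + 6 * ((1 + t) * (2 + t)))) 7k² (λ t m →
    m+d≡n⇒m≤n (t * t + 14 * (t * m) + 6 * (m * m) + 14 * t + 50 * m + 21) (eq t m))
    where
    eq : ∀ t m → (10 + ((2 + m + 1) * (2 + m + 1) + 6 * ((3 + t) * (4 + t)))) +
      (t * t + 14 * (t * m) + 6 * (m * m) + 14 * t + 50 * m + 21) ≡ 7 * ((2 + t + (2 + m)) * (2 + t + (2 + m)))
    eq = solve-∀

  q₂ : ∀ {t m} → 2 ≤ t → 2 ≤ m → 9 + (t * (m + 1) + (t + 2) * (m + 1) + 6 * ((1 + t) * (2 + t))) < 7k² t m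
  q₂ = from-2 (λ t m → 9 + (t * (m + 1) + (t + 2) * (m + 1) + 6 * ((1 + t) * (2 + t)))) 7k² (λ t m →
    m+d≡n⇒m≤n (t * t + 12 * (t * m) + 7 * (m * m) + 8 * t + 50 * m + 12) (eq t m))
    where
    eq : ∀ t m → (10 + ((2 + t) * (2 + m + 1) + (2 + t + 2) * (2 + m + 1) + 6 * ((3 + t) * (4 + t)))) +
      (t * t + 12 * (t * m) + 7 * (m * m) + 8 * t + 50 * m + 12) ≡ 7 * ((2 + t + (2 + m)) * (2 + t + (2 + m)))
    eq = solve-∀

  q₃ : ∀ {t m} → 2 ≤ t → 2 ≤ m → (t + 3) * (t + 3) + 0 < 7k² t m
  q₃ = from-2 (λ t m → (t + 3) * (t + 3) + 0) 7k² (λ t m →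
    m+d≡n⇒m≤n (6 * (t * t) + 14 * (t * m) + 7 * (m * m) + 46 * t + 56 * m + 86) (eq t m))
    where
    eq : ∀ t m → 1 + ((2 + t + 3) * (2 + t + 3) + 0) +
      (6 * (t * t) + 14 * (t * m) + 7 * (m * m) + 46 * t + 56 * m + 86) ≡ 7 * ((2 + t + (2 + m)) * (2 + t + (2 + m)))
    eq = solve-∀

  q₄ : ∀ {t m} → 2 ≤ t → 2 ≤ m → (m + 2) * (m + 2) + ((m + 1) * (m + 1) + t) < 7k² t m
  q₄ = from-2 (λ t m → (m + 2) * (m + 2) + ((m + 1) * (m + 1) + t)) 7k² (λ t m →
    m+d≡n⇒m≤n (7 * (t * t) + 14 * (t * m) + 5 * (m * m) + 55 * t + 42 * m + 84) (eq t m))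
    where
    eq : ∀ t m → 1 + ((2 + m + 2) * (2 + m + 2) + ((2 + m + 1) * (2 + m + 1) + (2 + t))) +
      (7 * (t * t) + 14 * (t * m) + 5 * (m * m) + 55 * t + 42 * m + 84) ≡ 7 * ((2 + t + (2 + m)) * (2 + t + (2 + m)))
    eq = solve-∀

  q₅ : ∀ {t m} → 2 ≤ t → 2 ≤ m → 9 + ((m + 1) * (m + 1) + t * (m + 1)) < 7k² t m
  q₅ = from-2 (λ t m → 9 + ((m + 1) * (m + 1) + t * (m + 1))) 7k² (λ t m →
    m+d≡n⇒m≤n (7 * (t * t) + 13 * (t * m) + 6 * (m * m) + 53 * t + 48 * m + 87) (eq t m))
    where
    eq : ∀ t m → (10 + ((2 + m + 1) * (2 + m + 1) + (2 + t) * (2 + m + 1))) +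
      (7 * (t * t) + 13 * (t * m) + 6 * (m * m) + 53 * t + 48 * m + 87) ≡ 7 * ((2 + t + (2 + m)) * (2 + t + (2 + m)))
    eq = solve-∀

  q₆ : ∀ {t m} → 2 ≤ t → 2 ≤ m → 9 + ((m + 1) * (m + 1) + t) < 7k² t m
  q₆ = from-2 (λ t m → 9 + ((m + 1) * (m + 1) + t)) 7k² (λ t m →
    m+d≡n⇒m≤n (7 * (t * t) + 14 * (t * m) + 6 * (m * m) + 55 * t + 50 * m + 91) (eq t m))
    where
    eq : ∀ t m → (10 + ((2 + m + 1) * (2 + m + 1) + (2 + t))) +
      (7 * (t * t) + 14 * (t * m) + 6 * (m * m) + 55 * t + 50 * m + 91) ≡ 7 * ((2 + t + (2 + m)) * (2 + t + (2 + m)))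
    eq = solve-∀

open Quadratics

-- Stability, and the alternative between a popular t-set and a family 𝒜(Z)

module Structure (n t m : ℕ) (2≤t : 2 ≤ t) (2≤m : 2 ≤ m) (n≥ : 7 * (m + 1) * (t + m) ^ 2 ≤ n)
  {F : Family n} (F? : Decidable F) (uniform : F ⊆ (t + m) -subsets) (int : t -intersecting F) where

  open Numbers n t m 2≤t 2≤m n≥
  open Bounds n t m 2≤t 2≤m n≥
  open Core n t m 2≤t 2≤m n≥ F? uniform int

  -- For the uniform family F this says F ⊆ 𝒜(Z); the pages are the t + 2 sets Z - z.
  Book : Subset n → Set
  Book Z = ∣ Z ∣ ≡ t + 2 × (∀ S → F S → t + 1 ≤ ∣ S ∩ Z ∣)

  page : ∀ {Z S : Subset n} → ∣ Z ∣ ≡ t + 2 → t + 1 ≤ ∣ S ∩ Z ∣ → ∃ λ z → z ∈ Z × Z - z Sub.⊆ S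
  page {Z} {S} Z≡ le with Z ⊆? S
  ... | no Z⊈S = let z , z∈Z , z∉S = ⊈⇒∃ Z⊈S in
    z , z∈Z , remove-⊆ z∈Z z∉S (≤-reflexive (trans Z≡ (+-suc t 1))) le
  ... | yes Z⊆S with nonempty? Z
  ...   | yes (z , z∈Z) = z , z∈Z , λ y∈ → Z⊆S (p─q⊆p Z ⁅ z ⁆ y∈)
  ...   | no empty = contradiction (trans (sym (trans (cong ∣_∣ (Empty-unique empty)) (∣⊥∣≡0 n))) Z≡) (λ e → 0≢1+n (trans e (+-suc t 1)))

  ∣Z-z∣ : ∀ {Z : Subset n} {z} → ∣ Z ∣ ≡ t + 2 → z ∈ Z → ∣ Z - z ∣ ≡ suc t
  ∣Z-z∣ Z≡ z∈ = suc-injective (trans (x∈p⇒suc∣p-x∣≡∣p∣ z∈) (trans Z≡ (+-comm t 2)))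

  -- In the book case a member `B` with at most t points in `Z` is impossible. It obstructs the at
  -- most t pages Z - z with z ∈ `B`. The pages with z ∉ `B` are obstructed too, unless |B ∩ Z| = t;
  -- then there are just two of them, with at most c₁ members each. So |F| would be at most 2c₁ up
  -- to multiples of c₂.
  stability : 3 * c₁ ≤ size F? + 9 * c₂ → (∃ Heavy) ⊎ (∃ Book)
  -- `peel j` starts from sets of size at most t + 1 + j, and k = t + m.
  stability f≥ with peel t {n} k (m ∸ 1) F? int
    (λ FS → ≤-reflexive (trans (uniform FS) (cong (t +_) (sym (m+[n∸m]≡n {1} {m} (≤-trans (s≤s z≤n) 2≤m))))))
  ... | T₁ , T₁? , int₁ , bd₁ , Q , Q? , Q≤ , cov with sunflower-or-book t T₁? (≤-trans (m≤m+n t m) (<⇒≤ k<n)) int₁ bd₁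
  ...   | inj₁ (X , X≡ , all⊇) = inj₁ (X , X≡ , ≰⇒> light)
    where
    rest : ℕ
    rest = 6 * ((1 + t) * (2 + t))
    split : ∀ S → F S → (F ⟨ X ⟩) S ⊎ Q S
    split S FS with cov FS (uniform FS) ⊆-refl
    ... | inj₁ (V , TV , V⊆S) = inj₁ (FS , ⊆-trans (all⊇ V TV) V⊆S)
    ... | inj₂ q = inj₂ q
    light : ∣⟨ X ⟩∣ ≰ c₁ + (m + 1) * (m + 1) * c₂
    light le = squeeze 2 (size F?) 9 ((m + 1) * (m + 1) + rest) f≥ (begin
      size F?                                            ≤⟨ size-cover F? (F? ⟨ X ⟩?) Q? (λ {S} → split S) ⟩
      ∣⟨ X ⟩∣ + size Q?                                  ≤⟨ +-mono-≤ le (≤-trans Q≤ (levels≤ (m ∸ 1))) ⟩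
      -- A whole c₁ is given away: anything near 2c₁ already contradicts `f≥`.
      c₁ + (m + 1) * (m + 1) * c₂ + rest * c₂               ≤⟨ m≤n+m _ c₁ ⟩
      c₁ + (c₁ + (m + 1) * (m + 1) * c₂ + rest * c₂)        ≡⟨ lemma c₁ ((m + 1) * (m + 1)) rest c₂ ⟩
      2 * c₁ + ((m + 1) * (m + 1) + rest) * c₂              ∎) (q₁ 2≤t 2≤m)
      where
      open ≤-Reasoning
      lemma : ∀ a b c d → a + (a + b * d + c * d) ≡ 2 * a + (b + c) * d
      lemma = solve-∀
  ...   | inj₂ (Z , Z≡ , covered) with anySubset? (λ S → F? S ×-dec ¬? (t + 1 ≤? ∣ S ∩ Z ∣))
  ...     | no none = inj₂ (Z , Z≡ , λ S FS → decidable-stable (t + 1 ≤? ∣ S ∩ Z ∣) (λ ¬le → none (S , FS , ¬le)))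
  ...     | yes (B , FB , ¬le) = ⊥-elim (squeeze 2 (size F?) 9 (t * (m + 1) + (t + 2) * (m + 1) + rest) f≥ (begin
      size F?                                               ≤⟨ size-cover F? GQ? G₁? (λ {S} → split S) ⟩
      size GQ? + size G₁?                                   ≤⟨ +-monoˡ-≤ (size G₁?) (size-cover GQ? G₂? Q? id) ⟩
      size G₂? + size Q? + size G₁?                         ≤⟨ +-mono-≤ (+-mono-≤ G₂≤ (≤-trans Q≤ (levels≤ (m ∸ 1)))) G₁≤ ⟩
      2 * c₁ + (t + 2) * ((m + 1) * c₂) + rest * c₂ + t * ((m + 1) * c₂)  ≡⟨ lemma c₁ (t + 2) (m + 1) c₂ rest t ⟩
      2 * c₁ + (t * (m + 1) + (t + 2) * (m + 1) + rest) * c₂   ∎) (q₂ 2≤t 2≤m))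
    where
    open ≤-Reasoning
    lemma : ∀ a b c d e f → 2 * a + b * (c * d) + e * d + f * (c * d) ≡ 2 * a + (f * c + b * c + e) * d
    lemma = solve-∀
    rest : ℕ
    rest = 6 * ((1 + t) * (2 + t))
    B∩Z≤t : ∣ B ∩ Z ∣ ≤ t
    B∩Z≤t = s≤s⁻¹ (≤-trans (≰⇒> ¬le) (≤-reflexive (+-comm t 1)))
    G₁ G₂ GQ : Family n
    G₁ S = F S × ∃ λ z → z ∈ Z ∩ B × Z - z Sub.⊆ S
    G₂ S = F S × ∃ λ z → z ∈ Z ─ B × Z - z Sub.⊆ S
    GQ S = G₂ S ⊎ Q S
    G₁? : Decidable G₁
    G₁? S = F? S ×-dec Finₚ.any? (λ z → z ∈? (Z ∩ B) ×-dec (Z - z) ⊆? S)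
    G₂? : Decidable G₂
    G₂? S = F? S ×-dec Finₚ.any? (λ z → z ∈? (Z ─ B) ×-dec (Z - z) ⊆? S)
    GQ? : Decidable GQ
    GQ? S = G₂? S ⊎-dec Q? S
    split : ∀ S → F S → GQ S ⊎ G₁ S
    split S FS with cov FS (uniform FS) ⊆-refl
    ... | inj₂ q = inj₁ (inj₂ q)
    ... | inj₁ (V , TV , V⊆S) with page {Z} {S} Z≡ (≤-trans (covered V TV) (p⊆q⇒∣p∣≤∣q∣ {p = V ∩ Z} {S ∩ Z}
            (λ z∈ → let z∈V , z∈Z = x∈p∩q⁻ V Z z∈ in x∈p∩q⁺ (V⊆S z∈V , z∈Z))))
    ...   | z , z∈Z , Z-z⊆S with z ∈? B
    ...     | yes z∈B = inj₂ (FS , z , x∈p∩q⁺ (z∈Z , z∈B) , Z-z⊆S)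
    ...     | no  z∉B = inj₁ (inj₁ (FS , z , x∈p∧x∉q⇒x∈p─q z∈Z z∉B , Z-z⊆S))
    thin : ∀ z → z ∈ Z → ∣ (Z - z) ∩ B ∣ < t → ∣⟨ Z - z ⟩∣ ≤ (m + 1) * c₂
    thin z z∈Z lt = ≤-trans (blocked (Z - z) FB lt) (≤-reflexive (cong (λ a → (m + 1) * up (suc a)) (∣Z-z∣ Z≡ z∈Z)))
    G₁≤ : size G₁? ≤ t * ((m + 1) * c₂)
    G₁≤ = ≤-trans
      (size-⋃-∈ G₁? (λ z → F? ⟨ Z - z ⟩?) ((m + 1) * c₂) (Z ∩ B)
        (λ (FS , z , z∈ , ⊆S) → z , z∈ , FS , ⊆S)
        (λ z z∈ → let z∈Z , z∈B = x∈p∩q⁻ Z B z∈ in thin z z∈Z (begin-strict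
          ∣ (Z - z) ∩ B ∣ <⟨ p⊂q⇒∣p∣<∣q∣ {p = (Z - z) ∩ B} {Z ∩ B}
            ((λ y∈ → let y∈Z-z , y∈B = x∈p∩q⁻ (Z - z) B y∈ in x∈p∩q⁺ (p─q⊆p Z ⁅ z ⁆ y∈Z-z , y∈B)) ,
              z , z∈ , λ z∈I → x∈p─q⇒x∉q Z ⁅ z ⁆ (proj₁ (x∈p∩q⁻ (Z - z) B z∈I)) (x∈⁅x⁆ z)) ⟩
          ∣ Z ∩ B ∣       ≡⟨ cong ∣_∣ (∩-comm Z B) ⟩
          ∣ B ∩ Z ∣       ≤⟨ B∩Z≤t ⟩
          t ∎)))
      (*-monoˡ-≤ ((m + 1) * c₂) (≤-trans (≤-reflexive (cong ∣_∣ (∩-comm Z B))) B∩Z≤t))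
    G₂≤ : size G₂? ≤ 2 * c₁ + (t + 2) * ((m + 1) * c₂)
    G₂≤ with m≤n⇒m<n∨m≡n B∩Z≤t
    ... | inj₁ lt = ≤-trans
      (size-⋃-∈ G₂? (λ z → F? ⟨ Z - z ⟩?) ((m + 1) * c₂) (Z ─ B)
        (λ (FS , z , z∈ , ⊆S) → z , z∈ , FS , ⊆S)
        (λ z z∈ → thin z (p─q⊆p Z B z∈) (≤-trans (s≤s (≤-trans (p⊆q⇒∣p∣≤∣q∣ {p = (Z - z) ∩ B} {B ∩ Z}
          (λ y∈ → let y∈Z-z , y∈B = x∈p∩q⁻ (Z - z) B y∈ in x∈p∩q⁺ (y∈B , p─q⊆p Z ⁅ z ⁆ y∈Z-z))) ≤-refl)) lt)))
      (≤-trans (*-monoˡ-≤ ((m + 1) * c₂) (≤-trans (∣p─q∣≤∣p∣ Z B) (≤-reflexive Z≡))) (m≤n+m _ (2 * c₁)))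
    ... | inj₂ eq = ≤-trans
      (size-⋃-∈ G₂? (λ z → F? ⟨ Z - z ⟩?) c₁ (Z ─ B)
        (λ (FS , z , z∈ , ⊆S) → z , z∈ , FS , ⊆S)
        (λ z z∈ → ≤-trans (∣⟨⟩∣≤up (Z - z)) (≤-reflexive (cong up (∣Z-z∣ Z≡ (p─q⊆p Z B z∈))))))
      (≤-trans (*-monoˡ-≤ c₁ (≤-reflexive two)) (m≤m+n (2 * c₁) _))
      where
      two : ∣ Z ─ B ∣ ≡ 2
      two = +-cancelˡ-≡ t _ _ (trans (cong (_+ ∣ Z ─ B ∣) (sym (trans (cong ∣_∣ (∩-comm Z B)) eq)))
        (trans (∣p∩q∣+∣p─q∣≡∣p∣ Z B) Z≡))

  size-Book : ∀ {Z} → Book Z → size F? ≤ (t + 2) * c₁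
  size-Book {Z} (Z≡ , covered) = ≤-trans
    (size-⋃-∈ F? (λ z → F? ⟨ Z - z ⟩?) c₁ Z
      (λ {S} FS → let z , z∈Z , ⊆S = page {Z} {S} Z≡ (covered S FS) in z , z∈Z , FS , ⊆S)
      (λ z z∈ → ≤-trans (∣⟨⟩∣≤up (Z - z)) (≤-reflexive (cong up (∣Z-z∣ Z≡ z∈)))))
    (≤-reflexive (cong (_* c₁) Z≡))

  module _ {d : ℕ} (2≤d : 2 ≤ d) (f≥ : σ d + t * β d ≤ size F?) where

    -- The t + 2 pages hold at most (t + 2)c₁ members, whereas d ≥ t + 3 would require about (t +
    -- 3)c₁.
    Book⇒d≤t+2 : ∀ {Z} → Book Z → d ≤ t + 2
    Book⇒d≤t+2 {Z} book with d ≤? t + 2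
    ... | yes d≤ = d≤
    ... | no d≰ = ⊥-elim (squeeze (t + 2) (size F?) ((t + 3) * (t + 3)) 0
      (subst (λ e → e * c₁ ≤ size F? + (t + 3) * (t + 3) * c₂) (+-suc t 2)
        (size≥ 2≤d f≥ {t + 3} (≤-trans (≤-reflexive (+-suc t 2)) (≰⇒> d≰)) t+3≤))
      (≤-trans (size-Book book) (≤-reflexive (sym (+-identityʳ _))))
      (q₃ 2≤t 2≤m))
      where
      t+3≤ : t + 3 ≤ 2 + m + t
      t+3≤ = ≤-trans (≤-reflexive (+-comm t 3)) (+-monoˡ-≤ t (+-monoʳ-≤ 2 (≤-trans (s≤s z≤n) 2≤m)))

    -- If `d` exceeded |D|, the lower bound with e = |D| + 1 would surpass `inner` by one c₁. The
    -- second hypothesis makes the members outside F[X] a lower-order term; it comes from |D| ≥ 3 or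
    -- from a small diversity.
    Kernel⇒d≤∣D∣ : ∀ {X D} → Kernel X D → size F? ≤ ∣⟨ X ⟩∣ + t * c₂ → d ≤ ∣ D ∣
    Kernel⇒d≤∣D∣ {X} {D} K f≤ with d ≤? ∣ D ∣
    ... | yes d≤ = d≤
    ... | no d≰ = ⊥-elim (squeeze ∣ D ∣ (size F?) ((m + 2) * (m + 2)) ((m + 1) * (m + 1) + t)
      (≤-trans (size≥ 2≤d f≥ {suc ∣ D ∣} (≰⇒> d≰) (≤-trans 1+D≤ (≤-trans (≤-reflexive (+-comm m 2)) (m≤m+n (2 + m) t))))
        (+-monoʳ-≤ (size F?) (*-monoˡ-≤ c₂ (*-mono-≤ 1+D≤ 1+D≤))))
      (begin
        size F?                                               ≤⟨ f≤ ⟩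
        ∣⟨ X ⟩∣ + t * c₂                                      ≤⟨ +-monoˡ-≤ (t * c₂) inner ⟩
        ∣ D ∣ * c₁ + (m + 1) * (m + 1) * c₂ + t * c₂          ≡⟨ lemma (∣ D ∣ * c₁) ((m + 1) * (m + 1)) t c₂ ⟩
        ∣ D ∣ * c₁ + ((m + 1) * (m + 1) + t) * c₂             ∎)
      (q₄ 2≤t 2≤m))
      where
      open ≤-Reasoning
      open Kernel K
      lemma : ∀ a b c d → a + b * d + c * d ≡ a + (b + c) * d
      lemma = solve-∀
      1+D≤ : suc ∣ D ∣ ≤ m + 2
      1+D≤ = ≤-trans (s≤s ∣D∣≤) (≤-reflexive (sym (+-suc m 1)))

    -- Here `tail≤` gives only t β 2, which is of order c₁. But a member of F[X] avoiding `D` would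
    -- make the tail of order c₂ by `tail-missed≤`, and then |F| would fall short of 3c₁.
    Kernel⇒Book : ∀ {X D} → ∣ X ∣ ≡ t → Kernel X D → ∣ D ∣ ≡ 2 → ∃ Book
    Kernel⇒Book {X} {D} X≡ K D≡2 with anySubset? (λ B → F? B ×-dec X ⊆? B ×-dec ¬? (nonempty? (D ∩ B)))
    ... | yes (B , FB , X⊆B , miss) = ⊥-elim (squeeze 2 (size F?) 9 ((m + 1) * (m + 1) + t * (m + 1))
      (size≥3 2≤d f≥) (begin
        size F?                                               ≤⟨ size≤⟨⟩+∖ F? X ⟩
        ∣⟨ X ⟩∣ + size out?                                   ≤⟨ +-mono-≤ inner (tail-missed≤ FB X⊆B (λ {y} y∈D y∈B → miss (y , x∈p∩q⁺ (y∈D , y∈B)))) ⟩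
        ∣ D ∣ * c₁ + (m + 1) * (m + 1) * c₂ + t * ((m + 1) * up (t + ∣ D ∣))
          ≡⟨ cong₂ (λ e s → e * c₁ + (m + 1) * (m + 1) * c₂ + t * ((m + 1) * up s)) D≡2 (trans (cong (t +_) D≡2) (+-comm t 2)) ⟩
        2 * c₁ + (m + 1) * (m + 1) * c₂ + t * ((m + 1) * c₂)  ≡⟨ lemma c₁ ((m + 1) * (m + 1)) t (m + 1) c₂ ⟩
        2 * c₁ + ((m + 1) * (m + 1) + t * (m + 1)) * c₂       ∎)
      (q₅ 2≤t 2≤m))
      where
      open ≤-Reasoning
      open Kernel K
      open Tail X≡ K
      lemma : ∀ a b t m c → 2 * a + b * c + t * (m * c) ≡ 2 * a + (b + t * m) * c
      lemma = solve-∀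
    ... | no none = X ∪ D , Z≡ , covered
      where
      open Kernel K
      open Tail X≡ K
      Z≡ : ∣ X ∪ D ∣ ≡ t + 2
      Z≡ = trans (disjoint⇒∣p∪q∣≡∣p∣+∣q∣ X D disjoint) (cong₂ _+_ X≡ D≡2)
      covered : ∀ S → F S → t + 1 ≤ ∣ S ∩ (X ∪ D) ∣
      covered S FS with X ⊆? S
      ... | yes X⊆S with nonempty? (D ∩ S)
      ...   | no miss = ⊥-elim (none (S , FS , X⊆S , miss))
      ...   | yes (y , y∈) = let y∈D , y∈S = x∈p∩q⁻ D S y∈ in
        ≤-trans (≤-reflexive (trans (+-comm t 1) (sym (trans (x∉p⇒∣p∪⁅x⁆∣≡suc∣p∣ (disjoint y∈D)) (cong suc X≡)))))
          (p⊆q⇒∣p∣≤∣q∣ {p = X ∪ ⁅ y ⁆} {S ∩ (X ∪ D)} (λ z∈ → x∈p∩q⁺ (∪⁅⁆⊆ X⊆S y∈S z∈ , ∪⁅⁆⊆ (p⊆p∪q D) (q⊆p∪q X D y∈D) z∈)))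
      covered S FS | no X⊈S =
        let x , x∈ , x∉ , c⊆ = outside-core {S} (FS , λ (_ , X⊆S) → X⊈S X⊆S) in
        ≤-trans (≤-reflexive (suc-injective (sym (trans (core≡ x∈) (trans (cong (t +_) D≡2) (+-suc t 1))))))
          (p⊆q⇒∣p∣≤∣q∣ {p = core x} {S ∩ (X ∪ D)} (λ z∈ → x∈p∩q⁺ (c⊆ z∈ ,
            x∈p∪q⁺ (Sum.map₁ (p─q⊆p X ⁅ x ⁆) (x∈p∪q⁻ (X - x) D z∈)))))

    dichotomy : (∃ λ X → ∣ X ∣ ≡ t × size (F? ∖? (F? ⟨ X ⟩?)) ≤ t * β d) ⊎ (d ≤ t + 2 × ∃ Book)
    dichotomy with stability (size≥3 2≤d f≥)
    ... | inj₂ (Z , book) = inj₂ (Book⇒d≤t+2 book , Z , book)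
    ... | inj₁ (X , heavy@(X≡ , _)) with kernel heavy
    ...   | inj₁ trivial = inj₁ (X , X≡ , ≤-trans
      (≤-reflexive (size-empty (F? ∖? (F? ⟨ X ⟩?)) (λ (FS , ¬FX) → ¬FX (FS , trivial FS)))) z≤n)
    ...   | inj₂ (D , K) with d ≤? ∣ D ∣ | m≤n⇒m<n∨m≡n (Kernel.2≤∣D∣ K)
    ...     | yes d≤ | _ = inj₁ (X , X≡ , ≤-trans tail≤ (*-monoʳ-≤ t (β-mono d≤)))
      where open Tail X≡ K
    ...     | no d≰ | inj₁ 3≤D = ⊥-elim (d≰ (Kernel⇒d≤∣D∣ K
      (≤-trans (size≤⟨⟩+∖ F? X) (+-monoʳ-≤ ∣⟨ X ⟩∣ (≤-trans tail≤ (*-monoʳ-≤ t (≤-trans (β-mono 3≤D) β₃≤c₂)))))))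
      where open Tail X≡ K
    ...     | no d≰ | inj₂ 2≡D =
      let Z , book = Kernel⇒Book X≡ K (sym 2≡D) in inj₂ (Book⇒d≤t+2 book , Z , book)

-- Permuting a chain X ⊆ U to initial segments

∈⇒lookup : ∀ {A : Subset n} {i} → i ∈ A → lookup A i ≡ inside
∈⇒lookup = Vecₚ.[]=⇒lookup

lookup⇒∈ : ∀ {A : Subset n} {i} → lookup A i ≡ inside → i ∈ A
lookup⇒∈ {A = A} {i} = Vecₚ.lookup⇒[]= i A

module _ (π : Permutation′ n) where

  lookup-image : ∀ A i → lookup (image π A) (π ⟨$⟩ʳ i) ≡ lookup A i
  lookup-image A i = trans (Vecₚ.lookup∘tabulate _ (π ⟨$⟩ʳ i)) (cong (lookup A) (Perm.inverseˡ π))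

  ∈-image⁺ : ∀ {A i} → i ∈ A → π ⟨$⟩ʳ i ∈ image π A
  ∈-image⁺ {A} {i} i∈ = lookup⇒∈ (trans (lookup-image A i) (∈⇒lookup i∈))

  ∈-image⁻ : ∀ {A i} → i ∈ image π A → π ⟨$⟩ˡ i ∈ A
  ∈-image⁻ {A} {i} i∈ = lookup⇒∈ (trans (sym (Vecₚ.lookup∘tabulate _ i)) (∈⇒lookup i∈))

  ∈-image⁺′ : ∀ {A i} → π ⟨$⟩ˡ i ∈ A → i ∈ image π A
  ∈-image⁺′ {A} {i} i∈ = subst (_∈ image π A) (Perm.inverseʳ π) (∈-image⁺ i∈)

  ∈-image⁻′ : ∀ {A i} → π ⟨$⟩ʳ i ∈ image π A → i ∈ A
  ∈-image⁻′ {A} {i} i∈ = subst (_∈ A) (Perm.inverseˡ π) (∈-image⁻ i∈)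

  image-mono : ∀ {A B} → A Sub.⊆ B → image π A Sub.⊆ image π B
  image-mono A⊆B i∈ = ∈-image⁺′ (A⊆B (∈-image⁻ i∈))

  image-reflects-⊆ : ∀ {A B} → image π A Sub.⊆ image π B → A Sub.⊆ B
  image-reflects-⊆ A⊆B i∈ = ∈-image⁻′ (A⊆B (∈-image⁺ i∈))

  image-injective : ∀ {A B} → image π A ≡ image π B → A ≡ B
  image-injective eq = ⊆-antisym
    (image-reflects-⊆ (⊆-reflexive eq)) (image-reflects-⊆ (⊆-reflexive (sym eq)))

  image-∩ : ∀ A B → image π (A ∩ B) ≡ image π A ∩ image π B
  image-∩ A B = ⊆-antisym
    (λ i∈ → let a , b = x∈p∩q⁻ A B (∈-image⁻ i∈) in x∈p∩q⁺ (∈-image⁺′ a , ∈-image⁺′ b))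
    (λ i∈ → let a , b = x∈p∩q⁻ (image π A) (image π B) i∈ in ∈-image⁺′ {A ∩ B} (x∈p∩q⁺ (∈-image⁻ a , ∈-image⁻ b)))

  image-─ : ∀ A B → image π (A ─ B) ≡ image π A ─ image π B
  image-─ A B = ⊆-antisym
    (λ i∈ → x∈p∧x∉q⇒x∈p─q (∈-image⁺′ (p─q⊆p A B (∈-image⁻ i∈))) (λ b → x∈p─q⇒x∉q A B (∈-image⁻ i∈) (∈-image⁻ b)))
    (λ i∈ → ∈-image⁺′ {A ─ B} (x∈p∧x∉q⇒x∈p─q (∈-image⁻ (p─q⊆p (image π A) (image π B) i∈))
              (λ b → x∈p─q⇒x∉q (image π A) (image π B) i∈ (∈-image⁺′ b))))

  image-⁅⁆ : ∀ x → image π ⁅ x ⁆ ≡ ⁅ π ⟨$⟩ʳ x ⁆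
  image-⁅⁆ x = ⊆-antisym
    (λ {i} i∈ → subst (_∈ ⁅ π ⟨$⟩ʳ x ⁆) (trans (cong (π ⟨$⟩ʳ_) (sym (x∈⁅y⁆⇒x≡y x (∈-image⁻ i∈)))) (Perm.inverseʳ π)) (x∈⁅x⁆ _))
    (λ i∈ → subst (_∈ image π ⁅ x ⁆) (sym (x∈⁅y⁆⇒x≡y _ i∈)) (∈-image⁺ (x∈⁅x⁆ x)))

  image-minus : ∀ A x → image π (A - x) ≡ image π A - (π ⟨$⟩ʳ x)
  image-minus A x = trans (image-─ A ⁅ x ⁆) (cong (image π A ─_) (image-⁅⁆ x))

  ∣image∣ : ∀ A → ∣ image π A ∣ ≡ ∣ A ∣
  ∣image∣ A = go ∣ A ∣ A refl
    where
    ∣Empty∣ : ∀ {A : Subset n} → ¬ Nonempty A → ∣ A ∣ ≡ 0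
    ∣Empty∣ empty = trans (cong ∣_∣ (Empty-unique empty)) (∣⊥∣≡0 n)
    go : ∀ c A → ∣ A ∣ ≡ c → ∣ image π A ∣ ≡ c
    go c A A≡ with nonempty? A
    go c A A≡ | no empty = trans (∣Empty∣ (λ (i , i∈) → empty (_ , ∈-image⁻ i∈))) (trans (sym (∣Empty∣ empty)) A≡)
    go zero A A≡ | yes (x , x∈) = contradiction (trans (x∈p⇒suc∣p-x∣≡∣p∣ x∈) A≡) λ ()
    go (suc c) A A≡ | yes (x , x∈) = trans (sym (x∈p⇒suc∣p-x∣≡∣p∣ (∈-image⁺ x∈)))
      (cong suc (trans (cong ∣_∣ (sym (image-minus A x))) (go c (A - x) (suc-injective (trans (x∈p⇒suc∣p-x∣≡∣p∣ x∈) A≡)))))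

  ℒ-image : ∀ k {X U V A} → ℒ k X U V A ⇔ ℒ k (image π X) (image π U) (image π V) (image π A)
  ℒ-image k {X} {U} {V} {A} = mk⇔ to from
    where
    meet≡ : image π (A ∩ (V ─ X)) ≡ image π A ∩ (image π V ─ image π X)
    meet≡ = trans (image-∩ A (V ─ X)) (cong (image π A ∩_) (image-─ V X))
    to : ℒ k X U V A → ℒ k (image π X) (image π U) (image π V) (image π A)
    to (A≡ , inj₁ (X⊆A , y , y∈)) = trans (∣image∣ A) A≡ , inj₁ (image-mono X⊆A , π ⟨$⟩ʳ y , subst (_ ∈_) meet≡ (∈-image⁺ y∈))
    to (A≡ , inj₂ (x , x∈ , eq)) = trans (∣image∣ A) A≡ , inj₂ (π ⟨$⟩ʳ x , ∈-image⁺ x∈ ,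
      trans (sym (image-∩ A U)) (trans (cong (image π) eq) (image-minus U x)))
    from : ℒ k (image π X) (image π U) (image π V) (image π A) → ℒ k X U V A
    from (A≡ , inj₁ (X⊆A , y , y∈)) = trans (sym (∣image∣ A)) A≡ , inj₁ (image-reflects-⊆ X⊆A , π ⟨$⟩ˡ y , ∈-image⁻ (subst (_ ∈_) (sym meet≡) y∈))
    from (A≡ , inj₂ (x , x∈ , eq)) = trans (sym (∣image∣ A)) A≡ , inj₂ (π ⟨$⟩ˡ x , ∈-image⁻ x∈ ,
      image-injective (trans (image-∩ A U) (trans eq (trans (cong (image π U -_) (sym (Perm.inverseʳ π))) (sym (image-minus U (π ⟨$⟩ˡ x)))))))

image-flip : ∀ (π : Permutation′ n) A → image π (image (Perm.flip π) A) ≡ A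
image-flip π A = ⊆-antisym
  (λ {i} i∈ → subst (_∈ A) (Perm.inverseʳ π) (∈-image⁻ (Perm.flip π) (∈-image⁻ π i∈)))
  (λ {i} i∈ → ∈-image⁺′ π (∈-image⁺ (Perm.flip π) i∈))

lookup-initial : ∀ s (i : Fin n) → lookup (initial n s) i ≡ does (toℕ i <? s)
lookup-initial s i = Vecₚ.lookup∘tabulate _ i

image≡initial : ∀ (π : Permutation′ n) A s → (∀ i → does (toℕ (π ⟨$⟩ʳ i) <? s) ≡ lookup A i) → image π A ≡ initial n s
image≡initial π A s h = Vecₚ.tabulate-cong (λ i → trans (sym (h (π ⟨$⟩ˡ i)))
  (cong (λ j → does (toℕ j <? s)) (Perm.inverseʳ π)))

toℕ-punchIn : ∀ (j : Fin (suc n)) l →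
  (toℕ l < toℕ j × toℕ (punchIn j l) ≡ toℕ l) ⊎ (toℕ j ≤ toℕ l × toℕ (punchIn j l) ≡ suc (toℕ l))
toℕ-punchIn zero l = inj₂ (z≤n , refl)
toℕ-punchIn (suc j) zero = inj₁ (z<s , refl)
toℕ-punchIn (suc j) (suc l) with toℕ-punchIn j l
... | inj₁ (lt , eq) = inj₁ (s≤s lt , cong suc eq)
... | inj₂ (le , eq) = inj₂ (s≤s le , cong suc eq)

-- `punchIn j` leaves a gap at `j`: a gap at or below `s` lengthens the initial segment by one, a
-- gap at or beyond its end leaves it alone.
punchIn<-inside : ∀ {s} (j : Fin (suc n)) l → toℕ j ≤ s → does (toℕ (punchIn j l) <? suc s) ≡ does (toℕ l <? s)
punchIn<-inside {s = s} j l j≤s with toℕ-punchIn j l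
... | inj₁ (lt , eq) = trans (cong (λ p → does (p <? suc s)) eq)
  (trans (dec-true (toℕ l <? suc s) (m≤n⇒m≤1+n (≤-trans lt j≤s))) (sym (dec-true (toℕ l <? s) (≤-trans lt j≤s))))
... | inj₂ (_ , eq) = cong (λ p → does (p <? suc s)) eq

punchIn<-outside : ∀ {s} (j : Fin (suc n)) l → s ≤ toℕ j → does (toℕ (punchIn j l) <? s) ≡ does (toℕ l <? s)
punchIn<-outside {s = s} j l s≤j with toℕ-punchIn j l
... | inj₁ (_ , eq) = cong (λ p → does (p <? s)) eq
... | inj₂ (le , eq) = trans (cong (λ p → does (p <? s)) eq)
  (trans (dec-false (suc (toℕ l) <? s) (λ lt → n≮n _ (≤-trans (≤-trans (s≤s (n≤1+n _)) lt) (≤-trans s≤j le))))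
    (sym (dec-false (toℕ l <? s) (λ lt → n≮n _ (≤-trans lt (≤-trans s≤j le))))))

module _ (π : Permutation′ n) (j : Fin (suc n)) (A : Subset n) (ih : image π A ≡ initial n ∣ A ∣) where

  private
    π⁺ : Permutation′ (suc n)
    π⁺ = Perm.insert zero j π

    old : ∀ i → does (toℕ (π ⟨$⟩ʳ i) <? ∣ A ∣) ≡ lookup A i
    old i = trans (sym (lookup-initial ∣ A ∣ (π ⟨$⟩ʳ i)))
      (trans (cong (λ B → lookup B (π ⟨$⟩ʳ i)) (sym ih)) (lookup-image π A i))

  insert-inside : toℕ j ≤ ∣ A ∣ → image π⁺ (inside Vec.∷ A) ≡ initial (suc n) (suc ∣ A ∣)
  insert-inside j≤ = image≡initial π⁺ (inside Vec.∷ A) (suc ∣ A ∣) λ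
    { zero → dec-true (toℕ j <? suc ∣ A ∣) (s≤s j≤)
    ; (suc i) → trans (cong (λ p → does (toℕ p <? suc ∣ A ∣)) (Perm.insert-punchIn zero j π i))
        (trans (punchIn<-inside j (π ⟨$⟩ʳ i) j≤) (old i)) }

  insert-outside : ∣ A ∣ ≤ toℕ j → image π⁺ (outside Vec.∷ A) ≡ initial (suc n) ∣ A ∣
  insert-outside ≤j = image≡initial π⁺ (outside Vec.∷ A) ∣ A ∣ λ
    { zero → dec-false (toℕ j <? ∣ A ∣) (≤⇒≯ ≤j)
    ; (suc i) → trans (cong (λ p → does (toℕ p <? ∣ A ∣)) (Perm.insert-punchIn zero j π i))
        (trans (punchIn<-outside j (π ⟨$⟩ʳ i) ≤j) (old i)) }

-- The head point is inserted at position 0 if it belongs to both sets, at |X| if it belongs to `U`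
-- only, and at |U| if it belongs to neither; both images stay initial segments.
sort-chain : ∀ (X U : Subset n) → X Sub.⊆ U →
  ∃ λ (π : Permutation′ n) → image π X ≡ initial n ∣ X ∣ × image π U ≡ initial n ∣ U ∣
sort-chain Vec.[] Vec.[] _ = Perm.id , refl , refl
sort-chain (b Vec.∷ X) (c Vec.∷ U) bX⊆cU with sort-chain X U (drop-∷-⊆ bX⊆cU)
sort-chain (inside Vec.∷ X) (outside Vec.∷ U) bX⊆cU | _ with bX⊆cU Vec.here
... | ()
sort-chain (inside Vec.∷ X) (inside Vec.∷ U) _ | π , eqX , eqU =
  Perm.insert zero zero π , insert-inside π zero X eqX z≤n , insert-inside π zero U eqU z≤n
sort-chain (outside Vec.∷ X) (inside Vec.∷ U) bX⊆cU | π , eqX , eqU =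
  Perm.insert zero j π ,
  insert-outside π j X eqX (≤-reflexive (sym (Finₚ.toℕ-fromℕ< (s≤s (∣p∣≤n X))))) ,
  insert-inside π j U eqU (≤-trans (≤-reflexive (Finₚ.toℕ-fromℕ< (s≤s (∣p∣≤n X)))) (p⊆q⇒∣p∣≤∣q∣ (drop-∷-⊆ bX⊆cU)))
  where j = fromℕ< (s≤s (∣p∣≤n X))
sort-chain (outside Vec.∷ X) (outside Vec.∷ U) bX⊆cU | π , eqX , eqU =
  Perm.insert zero j π ,
  insert-outside π j X eqX (≤-trans (p⊆q⇒∣p∣≤∣q∣ (drop-∷-⊆ bX⊆cU)) (≤-reflexive (sym (Finₚ.toℕ-fromℕ< (s≤s (∣p∣≤n U)))))) ,
  insert-outside π j U eqU (≤-reflexive (sym (Finₚ.toℕ-fromℕ< (s≤s (∣p∣≤n U)))))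
  where j = fromℕ< (s≤s (∣p∣≤n U))

∣initial∣ : ∀ {s} → s ≤ n → ∣ initial n s ∣ ≡ s
∣initial∣ {zero} z≤n = refl
∣initial∣ {suc n} {zero} z≤n = ∣initial∣ {n} {zero} z≤n
∣initial∣ {suc n} {suc s} (s≤s s≤n) = cong suc (∣initial∣ {n} {s} s≤n)

initial-mono : ∀ {s s′} → s ≤ s′ → initial n s Sub.⊆ initial n s′
initial-mono {s = s} {s′} s≤s′ {i} i∈ = lookup⇒∈ (trans (lookup-initial s′ i)
  (dec-true (toℕ i <? s′) (≤-trans (<ᵇ⇒< (toℕ i) s (Equivalence.from Boolₚ.T-≡ (trans (sym (lookup-initial s i)) (∈⇒lookup i∈)))) s≤s′)))


-- Extremal diversity

ℒ? : ∀ k (X U V : Subset n) → Decidable (ℒ k X U V)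
ℒ? k X U V A = ∣ A ∣ ≟ k ×-dec
  ((X ⊆? A ×-dec nonempty? (A ∩ (V ─ X))) ⊎-dec Finₚ.any? (λ x → x ∈? X ×-dec (A ∩ U) ≟ₛ (U - x)))

module _ (t : ℕ) {F : Family n} (F? : Decidable F) where

  private
    sizes : List ℕ
    sizes = map (λ X → size (F? ⟨ X ⟩?)) (filter (λ X → ∣ X ∣ ≟ t) (subsets n))

  Δ-upper : ∀ X → ∣ X ∣ ≡ t → size (F? ⟨ X ⟩?) ≤ Δ t F?
  Δ-upper X X≡ = All.lookup (xs≤max 0 sizes)
    (∈-map⁺ (λ X → size (F? ⟨ X ⟩?)) (∈-filter⁺ (λ X → ∣ X ∣ ≟ t) (∈-subsets X) X≡))

  -- `max` starts from the default 0, so the value 0 need not come from a t-set.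
  Δ-attained : (Δ t F? ≡ 0) ⊎ ∃ λ X → ∣ X ∣ ≡ t × Δ t F? ≡ size (F? ⟨ X ⟩?)
  Δ-attained with argmax-sel id 0 sizes
  ... | inj₁ eq = inj₁ eq
  ... | inj₂ ∈sizes with ∈-map⁻ (λ X → size (F? ⟨ X ⟩?)) ∈sizes
  ...   | X , X∈ , eq = inj₂ (X , proj₂ (∈-filter⁻ (λ X → ∣ X ∣ ≟ t) {xs = subsets n} X∈) , eq)

  γ≤out : ∀ X → ∣ X ∣ ≡ t → γ t F? ≤ size (F? ∖? (F? ⟨ X ⟩?))
  γ≤out X X≡ = begin
    size F? ∸ Δ t F?                          ≤⟨ ∸-monoʳ-≤ (size F?) (Δ-upper X X≡) ⟩
    size F? ∸ a                               ≤⟨ ∸-monoˡ-≤ a (size≤⟨⟩+∖ F? X) ⟩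
    (a + size (F? ∖? (F? ⟨ X ⟩?))) ∸ a        ≡⟨ m+n∸m≡n a _ ⟩
    size (F? ∖? (F? ⟨ X ⟩?))                  ∎
    where
    open ≤-Reasoning
    a : ℕ
    a = size (F? ⟨ X ⟩?)

-- Lopsided families and the case of equality

module Extremal (n t m : ℕ) (2≤t : 2 ≤ t) (2≤m : 2 ≤ m) (n≥ : 7 * (m + 1) * (t + m) ^ 2 ≤ n)
  {d : ℕ} (2≤d : 2 ≤ d) (d≤ : d ≤ m + 1) where

  open Numbers n t m 2≤t 2≤m n≥
  open Bounds n t m 2≤t 2≤m n≥

  b : ℕ
  b = t * β d

  b≤t*c₂ : 3 ≤ d → b ≤ t * c₂
  b≤t*c₂ 3≤d = *-monoʳ-≤ t (≤-trans (β-mono 3≤d) β₃≤c₂)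

  0<b : 0 < b
  0<b = *-mono-≤ (≤-trans (s≤s z≤n) 2≤t) (β>0 d≤)

  -- Among the sets counted by σ d are those through a first point of the d-set, c₁ in number, and
  -- those through a second but not the first, β 2 in number. It is the room left for the degree of
  -- a t-set other than X.
  c₁+β₂≤σ : c₁ + β 2 ≤ σ d
  c₁+β₂≤σ = ≤-trans (m+n≤o⇒m≤o∸n (c₁ + β 2) (≤-reflexive (begin
    c₁ + β 2 + (N ∸ 2) C m          ≡⟨ cong (λ x → c₁ + x + (N ∸ 2) C m) β₂≡ ⟩
    c₁ + (N ∸ 2) C (m ∸ 1) + (N ∸ 2) C m ≡⟨ +-assoc c₁ _ _ ⟩
    c₁ + ((N ∸ 2) C (m ∸ 1) + (N ∸ 2) C m) ≡⟨ cong (c₁ +_) (pascal 1 0 (≤-trans (s≤s z≤n) 2≤m) 2≤N) ⟩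
    c₁ + (N ∸ 1) C m                ≡⟨ cong (_+ (N ∸ 1) C m) (up-co 1 (≤-trans (s≤s z≤n) 2≤m)) ⟩
    (N ∸ 1) C (m ∸ 1) + (N ∸ 1) C m ≡⟨ pascal 0 0 (≤-trans (s≤s z≤n) 2≤m) (≤-trans (s≤s z≤n) 2≤N) ⟩
    N C m ∎)))
    (∸-monoʳ-≤ (N C m) (C-monoˡ-≤ m (∸-monoʳ-≤ N 2≤d)))
    where
    open ≡-Reasoning
    N : ℕ
    N = n ∸ t
    2≤N : 2 ≤ N
    2≤N = m+n≤o⇒m≤o∸n 2 (≤-trans (≤-trans (+-monoˡ-≤ t 2≤m) (≤-reflexive (+-comm m t))) (<⇒≤ k<n))
    pascal : ∀ i j → suc j ≤ m → suc i ≤ N → (N ∸ suc i) C (m ∸ suc j) + (N ∸ suc i) C (m ∸ j) ≡ (N ∸ i) C (m ∸ j)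
    pascal i j j<m i<N = begin
      (N ∸ suc i) C (m ∸ suc j) + (N ∸ suc i) C (m ∸ j)
        ≡⟨ cong (λ x → (N ∸ suc i) C (m ∸ suc j) + (N ∸ suc i) C x) (+-∸-assoc 1 {m} {suc j} j<m) ⟩
      (N ∸ suc i) C (m ∸ suc j) + (N ∸ suc i) C suc (m ∸ suc j)
        ≡⟨ nCk+nC[k+1]≡[n+1]C[k+1] (N ∸ suc i) (m ∸ suc j) ⟩
      suc (N ∸ suc i) C suc (m ∸ suc j)
        ≡⟨ sym (cong₂ _C_ (+-∸-assoc 1 {N} {suc i} i<N) (+-∸-assoc 1 {m} {suc j} j<m)) ⟩
      (N ∸ i) C (m ∸ j) ∎
    -- Obtained by comparing two Pascal splittings of c₁ and cancelling c₂.
    β₂≡ : β 2 ≡ (N ∸ 2) C (m ∸ 1)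
    β₂≡ = +-cancelʳ-≡ c₂ _ _ (begin
      β 2 + c₂                              ≡⟨ sym c₁≡β₂+c₂ ⟩
      c₁                                    ≡⟨ up-co 1 (≤-trans (s≤s z≤n) 2≤m) ⟩
      (N ∸ 1) C (m ∸ 1)                     ≡⟨ sym (pascal 1 1 2≤m 2≤N) ⟩
      (N ∸ 2) C (m ∸ 2) + (N ∸ 2) C (m ∸ 1) ≡⟨ +-comm ((N ∸ 2) C (m ∸ 2)) _ ⟩
      (N ∸ 2) C (m ∸ 1) + (N ∸ 2) C (m ∸ 2) ≡⟨ cong ((N ∸ 2) C (m ∸ 1) +_) (sym (up-co 2 2≤m)) ⟩
      (N ∸ 2) C (m ∸ 1) + c₂ ∎)

  module Lopsided {X U : Subset n} (X⊆U : X Sub.⊆ U) (X≡ : ∣ X ∣ ≡ t) (U≡ : ∣ U ∣ ≡ t + d) where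

    Star : Family n
    Star A = ∣ A ∣ ≡ k × X Sub.⊆ A × Nonempty (A ∩ (U ─ X))

    Star? : Decidable Star
    Star? A = ∣ A ∣ ≟ k ×-dec X ⊆? A ×-dec nonempty? (A ∩ (U ─ X))

    ∣U─X∣ : ∣ U ─ X ∣ ≡ d
    ∣U─X∣ = +-cancelˡ-≡ t _ _ (trans (cong (_+ ∣ U ─ X ∣) (sym (trans (cong ∣_∣ (⊆-antisym {i = U ∩ X} {X} (p∩q⊆q U X) (λ x∈ → x∈p∩q⁺ (X⊆U x∈ , x∈)))) X≡)))
      (trans (∣p∩q∣+∣p─q∣≡∣p∣ U X) U≡))

    size-Star : size Star? ≤ σ d
    size-Star = m+n≤o⇒m≤o∸n (size Star?) (begin
      size Star? + (n ∸ t ∸ d) C m           ≡⟨ cong (size Star? +_) (sym avoid≡) ⟩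
      size Star? + size Avoid?               ≤⟨ size-split (Interval? k X Sub.⊤) Star? Avoid?
                                                  (λ (e , l , _) → e , l , λ _ → ∈⊤) (λ (e , l , _) → e , l , λ _ → ∈⊤)
                                                  (λ {A} (_ , _ , y , y∈) (_ , _ , u) → let y∈A , y∈D = x∈p∩q⁻ A (U ─ X) y∈ in
                                                     x∈p⇒x∉∁p y∈D (u y∈A)) ⟩
      size (Interval? k X Sub.⊤)             ≤⟨ size-Interval-⊤≤ X k ⟩
      (n ∸ ∣ X ∣) C (n ∸ k)                  ≡⟨ cong up X≡ ⟩
      up t                                   ≡⟨ up-co 0 z≤n ⟩
      (n ∸ t) C m                            ∎)
      where
      open ≤-Reasoning
      Avoid? : Decidable (Interval k X (∁ (U ─ X)))
      Avoid? = Interval? k X (∁ (U ─ X))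
      ∣∁∣ : ∣ ∁ (U ─ X) ∣ ≡ n ∸ d
      ∣∁∣ = trans (∣∁p∣≡n∸∣p∣ (U ─ X)) (cong (n ∸_) ∣U─X∣)
      k+d≤n : k + d ≤ n
      k+d≤n = begin
        k + d                          ≤⟨ +-monoʳ-≤ k d≤ ⟩
        k + (m + 1)                    ≤⟨ +-monoʳ-≤ k (m≤m*n (m + 1) (4 * (k * k)) {{m*n≢0 4 (k * k) {{_}} {{m*n≢0 k k {{k≢0}} {{k≢0}}}}}}) ⟩
        k + (m + 1) * (4 * (k * k))    ≡⟨ cong (k +_) (lemma (m + 1) (k * k)) ⟩
        k + 4 * ((m + 1) * (k * k))    ≤⟨ k+4[m+1]kk≤n ⟩
        n                              ∎
        where
        lemma : ∀ a b → a * (4 * b) ≡ 4 * (a * b)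
        lemma = solve-∀
      avoid≡ : size Avoid? ≡ (n ∸ t ∸ d) C m
      avoid≡ = begin-equality
        size Avoid?  ≡⟨ size-Interval k X (∁ (U ─ X)) (λ x∈ → x∉p⇒x∈∁p (λ x∈D → x∈p─q⇒x∉q U X x∈D x∈))
                          (≤-trans (m+n≤o⇒m≤o∸n k k+d≤n) (≤-reflexive (sym ∣∁∣))) ⟩
        (∣ ∁ (U ─ X) ∣ ∸ ∣ X ∣) C (∣ ∁ (U ─ X) ∣ ∸ k) ≡⟨ cong₂ (λ u x → (u ∸ x) C (u ∸ k)) ∣∁∣ X≡ ⟩
        (n ∸ d ∸ t) C (n ∸ d ∸ k)                     ≡⟨ cong₂ _C_ (∸-comm n d t) co ⟩
        (n ∸ t ∸ d) C ((n ∸ t ∸ d) ∸ m)               ≡⟨ sym (nCk≡nC[n∸k] m≤) ⟩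
        (n ∸ t ∸ d) C m                               ∎
        where
        ∸-comm : ∀ a b c → a ∸ b ∸ c ≡ a ∸ c ∸ b
        ∸-comm a b c = trans (∸-+-assoc a b c) (trans (cong (a ∸_) (+-comm b c)) (sym (∸-+-assoc a c b)))
        co : n ∸ d ∸ k ≡ n ∸ t ∸ d ∸ m
        co = trans (sym (∸-+-assoc (n ∸ d) t m)) (cong (_∸ m) (∸-comm n d t))
        m≤ : m ≤ n ∸ t ∸ d
        m≤ = m+n≤o⇒m≤o∸n m (m+n≤o⇒m≤o∸n (m + d) (≤-trans (≤-reflexive (trans (+-comm (m + d) t) (sym (+-assoc t m d)))) k+d≤n))

    Petal : Fin n → Family n
    Petal x A = Interval k (U - x) (∁ ⁅ x ⁆) A

    Petal? : ∀ x → Decidable (Petal x)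
    Petal? x = Interval? k (U - x) (∁ ⁅ x ⁆)

    size-Petal : ∀ x → x ∈ X → size (Petal? x) ≤ β d
    size-Petal x x∈ = ≤-trans (size-Interval-∁⁅⁆≤ k (U - x) x)
      (≤-reflexive (cong (λ a → (n ∸ a) C (n ∸ suc k)) (trans (x∈p⇒suc∣p-x∣≡∣p∣ (X⊆U x∈)) U≡)))

    petal : ∀ {A} x → ∣ A ∣ ≡ k → x ∈ X → A ∩ U ≡ U - x → Petal x A
    petal {A} x A≡ x∈ eq = A≡ ,
      (λ y∈ → proj₁ (x∈p∩q⁻ A U (subst (_ ∈_) (sym eq) y∈))) ,
      (λ {y} y∈ → x∉p⇒x∈∁p (λ y∈x → let y≡x = x∈⁅y⁆⇒x≡y x y∈x in
        x∈p─q⇒x∉q U ⁅ x ⁆ (subst (y ∈_) eq (x∈p∩q⁺ (y∈ , subst (_∈ U) (sym y≡x) (X⊆U x∈)))) y∈x))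

    size-ℒ≤ : size (ℒ? k X U U) ≤ σ d + b
    size-ℒ≤ = ≤-trans (size-cover (ℒ? k X U U) Star? petals? (λ {A} → split A))
      (+-mono-≤ size-Star (≤-trans
        (size-⋃-∈ petals? Petal? (β d) X (λ (x , x∈ , p) → x , x∈ , p) size-Petal)
        (≤-reflexive (cong (_* β d) X≡))))
      where
      petals? : Decidable (λ A → ∃ λ x → x ∈ X × Petal x A)
      petals? A = Finₚ.any? (λ x → x ∈? X ×-dec Petal? x A)
      split : ∀ A → ℒ k X U U A → Star A ⊎ ∃ λ x → x ∈ X × Petal x A
      split A (A≡ , inj₁ (X⊆A , ne)) = inj₁ (A≡ , X⊆A , ne)
      split A (A≡ , inj₂ (x , x∈ , eq)) = inj₂ (x , x∈ , petal x A≡ x∈ eq)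

    module _ {F : Family n} (F? : Decidable F) (F⊆ℒ : F ⊆ ℒ k X U U) where

      module _ {Y : Subset n} (Y≡ : ∣ Y ∣ ≡ t) where

        petals? : Decidable (λ A → F A × ∃ λ x → x ∈ X ─ Y × Petal x A × Y Sub.⊆ A)
        petals? A = F? A ×-dec Finₚ.any? (λ x → x ∈? (X ─ Y) ×-dec Petal? x A ×-dec Y ⊆? A)

        split : ∀ A → (F ⟨ Y ⟩) A → Star A ⊎ (F A × ∃ λ x → x ∈ X ─ Y × Petal x A × Y Sub.⊆ A)
        split A (FA , Y⊆A) with F⊆ℒ FA
        ... | A≡ , inj₁ (X⊆A , ne) = inj₁ (A≡ , X⊆A , ne)
        ... | A≡ , inj₂ (x , x∈ , eq) = let p = petal x A≡ x∈ eq in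
          inj₂ (FA , x , x∈p∧x∉q⇒x∈p─q x∈ (λ x∈Y → x∈∁p⇒x∉p (proj₂ (proj₂ p) (Y⊆A x∈Y)) (x∈⁅x⁆ x)) , p , Y⊆A)

        ∣X─Y∣≡∣Y─X∣ : ∣ X ─ Y ∣ ≡ ∣ Y ─ X ∣
        ∣X─Y∣≡∣Y─X∣ = +-cancelˡ-≡ ∣ X ∩ Y ∣ _ _ (begin
          ∣ X ∩ Y ∣ + ∣ X ─ Y ∣ ≡⟨ ∣p∩q∣+∣p─q∣≡∣p∣ X Y ⟩
          ∣ X ∣                 ≡⟨ trans X≡ (sym Y≡) ⟩
          ∣ Y ∣                 ≡⟨ sym (∣p∩q∣+∣p─q∣≡∣p∣ Y X) ⟩
          ∣ Y ∩ X ∣ + ∣ Y ─ X ∣ ≡⟨ cong (λ I → ∣ I ∣ + ∣ Y ─ X ∣) (∩-comm Y X) ⟩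
          ∣ X ∩ Y ∣ + ∣ Y ─ X ∣ ∎)
          where open ≡-Reasoning

        common? : Decidable (λ A → Star A × Y Sub.⊆ A)
        common? A = Star? A ×-dec Y ⊆? A

        common≤ : size common? ≤ up (t + ∣ X ─ Y ∣)
        common≤ = ≤-trans
          (size-⊇≤ common? k (X ∪ Y) (λ ((A≡ , X⊆A , _) , Y⊆A) → A≡ , λ z∈ → [ X⊆A , Y⊆A ]′ (x∈p∪q⁻ X Y z∈)))
          (≤-reflexive (cong up (trans (∣p∪q∣≡∣p∣+∣q─p∣ X Y) (cong₂ _+_ X≡ (sym ∣X─Y∣≡∣Y─X∣)))))

        petals≤ : size petals? ≤ ∣ X ─ Y ∣ * β d
        petals≤ = size-⋃-∈ petals? Petal? (β d) (X ─ Y)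
          (λ (_ , x , x∈ , p , _) → x , x∈ , p) (λ x x∈ → size-Petal x (p─q⊆p X Y x∈))

        -- A petal at x that contains `Y` contains X - x together with `Y ─ X`, in all t - 1 + |Y ─
        -- X| ≥ t + 2 points.
        petals≤′ : 3 ≤ ∣ X ─ Y ∣ → size petals? ≤ t * c₂
        petals≤′ 3≤ = ≤-trans
          (size-⋃-∈ petals? (λ x → Interval? k ((X - x) ∪ (Y ─ X)) Sub.⊤) c₂ (X ─ Y)
            (λ (_ , x , x∈ , (A≡ , U-x⊆ , _) , Y⊆A) → x , x∈ , A≡ ,
              (λ z∈ → [ (λ z∈X-x → U-x⊆ (x∈p∧x∉q⇒x∈p─q (X⊆U (p─q⊆p X ⁅ x ⁆ z∈X-x)) (x∈p─q⇒x∉q X ⁅ x ⁆ z∈X-x)))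
                      , (λ z∈Y → Y⊆A (p─q⊆p Y X z∈Y)) ]′ (x∈p∪q⁻ (X - x) (Y ─ X) z∈)) , λ _ → ∈⊤)
            (λ x x∈ → ≤-trans (size-Interval-⊤≤ ((X - x) ∪ (Y ─ X)) k) (up-mono (large x (p─q⊆p X Y x∈)))))
          (*-monoˡ-≤ c₂ (≤-trans (∣p─q∣≤∣p∣ X Y) (≤-reflexive X≡)))
          where
          open ≤-Reasoning
          large : ∀ x → x ∈ X → 2 + t ≤ ∣ (X - x) ∪ (Y ─ X) ∣
          large x x∈ = s≤s⁻¹ (begin
            3 + t                                       ≡⟨ +-comm 3 t ⟩
            t + 3                                       ≤⟨ +-monoʳ-≤ t (≤-trans 3≤ (≤-reflexive ∣X─Y∣≡∣Y─X∣)) ⟩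
            t + ∣ Y ─ X ∣                               ≡⟨ cong (_+ ∣ Y ─ X ∣) (sym (trans (x∈p⇒suc∣p-x∣≡∣p∣ x∈) X≡)) ⟩
            suc (∣ X - x ∣ + ∣ Y ─ X ∣)                 ≡⟨ cong suc (sym (disjoint⇒∣p∪q∣≡∣p∣+∣q∣ (X - x) (Y ─ X)
                                                             (λ z∈ → x∈p─q⇒x∉q Y X z∈ ∘ p─q⊆p X ⁅ x ⁆))) ⟩
            suc ∣ (X - x) ∪ (Y ─ X) ∣                   ∎)

        -- Let i = |X ─ Y|. For i = 0 no petal contains `Y`. Otherwise the star contributes at most
        -- `up` (t + i), being above X ∪ Y, and only petals at points of `X ─ Y` contain `Y`. The
        -- totals are c₁ + β 2 for i = 1, c₂ + 2 β 2 for i = 2 and (t + 1)c₂ for i ≥ 3.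
        degree≤ : size (F? ⟨ Y ⟩?) ≤ σ d
        degree≤ with ∣ X ─ Y ∣ in eq
        ... | 0 = ≤-trans (size-mono (F? ⟨ Y ⟩?) Star? (λ {A} → only A)) size-Star
          where
          only : ∀ A → (F ⟨ Y ⟩) A → Star A
          only A a with split A a
          ... | inj₁ s = s
          ... | inj₂ (_ , x , x∈ , _) = contradiction (trans (x∈p⇒suc∣p-x∣≡∣p∣ x∈) eq) λ ()
        ... | suc i = ≤-trans
          (size-cover (F? ⟨ Y ⟩?) common? petals? (λ {A} a → Sum.map₁ (λ s → s , proj₂ a) (split A a)))
          (≤-trans (bound i (subst (λ j → size common? ≤ up (t + j)) eq common≤)
              (subst (λ j → size petals? ≤ j * β d) eq petals≤) (λ 3≤ → petals≤′ (subst (3 ≤_) (sym eq) 3≤)))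
            c₁+β₂≤σ)
          where
          open ≤-Reasoning
          βd≤β₂ : β d ≤ β 2
          βd≤β₂ = β-mono 2≤d
          bound : ∀ i {x y} → x ≤ up (t + suc i) → y ≤ suc i * β d → (3 ≤ suc i → y ≤ t * c₂) → x + y ≤ c₁ + β 2
          bound 0 x≤ y≤ _ = +-mono-≤ (≤-trans x≤ (≤-reflexive (cong up (+-comm t 1)))) (≤-trans y≤ (≤-trans (≤-reflexive (*-identityˡ (β d))) βd≤β₂))
          -- There is no slack here: c₂ + 2 β 2 is exactly c₁ + β 2.
          bound 1 {x} {y} x≤ y≤ _ = begin
            x + y              ≤⟨ +-mono-≤ (≤-trans x≤ (≤-reflexive (cong up (+-comm t 2)))) (≤-trans y≤ (*-monoʳ-≤ 2 βd≤β₂)) ⟩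
            c₂ + 2 * β 2       ≡⟨ lemma c₂ (β 2) ⟩
            β 2 + c₂ + β 2     ≡⟨ cong (_+ β 2) (sym c₁≡β₂+c₂) ⟩
            c₁ + β 2           ∎
            where
            lemma : ∀ a b → a + 2 * b ≡ b + a + b
            lemma = solve-∀
          bound (suc (suc i)) {x} {y} x≤ _ y≤ = begin
            x + y              ≤⟨ +-mono-≤ (≤-trans x≤ (up-mono (≤-trans (≤-reflexive (+-comm 2 t)) (+-monoʳ-≤ t (s≤s (s≤s z≤n)))))) (y≤ (s≤s (s≤s (s≤s z≤n)))) ⟩
            c₂ + t * c₂        ≡⟨⟩
            suc t * c₂         ≤⟨ *-monoˡ-≤ c₂ small ⟩
            7 * (k * k) * c₂   ≤⟨ 7kk*c₂≤c₁ ⟩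
            c₁                 ≤⟨ m≤m+n c₁ (β 2) ⟩
            c₁ + β 2           ∎
            where
            small : suc t ≤ 7 * (k * k)
            small = ≤-trans (s≤s (≤-trans (m≤n+m t ((m + 1) * (m + 1))) (m≤n+m _ 9))) (q₆ 2≤t 2≤m)

      b≤γ : σ d + b ≤ size F? → b ≤ γ t F?
      b≤γ f≥ = begin
        b                    ≡⟨ sym (m+n∸m≡n (σ d) b) ⟩
        (σ d + b) ∸ σ d      ≤⟨ ∸-mono f≥ Δ≤ ⟩
        size F? ∸ Δ t F?     ∎
        where
        open ≤-Reasoning
        Δ≤ : Δ t F? ≤ σ d
        Δ≤ with Δ-attained t F?
        ... | inj₁ eq = ≤-trans (≤-reflexive eq) z≤n
        ... | inj₂ (Y , Y≡ , eq) = ≤-trans (≤-reflexive eq) (degree≤ Y≡)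

      F≡ℒ : σ d + b ≤ size F? → ℒ k X U U ⊆ F
      F≡ℒ f≥ = size-rigid F? (ℒ? k X U U) F⊆ℒ (≤-trans size-ℒ≤ f≥)

  module _ {F : Family n} (F? : Decidable F) (uniform : F ⊆ k -subsets) (int : t -intersecting F)
    (f≥ : σ d + b ≤ size F?) (γ≡b : γ t F? ≡ b) where

    open Core n t m 2≤t 2≤m n≥ F? uniform int
    open Structure n t m 2≤t 2≤m n≥ F? uniform int

    Shape : Set
    Shape = ∃ λ X → ∃ λ U → X Sub.⊆ U × ∣ X ∣ ≡ t × ∣ U ∣ ≡ t + d × F ⊆ ℒ k X U U

    small-tail-impossible : ∀ {X} → ∣ X ∣ ≡ t → size (F? ∖? (F? ⟨ X ⟩?)) ≮ b
    small-tail-impossible {X} X≡ lt = n≮n b (≤-trans (s≤s (≤-trans (≤-reflexive (sym γ≡b)) (γ≤out t F? X X≡))) lt)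

    -- A kernel of more than d points, or a member of F[X] avoiding `D`, would push the number of
    -- members outside F[X] strictly below b, while γ is at most this number for every t-set X.
    Kernel⇒Shape : ∀ {X D} → ∣ X ∣ ≡ t → Kernel X D → d ≤ ∣ D ∣ → Shape
    Kernel⇒Shape {X} {D} X≡ K d≤D with m≤n⇒m<n∨m≡n d≤D
    ... | inj₁ d<D = ⊥-elim (small-tail-impossible X≡ (≤-trans (s≤s (≤-trans tail≤ (*-monoʳ-≤ t (β-mono d<D))))
      (*-monoʳ-< t {{>-nonZero (≤-trans (s≤s z≤n) 2≤t)}} (β-strict d≤))))
      where open Tail X≡ K
    ... | inj₂ d≡D with anySubset? (λ B → F? B ×-dec X ⊆? B ×-dec ¬? (nonempty? (D ∩ B)))
    ...   | yes (B , FB , X⊆B , miss) = ⊥-elim (small-tail-impossible X≡ (≤-trans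
      (s≤s (tail-missed≤ FB X⊆B (λ {y} y∈D y∈B → miss (y , x∈p∩q⁺ (y∈D , y∈B)))))
      (subst (λ e → t * ((m + 1) * up (t + e)) < b) d≡D (*-monoʳ-< t {{>-nonZero (≤-trans (s≤s z≤n) 2≤t)}} ([m+1]*up<β d≤)))))
      where open Tail X≡ K
    ...   | no none = X , X ∪ D , p⊆p∪q D , X≡ ,
      trans (disjoint⇒∣p∪q∣≡∣p∣+∣q∣ X D disjoint) (cong₂ _+_ X≡ (sym d≡D)) ,
      λ {S} FS → shape S FS
      where
      open Kernel K
      open Tail X≡ K
      shape : ∀ S → F S → ℒ k X (X ∪ D) (X ∪ D) S
      shape S FS with X ⊆? S
      ... | yes X⊆S with nonempty? (D ∩ S)
      ...   | no miss = ⊥-elim (none (S , FS , X⊆S , miss))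
      ...   | yes (y , y∈) = let y∈D , y∈S = x∈p∩q⁻ D S y∈ in
        uniform FS , inj₁ (X⊆S , y , x∈p∩q⁺ (y∈S , x∈p∧x∉q⇒x∈p─q (q⊆p∪q X D y∈D) (disjoint y∈D)))
      shape S FS | no X⊈S =
        let x , x∈ , x∉ , c⊆ = outside-core {S} (FS , λ (_ , X⊆S) → X⊈S X⊆S) in
        uniform FS , inj₂ (x , x∈ , ⊆-antisym
          (λ z∈ → let z∈S , z∈U = x∈p∩q⁻ S (X ∪ D) z∈ in x∈p∧x≢y⇒x∈p-y z∈U (λ { refl → x∉ z∈S }))
          (λ z∈ → let z∈U = p─q⊆p (X ∪ D) ⁅ x ⁆ z∈ in x∈p∩q⁺ (c⊆ (x∈p∪q⁺ (Sum.map₁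
            (λ z∈X → x∈p∧x∉q⇒x∈p─q z∈X (x∈p─q⇒x∉q (X ∪ D) ⁅ x ⁆ z∈)) (x∈p∪q⁻ X D z∈U))) , z∈U)))

    Heavy⇒Shape : ∀ {X} → Heavy X → (∀ {D} → Kernel X D → d ≤ ∣ D ∣) → Shape
    Heavy⇒Shape {X} heavy@(X≡ , _) d≤D with kernel heavy
    ... | inj₂ (D , K) = Kernel⇒Shape X≡ K (d≤D K)
    ... | inj₁ trivial = ⊥-elim (small-tail-impossible X≡ (subst (_< b)
      (sym (size-empty (F? ∖? (F? ⟨ X ⟩?)) (λ (FS , ¬FX) → ¬FX (FS , trivial FS)))) 0<b))

    -- For any t-subset X of Z, 𝒜(Z) lies in the lopsided family with U = V = Z, so for d = 2 this
    -- alternative also leads to the extremal shape.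
    Book⇒Shape : d ≡ 2 → ∀ {Z} → Book Z → Shape
    Book⇒Shape d≡2 {Z} (Z≡ , covered) with t-subset Z t (≤-trans (m≤m+n t 2) (≤-reflexive (sym Z≡)))
    ... | X , X⊆Z , X≡ = X , Z , X⊆Z , X≡ , trans Z≡ (cong (t +_) (sym d≡2)) , λ {S} FS → shape S FS
      where
      shape : ∀ S → F S → ℒ k X Z Z S
      shape S FS with X ⊆? S
      ... | no X⊈S = let x , x∈ , x∉ = ⊈⇒∃ X⊈S in
        uniform FS , inj₂ (x , x∈ , ⊆-antisym
          (λ z∈ → let z∈S , z∈Z = x∈p∩q⁻ S Z z∈ in x∈p∧x≢y⇒x∈p-y z∈Z (λ { refl → x∉ z∈S }))
          (λ z∈ → x∈p∩q⁺ (remove-⊆ (X⊆Z x∈) x∉ (≤-reflexive (trans Z≡ (+-suc t 1))) (covered S FS) z∈ , p─q⊆p Z ⁅ x ⁆ z∈)))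
      ... | yes X⊆S with nonempty? ((S ∩ Z) ─ X)
      ...   | yes (z , z∈) = let z∈S , z∈Z = x∈p∩q⁻ S Z (p─q⊆p (S ∩ Z) X z∈) in
        uniform FS , inj₁ (X⊆S , z , x∈p∩q⁺ (z∈S , x∈p∧x∉q⇒x∈p─q z∈Z (x∈p─q⇒x∉q (S ∩ Z) X z∈)))
      ...   | no none = contradiction (≤-trans (≤-reflexive (+-comm 1 t)) (≤-trans (covered S FS) (≤-trans (p⊆q⇒∣p∣≤∣q∣ (─-Empty⇒⊆ none)) (≤-reflexive X≡)))) (n≮n t)

    -- For d ≥ 3 the equality γ = b leaves at most t c₂ members outside the most popular t-set, so
    -- this set is heavy without any peeling.
    Δ-heavy : 3 ≤ d → ∃ λ X → Heavy X × size F? ≤ ∣⟨ X ⟩∣ + t * c₂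
    Δ-heavy 3≤d with Δ-attained t F?
    ... | inj₁ Δ≡0 = ⊥-elim (squeeze 2 (size F?) 9 ((m + 1) * (m + 1) + t) (size≥3 2≤d f≥) (begin
      size F?                                   ≡⟨ sym (cong (size F? ∸_) Δ≡0) ⟩
      γ t F?                                    ≡⟨ γ≡b ⟩
      b                                         ≤⟨ b≤t*c₂ 3≤d ⟩
      t * c₂                                    ≤⟨ *-monoˡ-≤ c₂ (m≤n+m t ((m + 1) * (m + 1))) ⟩
      ((m + 1) * (m + 1) + t) * c₂              ≤⟨ m≤n+m _ (2 * c₁) ⟩
      2 * c₁ + ((m + 1) * (m + 1) + t) * c₂     ∎) (q₆ 2≤t 2≤m))
      where open ≤-Reasoning
    ... | inj₂ (X , X≡ , Δ≡) = X , (X≡ , ≰⇒> light) , f≤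
      where
      open ≤-Reasoning
      f≤ : size F? ≤ ∣⟨ X ⟩∣ + t * c₂
      f≤ = begin
        size F?                        ≤⟨ m≤n+m∸n (size F?) (Δ t F?) ⟩
        Δ t F? + (size F? ∸ Δ t F?)    ≤⟨ +-mono-≤ (≤-reflexive Δ≡) (≤-trans (≤-reflexive γ≡b) (b≤t*c₂ 3≤d)) ⟩
        ∣⟨ X ⟩∣ + t * c₂               ∎
      lemma : ∀ a b t c → a + (a + b * c + t * c) ≡ 2 * a + (b + t) * c
      lemma = solve-∀
      light : ∣⟨ X ⟩∣ ≰ c₁ + (m + 1) * (m + 1) * c₂
      light le = squeeze 2 (size F?) 9 ((m + 1) * (m + 1) + t) (size≥3 2≤d f≥) (begin
        size F?                                             ≤⟨ f≤ ⟩
        ∣⟨ X ⟩∣ + t * c₂                                    ≤⟨ +-monoˡ-≤ (t * c₂) le ⟩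
        c₁ + (m + 1) * (m + 1) * c₂ + t * c₂                ≤⟨ m≤n+m _ c₁ ⟩
        c₁ + (c₁ + (m + 1) * (m + 1) * c₂ + t * c₂)         ≡⟨ lemma c₁ ((m + 1) * (m + 1)) t c₂ ⟩
        2 * c₁ + ((m + 1) * (m + 1) + t) * c₂               ∎) (q₆ 2≤t 2≤m)

    shape : Shape
    shape with m≤n⇒m<n∨m≡n 2≤d
    ... | inj₁ 3≤d = let X , heavy , f≤ = Δ-heavy 3≤d in Heavy⇒Shape heavy (λ K → Kernel⇒d≤∣D∣ 2≤d f≥ K f≤)
    -- For d = 2, b is of order c₁ and says too little about the most popular t-set, so the heavy
    -- set or the book comes from `stability`.
    ... | inj₂ 2≡d with stability (size≥3 2≤d f≥)
    ...   | inj₁ (X , heavy) = Heavy⇒Shape heavy (λ K → ≤-trans (≤-reflexive (sym 2≡d)) (Kernel.2≤∣D∣ K))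
    ...   | inj₂ (Z , book) = Book⇒Shape (sym 2≡d) book

    γ≡b⇒≅ : F ≅ ℒ[ n , k , t , d , d ]
    γ≡b⇒≅ with shape
    ... | X , U , X⊆U , X≡ , U≡ , F⊆ℒ with sort-chain X U X⊆U
    ...   | π , eqX , eqU = π , λ A → mk⇔
      (λ FA → subst₂ (λ I J → ℒ k I J J (image π A)) eqX′ eqU′ (Equivalence.to (ℒ-image π k) (F⊆ℒ FA)))
      (λ LA → F≡ℒ F? F⊆ℒ f≥ (Equivalence.from (ℒ-image π k) (subst₂ (λ I J → ℒ k I J J (image π A)) (sym eqX′) (sym eqU′) LA)))
      where
      open Lopsided X⊆U X≡ U≡
      eqX′ : image π X ≡ initial n t
      eqX′ = trans eqX (cong (initial n) X≡)
      eqU′ : image π U ≡ initial n (t + d)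
      eqU′ = trans eqU (cong (initial n) U≡)

  -- Pulling the initial segments back along π places F inside a lopsided family, to which `b≤γ`
  -- applies.
  ≅⇒b≤γ : {F : Family n} (F? : Decidable F) → σ d + b ≤ size F? → F ≅ ℒ[ n , k , t , d , d ] → b ≤ γ t F?
  ≅⇒b≤γ {F} F? f≥ (π , iso) = b≤γ F? (λ {A} FA → Equivalence.from (ℒ-image π k)
      (subst₂ (λ I J → ℒ k I J J (image π A)) (sym (image-flip π (initial n t))) (sym (image-flip π (initial n (t + d))))
        (Equivalence.to (iso A) FA))) f≥
    where
    t+d≤n : t + d ≤ n
    t+d≤n = ≤-trans (+-monoʳ-≤ t d≤) (≤-trans (≤-reflexive (trans (sym (+-assoc t m 1)) (+-comm k 1))) k<n)
    open Lopsided {image (Perm.flip π) (initial n t)} {image (Perm.flip π) (initial n (t + d))}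
      (image-mono (Perm.flip π) (initial-mono (m≤m+n t d)))
      (trans (∣image∣ (Perm.flip π) (initial n t)) (∣initial∣ (≤-trans (m≤m+n t d) t+d≤n)))
      (trans (∣image∣ (Perm.flip π) (initial n (t + d))) (∣initial∣ t+d≤n))

-- From integer to natural binomial coefficients

[+a]-[+b] : ∀ a b → (b ≤ a × ℤ.+ a ℤ.- ℤ.+ b ≡ ℤ.+ (a ∸ b)) ⊎ (a < b × ∃ λ e → ℤ.+ a ℤ.- ℤ.+ b ≡ ℤ.-[1+ e ])
[+a]-[+b] a b with b ≤? a
... | yes b≤a = inj₁ (b≤a , trans (ℤₚ.m-n≡m⊖n a b) (ℤₚ.⊖-≥ b≤a))
... | no b≰a with b ∸ a in eq
...   | zero  = contradiction (m∸n≡0⇒m≤n eq) b≰a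
...   | suc e = inj₂ (≰⇒> b≰a , e ,
  trans (ℤₚ.m-n≡m⊖n a b) (trans (ℤₚ.⊖-< (≰⇒> b≰a)) (cong (λ x → ℤ.- (ℤ.+ x)) eq)))

module Binomials (n t m d : ℕ) (2≤t : 2 ≤ t) (2≤m : 2 ≤ m) (n≥ : 7 * (m + 1) * (t + m) ^ 2 ≤ n) where

  open Numbers n t m 2≤t 2≤m n≥
  open Bounds n t m 2≤t 2≤m n≥

  n-t k-t : ℤ.ℤ
  n-t = ℤ.+ n ℤ.- ℤ.+ t
  k-t = ℤ.+ k ℤ.- ℤ.+ t

  n-t≡ : n-t ≡ ℤ.+ (n ∸ t)
  n-t≡ = trans (ℤₚ.m-n≡m⊖n n t) (ℤₚ.⊖-≥ (≤-trans (m≤m+n t m) (<⇒≤ k<n)))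

  k-t≡ : k-t ≡ ℤ.+ m
  k-t≡ = trans (ℤₚ.m-n≡m⊖n k t) (trans (ℤₚ.⊖-≥ (m≤m+n t m)) (cong ℤ.+_ (m+n∸m≡n t m)))

  binom-σ : binom n-t k-t ∸ binom (n-t ℤ.- ℤ.+ d) k-t ≡ σ d
  binom-σ = cong₂ _∸_ (cong₂ binom n-t≡ k-t≡)
    (trans (cong₂ (λ x y → binom (x ℤ.- ℤ.+ d) y) n-t≡ k-t≡) ([ pos , neg ]′ ([+a]-[+b] (n ∸ t) d)))
    where
    pos : d ≤ n ∸ t × ℤ.+ (n ∸ t) ℤ.- ℤ.+ d ≡ ℤ.+ (n ∸ t ∸ d) →
      binom (ℤ.+ (n ∸ t) ℤ.- ℤ.+ d) (ℤ.+ m) ≡ (n ∸ t ∸ d) C m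
    pos (_ , eq) = cong (λ x → binom x (ℤ.+ m)) eq
    neg : n ∸ t < d × (∃ λ e → ℤ.+ (n ∸ t) ℤ.- ℤ.+ d ≡ ℤ.-[1+ e ]) →
      binom (ℤ.+ (n ∸ t) ℤ.- ℤ.+ d) (ℤ.+ m) ≡ (n ∸ t ∸ d) C m
    -- Truncation makes the natural upper index 0, and m is positive, so both binomials vanish.
    neg (lt , e , eq) = trans (cong (λ x → binom x (ℤ.+ m)) eq)
      (sym (trans (cong (_C m) (m≤n⇒m∸n≡0 (<⇒≤ lt))) (k>n⇒nCk≡0 (≤-trans (s≤s z≤n) 2≤m))))

  binom-β : binom (n-t ℤ.- ℤ.+ d) (k-t ℤ.- ℤ.+ d ℤ.+ ℤ.+ 1) ≡ β d
  binom-β = trans (cong₂ binom (cong (λ x → x ℤ.- ℤ.+ d) n-t≡) bottom) (by-signs ([+a]-[+b] (n ∸ t) d) ([+a]-[+b] (m + 1) d))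
    where
    bottom : k-t ℤ.- ℤ.+ d ℤ.+ ℤ.+ 1 ≡ ℤ.+ (m + 1) ℤ.- ℤ.+ d
    bottom = trans (cong (λ x → x ℤ.- ℤ.+ d ℤ.+ ℤ.+ 1) k-t≡)
      (trans (ℤₚ.+-assoc (ℤ.+ m) (ℤ.- ℤ.+ d) (ℤ.+ 1))
        (trans (cong (λ x → ℤ.+ m ℤ.+ x) (ℤₚ.+-comm (ℤ.- ℤ.+ d) (ℤ.+ 1))) (sym (ℤₚ.+-assoc (ℤ.+ m) (ℤ.+ 1) (ℤ.- ℤ.+ d)))))
    1+k≡ : suc k ≡ t + (m + 1)
    1+k≡ = trans (+-comm 1 k) (+-assoc t m 1)
    0<n∸[1+k] : 0 < n ∸ suc k
    0<n∸[1+k] = m<n⇒0<n∸m 2+k≤n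
    by-signs : ∀ {x y} →
      (d ≤ n ∸ t × x ≡ ℤ.+ (n ∸ t ∸ d)) ⊎ (n ∸ t < d × ∃ λ e → x ≡ ℤ.-[1+ e ]) →
      (d ≤ m + 1 × y ≡ ℤ.+ (m + 1 ∸ d)) ⊎ (m + 1 < d × ∃ λ e → y ≡ ℤ.-[1+ e ]) →
      binom x y ≡ β d
    by-signs (inj₁ (_ , refl)) (inj₁ (d≤ , refl)) = begin
      (n ∸ t ∸ d) C (m + 1 ∸ d)                       ≡⟨ nCk≡nC[n∸k] (∸-monoˡ-≤ d m+1≤N) ⟩
      (n ∸ t ∸ d) C ((n ∸ t ∸ d) ∸ (m + 1 ∸ d))       ≡⟨ cong₂ _C_ (∸-+-assoc n t d) eq ⟩
      (n ∸ (t + d)) C (n ∸ suc k)                     ∎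
      where
      open ≡-Reasoning
      m+1≤N : m + 1 ≤ n ∸ t
      m+1≤N = m+n≤o⇒m≤o∸n (m + 1) (≤-trans (≤-reflexive (trans (+-comm (m + 1) t) (sym 1+k≡))) k<n)
      eq : (n ∸ t ∸ d) ∸ (m + 1 ∸ d) ≡ n ∸ suc k
      eq = begin
        (n ∸ t ∸ d) ∸ (m + 1 ∸ d)   ≡⟨ ∸-+-assoc (n ∸ t) d (m + 1 ∸ d) ⟩
        n ∸ t ∸ (d + (m + 1 ∸ d))   ≡⟨ cong (n ∸ t ∸_) (m+[n∸m]≡n d≤) ⟩
        n ∸ t ∸ (m + 1)             ≡⟨ ∸-+-assoc n t (m + 1) ⟩
        n ∸ (t + (m + 1))           ≡⟨ cong (n ∸_) (sym 1+k≡) ⟩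
        n ∸ suc k                   ∎
    -- With d > m + 1 the integer lower index is negative; on the natural side t + d > k + 1 puts
    -- the upper index below the lower one.
    by-signs (inj₁ (d≤N , refl)) (inj₂ (m+1<d , e , refl)) = sym (k>n⇒nCk≡0
      (∸-monoʳ-< (≤-trans (s≤s (≤-reflexive 1+k≡)) (≤-trans (≤-reflexive (sym (+-suc t (m + 1)))) (+-monoʳ-≤ t m+1<d)))
        (≤-trans (+-monoʳ-≤ t d≤N) (≤-reflexive (m+[n∸m]≡n (≤-trans (m≤m+n t m) (<⇒≤ k<n)))))))
    -- Here n - (t + d) truncates to 0, while n - (k + 1) is positive.
    by-signs (inj₂ (N<d , e , refl)) _ = sym (trans
      (cong (_C (n ∸ suc k)) (trans (sym (∸-+-assoc n t d)) (m≤n⇒m∸n≡0 (<⇒≤ N<d))))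
      (k>n⇒nCk≡0 0<n∸[1+k]))

-- `b` is a parameter, so that the result can be transported along `binom-β` from natural to integer
-- binomials in one step.
Conclusion : (n k t d : ℕ) {F : Family n} → Decidable F → ℕ → Set
Conclusion n k t d {F} F? b =
  ( ( γ t F? ≤ b × ∃ λ (X : Subset n) → ∣ X ∣ ≡ t × size (F? ∖? (F? ⟨ X ⟩?)) ≤ b )
  ⊎ ( d ≤ t + 2 × ∃ λ (Z : Subset n) → ∣ Z ∣ ≡ t + 2 × F ⊆ 𝒜 k t Z ) )
  × ( d ≤ k ∸ t + 1 → γ t F? ≤ b → (γ t F? ≡ b ⇔ F ≅ ℒ[ n , k , t , d , d ]) )

module _ (n t m d : ℕ) (2≤t : 2 ≤ t) (2≤m : 2 ≤ m) (n≥ : 7 * (m + 1) * (t + m) ^ 2 ≤ n) (2≤d : 2 ≤ d) where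

  open Numbers n t m 2≤t 2≤m n≥
  open Bounds n t m 2≤t 2≤m n≥

  conclusion : {F : Family n} (F? : Decidable F) → F ⊆ k -subsets → t -intersecting F →
    σ d + t * β d ≤ size F? → Conclusion n k t d F? (t * β d)
  conclusion F? uniform int f≥ =
    Sum.map
      (λ (X , X≡ , out≤) → ≤-trans (γ≤out t F? X X≡) out≤ , X , X≡ , out≤)
      (λ (d≤ , Z , Z≡ , covered) → d≤ , Z , Z≡ , λ {S} FS → uniform FS , covered S FS)
      (dichotomy 2≤d f≥) ,
    λ d≤k∸t+1 γ≤b → let d≤ = ≤-trans d≤k∸t+1 (≤-reflexive (cong (_+ 1) (m+n∸m≡n t m))) in mk⇔
      (Extremal.γ≡b⇒≅ n t m 2≤t 2≤m n≥ 2≤d d≤ F? uniform int f≥)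
      (λ iso → ≤-antisym γ≤b (Extremal.≅⇒b≤γ n t m 2≤t 2≤m n≥ 2≤d d≤ F? f≥ iso))
    where open Structure n t m 2≤t 2≤m n≥ F? uniform int

open ℤ using (+_)

theorem1p14 :
  ∀ (n k t d : ℕ) →
  k ≥ t + 2 → t + 2 ≥ 4 →
  n ≥ 7 * (k ∸ t + 1) * k ^ 2 →
  d ≥ 2 →
  (F : Family n) (F? : Decidable F) →
  F ⊆ k -subsets →
  t -intersecting F →
  let n-t = + n ℤ.- + t
      k-t = + k ℤ.- + t
      b = t * binom (n-t ℤ.- + d) (k-t ℤ.- + d ℤ.+ + 1)
  in
  size F? ≥ (binom n-t k-t ∸ binom (n-t ℤ.- + d) k-t) + b →
  ( ( γ t F? ≤ b
    × ∃ λ (X : Subset n) → ∣ X ∣ ≡ t × size (F? ∖? (F? ⟨ X ⟩?)) ≤ b )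
  ⊎ ( d ≤ t + 2
    × ∃ λ (Z : Subset n) → ∣ Z ∣ ≡ t + 2 × F ⊆ 𝒜 k t Z ) )
  × ( d ≤ k ∸ t + 1 → γ t F? ≤ b →
      (γ t F? ≡ b ⇔ F ≅ ℒ[ n , k , t , d , d ]) )
theorem1p14 n k t d k≥ t≥ n≥ 2≤d F F? uniform int f≥
  with m≤n⇒∃[o]m+o≡n (≤-trans (m≤m+n t 2) k≥)
... | m , refl = subst (Conclusion n (t + m) t d F?) (cong (t *_) (sym binom-β))
  (conclusion n t m d 2≤t 2≤m n≥′ 2≤d F? uniform int
    (subst₂ (λ x y → x + t * y ≤ size F?) binom-σ binom-β f≥))
  where
  2≤t : 2 ≤ t
  2≤t = +-cancelʳ-≤ 2 2 t t≥
  2≤m : 2 ≤ m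
  2≤m = +-cancelˡ-≤ t 2 m k≥
  n≥′ : 7 * (m + 1) * (t + m) ^ 2 ≤ n
  n≥′ = subst (λ x → 7 * (x + 1) * (t + m) ^ 2 ≤ n) (m+n∸m≡n t m) n≥
  open Binomials n t m d 2≤t 2≤m n≥′
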